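{- Let $t \geq 2$ be an integer and $G$ a graph. If $G$ contains no odd $K_t$ minor and contains a bipartite $K_{2t-2} + I_t$ subdivision, then there is $X \subseteq V(G)$ with $|X| \leq 2t-4$ such that $G \setminus X$ contains a bipartite block $U$ having at least $t+3$ vertices.
   Context: All graphs are finite and simple. $K_s$ is the complete graph on $s$ vertices, $I_t$ the edgeless graph on $t$ vertices, and $A+B$ is the graph obtained from the disjoint union of $A$ and $B$ by adding all edges between $V(A)$ and $V(B)$. An $H_0$-subdivision is obtained from $H_0$ by replacing its edges by internally disjoint paths; $G$ contains a bipartite $H_0$ subdivision if some subgraph of $G$ is isomorphic to an $H_0$-subdivision and is bipartite. A block is a maximal connected subgraph without a cut vertex. $G$ contains $K_t$ as an odd minor if there are vertex-disjoint trees $\{T_u\}_{u\in V(K_t)}$ in $G$ and a coloring $\alpha:\bigcup_u V(T_u)\to\{1,2\}$ such that every edge of each $T_u$ has differently colored ends, and for every edge $vw$ of $K_t$ some edge of $G$ with equally colored ends joins $V(T_v)$ and $V(T_w)$. -}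

module Defs where

open import Data.Nat using (ℕ; _<ᵇ_; _≡ᵇ_; _+_; _≤_) public
open import Data.Bool using (Bool; true; false; not; _∧_; _∨_) public
open import Data.Fin using (Fin; toℕ) public
open import Data.Fin.Subset using (Subset; _∈_; _∉_; ∣_∣) public
open import Data.List using (List; []; _∷_; _∷ʳ_; length) public
open import Data.List.Relation.Unary.Linked using (Linked) public
open import Data.List.Relation.Unary.All using (All) public
open import Data.List.Relation.Unary.Unique.Propositional using (Unique) public
import Data.List.Membership.Propositional as LMem
open import Data.Product using (Σ; ∃; ∃-syntax; _×_; _,_) public
open import Data.Sum using (_⊎_) public
open import Data.Empty using (⊥) public
open import Relation.Nullary using (¬_) public
open import Relation.Binary.PropositionalEquality using (_≡_; _≢_) public

_∈ᴸ_ : ∀ {n} → Fin n → List (Fin n) → Set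
x ∈ᴸ xs = x LMem.∈ xs

record Graph : Set where
  field
    n      : ℕ
    adj    : Fin n → Fin n → Bool
    sym    : ∀ x y → adj x y ≡ adj y x
    irrefl : ∀ x → adj x x ≡ false

module _ (G : Graph) where
  open Graph G

  Edge : Fin n → Fin n → Set
  Edge x y = adj x y ≡ true

record Sub (n : ℕ) : Set₁ where
  field
    V : Fin n → Set
    E : Fin n → Fin n → Set

open Sub public

IsSubgraphOf : (G : Graph) → (Fin (Graph.n G) → Set) → Sub (Graph.n G) → Set
IsSubgraphOf G W H =
  (∀ x → V H x → W x) ×
  (∀ x y → E H x y → Edge G x y × V H x × V H y) ×
  (∀ x y → E H x y → E H y x)

PathIn : ∀ {n} → Sub n → Fin n → Fin n → Set
PathIn H a b = Σ (List _) λ mid →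
  Unique (a ∷ mid ∷ʳ b) × Linked (E H) (a ∷ mid ∷ʳ b) × All (V H) (a ∷ mid ∷ʳ b)

Connected : ∀ {n} → Sub n → Set
Connected H = ∀ x y → V H x → V H y → x ≡ y ⊎ PathIn H x y

Acyclic : ∀ {n} → Sub n → Set
Acyclic H = ∀ x y (mid : List _) → 1 ≤ length mid →
  Unique (x ∷ mid ∷ʳ y) → Linked (E H) (x ∷ mid ∷ʳ y) → E H y x → ⊥

IsTree : ∀ {n} → Sub n → Set
IsTree H = (∃ λ x → V H x) × Connected H × Acyclic H

Delete : ∀ {n} → Sub n → Fin n → Sub n
Delete H v = record { V = λ x → V H x × x ≢ v ; E = λ x y → E H x y × x ≢ v × y ≢ v }

NoCutVertex : ∀ {n} → Sub n → Set
NoCutVertex H = ∀ v → V H v → Connected (Delete H v)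

_⊑_ : ∀ {n} → Sub n → Sub n → Set
H ⊑ H' = (∀ x → V H x → V H' x) × (∀ x y → E H x y → E H' x y)

IsBlock : (G : Graph) → (Fin (Graph.n G) → Set) → Sub (Graph.n G) → Set₁
IsBlock G W H =
  IsSubgraphOf G W H × Connected H × NoCutVertex H ×
  (∀ H' → IsSubgraphOf G W H' → Connected H' → NoCutVertex H' → H ⊑ H' → H' ⊑ H)

Bipartite : ∀ {n} → Sub n → Set
Bipartite H = ∃ λ (c : Fin _ → Bool) → ∀ x y → E H x y → c x ≢ c y

HasOddKMinor : Graph → ℕ → Set₁
HasOddKMinor G t =
  Σ (Fin t → Sub (Graph.n G)) λ T →
  Σ (Fin (Graph.n G) → Bool) λ α →
    (∀ u → IsSubgraphOf G (λ _ → Data.Unit.⊤) (T u) × IsTree (T u)) ×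
    (∀ u w x → u ≢ w → V (T u) x → V (T w) x → ⊥) ×
    (∀ u x y → E (T u) x y → α x ≢ α y) ×
    (∀ u w → u ≢ w → ∃ λ x → ∃ λ y →
        V (T u) x × V (T w) y × Edge G x y × α x ≡ α y)
  where import Data.Unit

-- Bipartite subdivisions of a pattern graph H0 on Fin m (given by a
-- Bool-valued adjacency). Each edge ij of H0 with i < j is replaced by a
-- path f i, P i j, f j in G (P i j = list of interior vertices).

HasBipartiteSubdivision : (G : Graph) → (m : ℕ) → (Fin m → Fin m → Bool) → Set
HasBipartiteSubdivision G m adjH =
  Σ (Fin m → Fin (Graph.n G)) λ f →
  Σ (Fin m → Fin m → List (Fin (Graph.n G))) λ P →
  Σ (Fin (Graph.n G) → Bool) λ c →
    (∀ i j → f i ≡ f j → i ≡ j) ×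
    (∀ i j → adjH i j ≡ true → toℕ i Data.Nat.< toℕ j →
        Unique (f i ∷ P i j ∷ʳ f j) ×
        Linked (Edge G) (f i ∷ P i j ∷ʳ f j) ×
        Linked (λ x y → c x ≢ c y) (f i ∷ P i j ∷ʳ f j) ×
        (∀ x k → x ∈ᴸ P i j → x ≢ f k)) ×
    (∀ i j i' j' → adjH i j ≡ true → toℕ i Data.Nat.< toℕ j →
        adjH i' j' ≡ true → toℕ i' Data.Nat.< toℕ j' →
        ¬ (i ≡ i' × j ≡ j') → ∀ x → x ∈ᴸ P i j → x ∈ᴸ P i' j' → ⊥)
  where import Data.Nat

-- K_s + I_r on Fin (s + r): vertices with toℕ < s form the clique part
KplusI : (s r : ℕ) → Fin (s + r) → Fin (s + r) → Bool
KplusI s r i j = not (toℕ i ≡ᵇ toℕ j) ∧ ((toℕ i <ᵇ s) ∨ (toℕ j <ᵇ s))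

mkSub : ∀ {n} → Subset n → (Fin n → Fin n → Set) → Sub n
mkSub U F = record { V = λ x → x ∈ U ; E = F }

{-# OPTIONS --safe #-}
module Submission where

-- Let c be the 2-colouring of the subdivision. Call a path between two branch vertices breaking if an alternating
-- colouring of it that agrees with c at one end disagrees with c at the other.
--
-- Either there are t − 1 disjoint breaking paths, or at most 2t − 4 vertices meet all breaking paths. To see this, take
-- two copies of G, keep each branch vertex only in the copy given by its colour, and join the copies of every other
-- vertex by a rung: a matching larger than that of the rungs yields disjoint breaking paths, and a Tutte–Berge barrier
-- (found through Gallai's relation "no maximum matching misses both vertices") yields the hitting set.
--
-- In the first case choose the paths so as to leave the subdivided edges as rarely as possible. At least t branch
-- vertices lie on none of the paths, and by minimality each subdivided edge from such a vertex f to an end e of a path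
-- meets the paths first on that path, at a vertex coloured from e as by c. So f with its subdivided edges and one of the
-- paths, attached at its start, forms a tree, and the edges running to the finishes of the other paths are monochromatic:
-- an odd K_t minor.
--
-- In the second case two clique vertices s, s' avoid the hitting set X. Starting from {s, s'}, add ears of G − X as long
-- as possible, keeping a colouring such that any two vertices are linked to s and s' by disjoint alternating walks. An
-- edge or ear violating the colouring would close a breaking path, so the result is bipartite. It is a block, because
-- no ear can be added and X with one more vertex cannot separate the remaining branch vertices. It contains those, and
-- one vertex more is gained from a triangle of subdivided edges, which cannot consist of three single edges.

open import Defs
open import Data.Nat using (zero; suc; _<_; _∸_; _*_; z≤n; s≤s; s≤s⁻¹)
import Data.Nat.Properties as ℕ
open import Data.Bool.Properties using (not-involutive; ¬-not; not-¬)
import Data.Bool.Properties as 𝔹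
open import Data.Fin using (zero; suc; _↑ˡ_; _↑ʳ_; inject≤; fromℕ<; combine; remQuot)
import Data.Fin.Properties as F
open import Data.Fin.Subset.Properties using (_∈?_; anySubset?)
open import Data.Vec using (Vec; []; _∷_; tabulate; lookup; here; there)
open import Data.Vec.Properties using (lookup∘tabulate; lookup⇒[]=; []=⇒lookup)
open import Data.List using (_++_; map; filter; allFin)
import Data.List.Properties as L
open import Data.List.Membership.Propositional using (find; lose) renaming (_∈_ to _∈ˡ_; _∉_ to _∉ˡ_)
open import Data.List.Membership.Propositional.Properties
open import Data.List.Relation.Unary.Any using (here; there)
import Data.List.Relation.Unary.Any as Any
open import Data.List.Relation.Unary.All using ([]; _∷_)
import Data.List.Relation.Unary.All as All
import Data.List.Relation.Unary.All.Properties as All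
open import Data.List.Relation.Unary.AllPairs using ([]; _∷_)
import Data.List.Relation.Unary.Unique.Propositional.Properties as Uniq
open import Data.List.Relation.Unary.Linked using ([]; [-]; _∷_)
open import Data.Product using (proj₁; proj₂; map₂)
open import Data.Sum using (inj₁; inj₂; [_,_]′)
import Data.Sum as Sum
open import Data.Empty using (⊥-elim)
open import Data.Unit using (⊤; tt)
open import Function using (_∘_; id; case_of_)
open import Relation.Nullary using (Dec; yes; no; contradiction; does)
open import Relation.Nullary.Decidable using (_×-dec_; _⊎-dec_; ¬?; map′; decidable-stable; dec-true; dec-false; toSum)
open import Relation.Binary using (DecidableEquality)
open import Relation.Binary.PropositionalEquality using (refl; sym; trans; cong; cong₂; subst; subst₂; module ≡-Reasoning)
open import Relation.Binary.Construct.Closure.ReflexiveTransitive using (Star; ε; _◅_; _◅◅_; gmap)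
import Relation.Binary.Construct.Closure.ReflexiveTransitive.Properties as Star
open import Algebra.Properties.CommutativeSemigroup ℕ.+-commutativeSemigroup using (interchange)

-- Breaking is a matter of parity, so Menger's theorem does not yield disjoint breaking paths: in
-- the double cover of `G` two paths may use different copies of one vertex, and one path may use
-- both. Matchings avoid this. A matched rung takes its vertex out of use; otherwise the two copies
-- can serve as entry and exit of a single path.
--
-- With `k` = t - 1, the constants are counts. The matching yields some g disjoint breaking paths,
-- the barrier a hitting set of at most 2g vertices; if g ≤ k - 1, this is at most 2t - 4. Of the 3t
-- - 2 branch vertices, k disjoint paths use 2k as ends and leave t, one for each tree of the minor;
-- deleting 2t - 4 vertices leaves t + 2 for the block, hence the need for one more.
--
-- Branch vertices of `I_t` are not joined to each other. Each path is therefore directed so that a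
-- start in the clique forces its finish into the clique, and free clique vertices are assigned
-- wherever an end outside the clique must be reached.

-- Duplicate-free lists, finite types and involutions

module _ {A : Set} where

  unique-⊆⇒length≤ : {xs ys : List A} → Unique xs → (∀ {x} → x ∈ˡ xs → x ∈ˡ ys) → length xs ≤ length ys
  unique-⊆⇒length≤ {[]} _ _ = z≤n
  unique-⊆⇒length≤ {x ∷ xs} {ys} (x∉ ∷ u) sub with ∈-∃++ (sub (here refl))
  ... | as , bs , refl =
    ℕ.≤-trans (s≤s (unique-⊆⇒length≤ u sub′)) (ℕ.≤-reflexive eq)
    where
    eq : suc (length (as ++ bs)) ≡ length (as ++ x ∷ bs)
    eq rewrite L.length-++ as {bs} | L.length-++ as {x ∷ bs} = sym (ℕ.+-suc (length as) (length bs))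
    sub′ : ∀ {y} → y ∈ˡ xs → y ∈ˡ as ++ bs
    sub′ y∈ with ∈-++⁻ as (sub (there y∈))
    ... | inj₁ p = ∈-++⁺ˡ p
    ... | inj₂ (here refl) = ⊥-elim (All.lookup x∉ y∈ refl)
    ... | inj₂ (there p) = ∈-++⁺ʳ as p

  unique-≈⇒length≡ : {xs ys : List A} → Unique xs → Unique ys →
    (∀ {x} → x ∈ˡ xs → x ∈ˡ ys) → (∀ {x} → x ∈ˡ ys → x ∈ˡ xs) → length xs ≡ length ys
  unique-≈⇒length≡ u v p q = ℕ.≤-antisym (unique-⊆⇒length≤ u p) (unique-⊆⇒length≤ v q)

  unique-∷ : {x : A} {xs : List A} → x ∉ˡ xs → Unique xs → Unique (x ∷ xs)
  unique-∷ x∉ u = All.tabulate (λ y∈ eq → x∉ (subst (_∈ˡ _) (sym eq) y∈)) ∷ u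

  unique-head∉ : {x : A} {xs : List A} → Unique (x ∷ xs) → x ∉ˡ xs
  unique-head∉ (p ∷ _) x∈ = All.lookup p x∈ refl

  unique-++ : {xs ys : List A} → Unique xs → Unique ys → (∀ {x} → x ∈ˡ xs → x ∉ˡ ys) → Unique (xs ++ ys)
  unique-++ u v d = Uniq.++⁺ u v (λ (p , q) → d p q)

  unique-++⁻ : (xs : List A) {ys : List A} → Unique (xs ++ ys) →
    Unique xs × Unique ys × (∀ {x} → x ∈ˡ xs → x ∉ˡ ys)
  unique-++⁻ [] u = [] , u , λ ()
  unique-++⁻ (x ∷ xs) (p ∷ u) with unique-++⁻ xs u | All.++⁻ xs p
  ... | u₁ , u₂ , d | p₁ , p₂ = p₁ ∷ u₁ , u₂ , λ where
    (here refl) y∈ → All.lookup p₂ y∈ refl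
    (there x∈) → d x∈

record Finite (A : Set) : Set where
  field
    size   : ℕ
    idx    : A → Fin size
    at     : Fin size → A
    at-idx : ∀ a → at (idx a) ≡ a
    idx-at : ∀ i → idx (at i) ≡ i

  idx-inj : ∀ {a b} → idx a ≡ idx b → a ≡ b
  idx-inj {a} {b} eq = trans (sym (at-idx a)) (trans (cong at eq) (at-idx b))

  infix 4 _≟_
  _≟_ : DecidableEquality A
  a ≟ b = map′ idx-inj (cong idx) (idx a F.≟ idx b)

  all? : {P : A → Set} → (∀ a → Dec (P a)) → Dec (∀ a → P a)
  all? {P} P? = map′ (λ h a → subst P (at-idx a) (h (idx a))) (λ h i → h (at i)) (F.all? (P? ∘ at))

  any? : {P : A → Set} → (∀ a → Dec (P a)) → Dec (∃ P)
  any? {P} P? = map′ (λ (i , p) → at i , p) (λ (a , p) → idx a , subst P (sym (at-idx a)) p) (F.any? (P? ∘ at))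

  univ : List A
  univ = map at (allFin size)

  univ-complete : ∀ a → a ∈ˡ univ
  univ-complete a = subst (_∈ˡ univ) (at-idx a) (∈-map⁺ at (∈-allFin (idx a)))

  univ-unique : Unique univ
  univ-unique = Uniq.map⁺ (λ {i} {j} eq → trans (sym (idx-at i)) (trans (cong idx eq) (idx-at j))) (Uniq.allFin⁺ size)

  anyVec? : ∀ k {P : Vec A k → Set} → (∀ v → Dec (P v)) → Dec (∃ P)
  anyVec? zero P? = map′ (λ p → [] , p) (λ { ([] , p) → p }) (P? [])
  anyVec? (suc k) P? =
    map′ (λ (a , v , p) → a ∷ v , p) (λ { (a ∷ v , p) → a , v , p })
         (any? λ a → anyVec? k λ v → P? (a ∷ v))

  -- Functions are enumerated through their vectors of values, so the predicate has to respect
  -- pointwise equality.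
  anyFun? : {P : (A → A) → Set} → (∀ f → Dec (P f)) → (∀ {f g} → (∀ x → f x ≡ g x) → P f → P g) → Dec (∃ P)
  anyFun? {P} P? resp =
    map′ (λ (v , p) → (λ a → lookup v (idx a)) , p)
         (λ (f , p) → tabulate (f ∘ at) ,
            resp (λ x → sym (trans (lookup∘tabulate (f ∘ at) (idx x)) (cong f (at-idx x)))) p)
         (anyVec? size (λ v → P? (λ a → lookup v (idx a))))

-- The elements of xs moved upwards by f are half of the elements moved by f.
module _ {A : Set} (FA : Finite A) where
  open Finite FA

  fixed : (A → A) → List A → List A
  fixed f = filter (λ x → f x ≟ x)

  raised : (A → A) → List A → List A
  raised f = filter (λ x → toℕ (idx x) ℕ.<? toℕ (idx (f x)))

  module _ (f : A → A) (inv : ∀ x → f (f x) ≡ x) {xs : List A} (u : Unique xs)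
           (closed : ∀ {x} → x ∈ˡ xs → f x ∈ˡ xs) where

    raised∈ : ∀ {x} → x ∈ˡ raised f xs → x ∈ˡ xs × toℕ (idx x) < toℕ (idx (f x))
    raised∈ = ∈-filter⁻ (λ x → toℕ (idx x) ℕ.<? toℕ (idx (f x)))

    raised-images∈ : ∀ {x} → x ∈ˡ map f (raised f xs) → x ∈ˡ xs × toℕ (idx (f x)) < toℕ (idx x)
    raised-images∈ m with ∈-map⁻ f m
    ... | y , y∈ , refl = closed (proj₁ (raised∈ y∈)) ,
      subst (λ z → toℕ (idx z) < toℕ (idx (f y))) (sym (inv y)) (proj₂ (raised∈ y∈))

    involution-halves-unique : Unique (raised f xs ++ map f (raised f xs))
    involution-halves-unique =
      unique-++ (Uniq.filter⁺ _ u)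
        (Uniq.map⁺ (λ {x} {y} eq → trans (sym (inv x)) (trans (cong f eq) (inv y))) (Uniq.filter⁺ _ u))
        (λ p q → ℕ.<-asym (proj₂ (raised∈ p)) (proj₂ (raised-images∈ q)))

    involution-count : length xs ≡ length (fixed f xs) + (length (raised f xs) + length (raised f xs))
    involution-count = begin
      length xs ≡⟨ unique-≈⇒length≡ u uni to from ⟩
      length (fixed f xs ++ halves) ≡⟨ L.length-++ (fixed f xs) ⟩
      length (fixed f xs) + length halves ≡⟨ cong (length (fixed f xs) +_)
        (trans (L.length-++ (raised f xs)) (cong (length (raised f xs) +_) (L.length-map f (raised f xs)))) ⟩
      _ ∎
      where
      open ≡-Reasoning
      halves = raised f xs ++ map f (raised f xs)
      uni : Unique (fixed f xs ++ halves)
      uni = unique-++ (Uniq.filter⁺ _ u) involution-halves-unique λ {x} p q →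
        let fx = proj₂ (∈-filter⁻ (λ x → f x ≟ x) {xs = xs} p) in
        case ∈-++⁻ (raised f xs) q of λ where
          (inj₁ r) → ℕ.<⇒≢ (proj₂ (raised∈ r)) (cong (toℕ ∘ idx) (sym fx))
          (inj₂ r) → ℕ.<⇒≢ (proj₂ (raised-images∈ r)) (cong (toℕ ∘ idx) fx)
      to : ∀ {x} → x ∈ˡ xs → x ∈ˡ fixed f xs ++ halves
      to {x} x∈ with f x ≟ x
      ... | yes p = ∈-++⁺ˡ (∈-filter⁺ _ x∈ p)
      ... | no ¬p with toℕ (idx x) ℕ.<? toℕ (idx (f x))
      ...   | yes lt = ∈-++⁺ʳ (fixed f xs) (∈-++⁺ˡ (∈-filter⁺ _ x∈ lt))
      ...   | no ge = ∈-++⁺ʳ (fixed f xs) (∈-++⁺ʳ (raised f xs)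
        (subst (_∈ˡ map f (raised f xs)) (inv x) (∈-map⁺ f (∈-filter⁺ _ (closed x∈)
          (subst (λ z → toℕ (idx (f x)) < toℕ (idx z)) (sym (inv x))
            (ℕ.≤∧≢⇒< (ℕ.≮⇒≥ ge) (λ eq → ¬p (idx-inj (F.toℕ-injective eq)))))))))
      from : ∀ {x} → x ∈ˡ fixed f xs ++ halves → x ∈ˡ xs
      from p with ∈-++⁻ (fixed f xs) p
      ... | inj₁ q = proj₁ (∈-filter⁻ (λ x → f x ≟ x) q)
      ... | inj₂ q with ∈-++⁻ (raised f xs) q
      ...   | inj₁ r = proj₁ (raised∈ r)
      ...   | inj₂ r = proj₁ (raised-images∈ r)

even≢odd : ∀ l k → suc (l + l) ≢ k + k
even≢odd l zero ()
even≢odd zero (suc k) e rewrite ℕ.+-suc k k = case e of λ ()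
even≢odd (suc l) (suc k) e rewrite ℕ.+-suc k k | ℕ.+-suc l l =
  even≢odd l k (ℕ.suc-injective (ℕ.suc-injective e))

-- Maximum matchings

module Matching {A : Set} (FA : Finite A) (E : A → A → Bool) (E-sym : ∀ x y → E x y ≡ E y x) where
  open Finite FA
  infix 4 _∈A?_
  _∈A?_ : ∀ x (xs : List A) → Dec (x ∈ˡ xs)
  x ∈A? xs = Any.any? (x ≟_) xs

  -- A matching avoiding Z, as an involution whose fixed points are the unmatched vertices.
  IsMatching : List A → (A → A) → Set
  IsMatching Z f = (∀ x → f (f x) ≡ x) × (∀ x → f x ≢ x → E x (f x) ≡ true × x ∉ˡ Z)

  unmatched : (A → A) → List A
  unmatched f = fixed FA f univ

  deficiency : (A → A) → ℕ
  deficiency f = length (unmatched f)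

  unmatched⁺ : ∀ {f x} → f x ≡ x → x ∈ˡ unmatched f
  unmatched⁺ {f} {x} = ∈-filter⁺ (λ x → f x ≟ x) (univ-complete x)

  unmatched⁻ : ∀ {f x} → x ∈ˡ unmatched f → f x ≡ x
  unmatched⁻ {f} x∈ = proj₂ (∈-filter⁻ (λ x → f x ≟ x) {xs = univ} x∈)

  unmatched-unique : ∀ f → Unique (unmatched f)
  unmatched-unique f = Uniq.filter⁺ (λ x → f x ≟ x) univ-unique

  unmatched-head : ∀ {f x y} → f y ≢ y → x ∈ˡ unmatched f → x ≢ y
  unmatched-head ¬p x∈ refl = ¬p (unmatched⁻ x∈)

  Missing : List A → ℕ → List A → (A → A) → Set
  Missing Z d xs f = IsMatching Z f × deficiency f ≤ d × All (λ x → f x ≡ x) xs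

  isMatching? : ∀ Z f → Dec (IsMatching Z f)
  isMatching? Z f = all? (λ x → f (f x) ≟ x) ×-dec
    all? (λ x → map′ (λ { (inj₁ p) ¬p → contradiction p ¬p ; (inj₂ q) _ → q })
                     (λ h → case f x ≟ x of λ { (yes p) → inj₁ p ; (no ¬p) → inj₂ (h ¬p) })
                     ((f x ≟ x) ⊎-dec ((E x (f x) 𝔹.≟ true) ×-dec ¬? (x ∈A? Z))))

  missing? : ∀ Z d xs → Dec (∃ (Missing Z d xs))
  missing? Z d xs = anyFun?
    (λ f → isMatching? Z f ×-dec ((deficiency f ℕ.≤? d) ×-dec All.all? (λ x → f x ≟ x) xs))
    (λ {f} {g} eq ((i , e) , le , al) →
      ((λ x → trans (sym (trans (cong f (eq x)) (eq (g x)))) (i x)) ,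
       (λ x ¬p → let e′ = e x (λ p → ¬p (trans (sym (eq x)) p)) in
          subst (λ y → E x y ≡ true) (eq x) (proj₁ e′) , proj₂ e′)) ,
      ℕ.≤-trans (unique-⊆⇒length≤ (unmatched-unique g)
        (λ {x} x∈ → unmatched⁺ {f} (trans (eq x) (unmatched⁻ {g} x∈)))) le ,
      All.map (λ {x} p → trans (sym (eq x)) p) al)

  Minimum : List A → ℕ → Set
  Minimum Z d = ∀ g → IsMatching Z g → d ≤ deficiency g

  minimum : ∀ Z → ∃ λ d → ∃ (Missing Z d []) × Minimum Z d
  minimum Z = descend (deficiency id) (id , ((λ _ → refl) , λ _ ¬p → contradiction refl ¬p) , ℕ.≤-refl , [])
    where
    descend : ∀ b → ∃ (Missing Z b []) → ∃ λ d → ∃ (Missing Z d []) × Minimum Z d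
    descend zero m = zero , m , λ _ _ → z≤n
    descend (suc b) m with missing? Z b []
    ... | yes m′ = descend b m′
    ... | no ¬m′ = suc b , m , λ g mg → ℕ.≰⇒> λ le → ¬m′ (g , mg , le , [])

  parity : ∀ Z f → IsMatching Z f → ∃ λ k → length univ ≡ deficiency f + (k + k)
  parity Z f (inv , _) = length (raised FA f univ) , involution-count FA f inv univ-unique (λ _ → univ-complete _)

  module Exchange (Z : List A) (d : ℕ) (min : Minimum Z d) where

    Avoidable : List A → Set
    Avoidable xs = ∃ (Missing Z d xs)

    infix 4 _~_ _~?_
    -- Gallai's relation: no maximum matching misses both.
    _~_ : A → A → Set
    x ~ y = x ≡ y ⊎ ¬ Avoidable (x ∷ y ∷ [])

    _~?_ : ∀ x y → Dec (x ~ y)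
    x ~? y = (x ≟ y) ⊎-dec ¬? (missing? Z d (x ∷ y ∷ []))

    ~-sym : ∀ {x y} → x ~ y → y ~ x
    ~-sym (inj₁ p) = inj₁ (sym p)
    ~-sym (inj₂ h) = inj₂ λ { (f , m , le , p ∷ q ∷ []) → h (f , m , le , q ∷ p ∷ []) }

    -- The matching edge at `w′` is exchanged for the edge from `w`, which `f` misses; the former
    -- partner of `w′` becomes unmatched instead. If `w′` was unmatched too, this is an
    -- augmentation.
    rematch : (w w′ : A) → (A → A) → A → A
    rematch w w′ f v with v ≟ w
    ... | yes _ = w′
    ... | no _ with v ≟ w′
    ...   | yes _ = w
    ...   | no _ with v ≟ f w′
    ...     | yes _ = v
    ...     | no _ = f v

    module Rematch {f : A → A} (mf : IsMatching Z f) {w w′ : A} (w≢w′ : w ≢ w′) (fw : f w ≡ w)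
                   (edge : E w w′ ≡ true) (w∉ : w ∉ˡ Z) (w′∉ : w′ ∉ˡ Z) where
      g : A → A
      g = rematch w w′ f

      inv = proj₁ mf

      g-w : g w ≡ w′
      g-w with w ≟ w
      ... | yes _ = refl
      ... | no ¬p = contradiction refl ¬p

      g-w′ : g w′ ≡ w
      g-w′ with w′ ≟ w
      ... | yes p = p
      ... | no _ with w′ ≟ w′
      ...   | yes _ = refl
      ...   | no ¬p = contradiction refl ¬p

      g-w″ : ∀ {v} → v ≢ w → v ≢ w′ → v ≡ f w′ → g v ≡ v
      g-w″ {v} p q r with v ≟ w
      ... | yes p′ = contradiction p′ p
      ... | no _ with v ≟ w′
      ...   | yes q′ = contradiction q′ q
      ...   | no _ with v ≟ f w′
      ...     | yes _ = refl
      ...     | no r′ = contradiction r r′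

      g-else : ∀ {v} → v ≢ w → v ≢ w′ → v ≢ f w′ → g v ≡ f v
      g-else {v} p q r with v ≟ w
      ... | yes p′ = contradiction p′ p
      ... | no _ with v ≟ w′
      ...   | yes q′ = contradiction q′ q
      ...   | no _ with v ≟ f w′
      ...     | yes r′ = contradiction r′ r
      ...     | no _ = refl

      data View (v : A) : Set where
        is-w  : v ≡ w → View v
        is-w′ : v ≡ w′ → View v
        is-w″ : v ≢ w → v ≢ w′ → v ≡ f w′ → View v
        other : v ≢ w → v ≢ w′ → v ≢ f w′ → View v

      view : ∀ v → View v
      view v with v ≟ w
      ... | yes p = is-w p
      ... | no p with v ≟ w′
      ...   | yes q = is-w′ q
      ...   | no q with v ≟ f w′
      ...     | yes r = is-w″ p q r
      ...     | no r = other p q r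

      matching : IsMatching Z g
      matching = involutive , edges
        where
        involutive : ∀ v → g (g v) ≡ v
        involutive v with view v
        ... | is-w refl = trans (cong g g-w) g-w′
        ... | is-w′ refl = trans (cong g g-w′) g-w
        ... | is-w″ p q r = trans (cong g (g-w″ p q r)) (g-w″ p q r)
        ... | other p q r = trans (cong g (g-else p q r)) (trans (g-else
          (λ e → p (trans (sym (inv v)) (trans (cong f e) fw)))
          (λ e → r (trans (sym (inv v)) (cong f e)))
          (λ e → q (trans (sym (inv v)) (trans (cong f e) (inv w′))))) (inv v))
        edges : ∀ v → g v ≢ v → E v (g v) ≡ true × v ∉ˡ Z
        edges v ne with view v
        ... | is-w refl = subst (λ y → E w y ≡ true) (sym g-w) edge , w∉
        ... | is-w′ refl = subst (λ y → E w′ y ≡ true) (sym g-w′) (trans (E-sym w′ w) edge) , w′∉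
        ... | is-w″ p q r = contradiction (g-w″ p q r) ne
        ... | other p q r = subst (λ y → E v y ≡ true × v ∉ˡ Z) (sym (g-else p q r))
          (proj₂ mf v (λ e → ne (trans (g-else p q r) e)))

      w-moved : g w ≢ w
      w-moved e = w≢w′ (sym (trans (sym g-w) e))

      w′-moved : g w′ ≢ w′
      w′-moved e = w≢w′ (trans (sym g-w′) e)

      still-unmatched : ∀ {v} → v ∈ˡ unmatched g → v ≢ f w′ → f v ≡ v
      still-unmatched {v} v∈ r =
        trans (sym (g-else (unmatched-head {g} w-moved v∈) (unmatched-head {g} w′-moved v∈) r)) (unmatched⁻ {g} v∈)

      -- Otherwise f could be augmented by the edge w w′.
      w′-matched : deficiency f ≤ d → f w′ ≢ w′
      w′-matched le e = ℕ.<⇒≱ (ℕ.≤-trans drop le) (ℕ.≤-trans (min g matching) (ℕ.n≤1+n _))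
        where
        drop : 2 + deficiency g ≤ deficiency f
        drop = unique-⊆⇒length≤ {xs = w ∷ w′ ∷ unmatched g}
          (unique-∷ (λ { (here p) → w≢w′ p ; (there q) → unmatched-head {g} w-moved q refl })
            (unique-∷ (λ q → unmatched-head {g} w′-moved q refl) (unmatched-unique g)))
          λ { (here refl) → unmatched⁺ {f} fw
            ; (there (here refl)) → unmatched⁺ {f} e
            ; (there (there v∈)) → unmatched⁺ {f} (still-unmatched v∈
                (λ r → unmatched-head {g} w′-moved v∈ (trans r e))) }

      deficiency-rematch : deficiency g ≤ deficiency f
      deficiency-rematch = s≤s⁻¹ (unique-⊆⇒length≤ {xs = w ∷ unmatched g} {f w′ ∷ unmatched f}
        (unique-∷ (λ q → unmatched-head {g} w-moved q refl) (unmatched-unique g))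
        λ { (here refl) → there (unmatched⁺ {f} fw)
          ; (there {v} v∈) → case _ ≟ f w′ of λ where
              (yes r) → here r
              (no r) → there (unmatched⁺ {f} (still-unmatched v∈ r)) })

      disagreement : (A → A) → (A → A) → List A
      disagreement h₁ h₂ = filter (λ v → ¬? (h₁ v ≟ h₂ v)) univ

      disagreement-decreases : ∀ {h} → (∀ x → h (h x) ≡ x) → h w ≡ w′ →
        length (disagreement h g) < length (disagreement h f)
      disagreement-decreases {h} h-inv hw = unique-⊆⇒length≤ {xs = w ∷ disagreement h g}
        (unique-∷ (λ q → dis⁻ q (trans hw (sym g-w))) (Uniq.filter⁺ (λ v → ¬? (h v ≟ g v)) univ-unique))
        λ { (here refl) → dis⁺ (λ e → w≢w′ (trans (sym fw) (trans (sym e) hw)))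
          ; (there {v} v∈) → dis⁺ (still v∈) }
        where
        hw′ : h w′ ≡ w
        hw′ = trans (cong h (sym hw)) (h-inv w)
        dis⁺ : ∀ {v} → h v ≢ f v → v ∈ˡ disagreement h f
        dis⁺ {v} ne = ∈-filter⁺ (λ v → ¬? (h v ≟ f v)) (univ-complete v) ne
        dis⁻ : ∀ {v} → v ∈ˡ disagreement h g → h v ≢ g v
        dis⁻ v∈ = proj₂ (∈-filter⁻ (λ v → ¬? (h v ≟ g v)) {xs = univ} v∈)
        still : ∀ {v} → v ∈ˡ disagreement h g → h v ≢ f v
        still {v} v∈ e with view v
        ... | is-w refl = dis⁻ v∈ (trans hw (sym g-w))
        ... | is-w′ refl = dis⁻ v∈ (trans hw′ (sym g-w′))
        ... | is-w″ p q refl = p (trans (sym (h-inv v)) (trans (cong h (trans e (inv w′))) hw′))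
        ... | other p q r = dis⁻ v∈ (trans e (sym (g-else p q r)))

    module _ (avoidable : ∀ v → v ∉ˡ Z → Avoidable (v ∷ [])) where

      -- h misses x and z, f misses y; f is moved towards h until some maximum matching misses y and x, or y and z.
      private
        exchange : ∀ {x y z h} n → x ~ y → y ~ z → x ≢ y → y ≢ z → x ≢ z →
          Missing Z d (x ∷ z ∷ []) h → ∀ f → Missing Z d (y ∷ []) f →
          length (filter (λ v → ¬? (h v ≟ f v)) univ) ≤ n → ⊥
        exchange _ (inj₁ p) _ x≢y _ _ _ _ _ _ = x≢y p
        exchange _ _ (inj₁ p) _ y≢z _ _ _ _ _ = y≢z p
        exchange {x} {y} {z} {h} n (inj₂ xy) (inj₂ yz) x≢y y≢z x≢z (mh , leh , hx ∷ hz ∷ []) f (mf , lef , fy ∷ []) lt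
          with any? (λ w → (f w ≟ w) ×-dec (¬? (h w ≟ w) ×-dec ¬? (w ≟ y)))
        -- Here `h` misses everything that `f` misses, except possibly `y`. It also misses `x` and
        -- `z`, neither of which `f` can miss together with `y`, so `f` would miss fewer than `d`
        -- vertices.
        ... | no none = ℕ.<⇒≱ (s≤s⁻¹ (ℕ.≤-trans (unique-⊆⇒length≤ uni sub) (s≤s leh))) (min f mf)
          where
          uni : Unique (x ∷ z ∷ unmatched f)
          uni = unique-∷
            (λ { (here p) → x≢z p ; (there q) → xy (f , mf , lef , unmatched⁻ {f} q ∷ fy ∷ []) })
            (unique-∷ (λ q → yz (f , mf , lef , fy ∷ unmatched⁻ {f} q ∷ [])) (unmatched-unique f))
          sub : ∀ {v} → v ∈ˡ x ∷ z ∷ unmatched f → v ∈ˡ y ∷ unmatched h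
          sub (here refl) = there (unmatched⁺ {h} hx)
          sub (there (here refl)) = there (unmatched⁺ {h} hz)
          sub (there (there {v} v∈)) with _ ≟ y | h _ ≟ _
          ... | yes p | _ = here p
          ... | no _ | yes q = there (unmatched⁺ {h} q)
          ... | no p | no q = contradiction (_ , unmatched⁻ {f} v∈ , q , p) none
        ... | yes (w , fw , hw , w≢y) = step n lt
          where
          hE = proj₂ mh w hw
          hE′ = proj₂ mh (h w) (λ e → hw (trans (sym e) (proj₁ mh w)))
          open Rematch mf {w} {h w} (λ e → hw (sym e)) fw (proj₁ hE) (proj₂ hE) (proj₂ hE′)
          fw′ : f (h w) ≢ h w
          fw′ = w′-matched lef
          gy : g y ≡ y
          gy with y ≟ f (h w)
          ... | yes p = contradiction (trans (trans (sym (proj₁ mf (h w))) (cong f (sym p))) (trans fy p)) (λ e → fw′ (sym e))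
          ... | no ¬p = trans (g-else (λ e → w≢y (sym e)) (λ e → fw′ (subst (λ t → f t ≡ t) e fy)) ¬p) fy
          step : ∀ n → length (filter (λ v → ¬? (h v ≟ f v)) univ) ≤ n → ⊥
          step zero le = ℕ.<⇒≱ (disagreement-decreases (proj₁ mh) refl) (ℕ.≤-trans le z≤n)
          step (suc n) le = exchange n (inj₂ xy) (inj₂ yz) x≢y y≢z x≢z (mh , leh , hx ∷ hz ∷ [])
            g (matching , ℕ.≤-trans deficiency-rematch lef , gy ∷ [])
            (s≤s⁻¹ (ℕ.≤-trans (disagreement-decreases (proj₁ mh) refl) le))

      ~-trans : ∀ {x y z} → y ∉ˡ Z → x ~ y → y ~ z → x ~ z
      ~-trans {x} {y} {z} y∉ xy yz with x ≟ z | x ≟ y | y ≟ z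
      ... | yes p | _ | _ = inj₁ p
      ... | no _ | yes refl | _ = yz
      ... | no _ | no _ | yes refl = xy
      ... | no x≢z | no x≢y | no y≢z = inj₂ λ (h , mh) →
        case avoidable y y∉ of λ (f , mf) → exchange _ xy yz x≢y y≢z x≢z mh f mf ℕ.≤-refl

      ~-adjacent : ∀ {x y} → x ∉ˡ Z → y ∉ˡ Z → E x y ≡ true → x ~ y
      ~-adjacent {x} {y} x∉ y∉ e with x ≟ y
      ... | yes p = inj₁ p
      ... | no ne = inj₂ λ { (f , mf , le , fx ∷ fy ∷ []) → Rematch.w′-matched mf ne fx e x∉ y∉ le fy }

  -- The classes of `_~_` outside `Z` play the part of the components of a Tutte-Berge barrier: no
  -- edge outside `Z` leaves a class, and `m` misses at most one vertex of each. As `m` misses all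
  -- of `Z` as well, `deficiency-gap` says that the classes with a missed vertex number at least the
  -- deficiency of `m₀` plus the length of `Z`.
  record Barrier : Set₁ where
    field
      m₀ m   : A → A
      Z      : List A
      m₀-matching : IsMatching [] m₀
      m-matching  : IsMatching Z m
      Z-unique    : Unique Z
      deficiency-gap : deficiency m₀ + (length Z + length Z) ≤ deficiency m
      _~_    : A → A → Set
      _~?_   : ∀ x y → Dec (x ~ y)
      ~-refl : ∀ {x} → x ~ x
      ~-sym  : ∀ {x y} → x ~ y → y ~ x
      ~-trans : ∀ {x y z} → y ∉ˡ Z → x ~ y → y ~ z → x ~ z
      ~-adjacent : ∀ {x y} → x ∉ˡ Z → y ∉ˡ Z → E x y ≡ true → x ~ y
      ~-unmatched : ∀ {x y} → m x ≡ x → m y ≡ y → x ~ y → x ≡ y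

  deficiency≤size : ∀ f → deficiency f ≤ length univ
  deficiency≤size f = unique-⊆⇒length≤ (unmatched-unique f) (λ _ → univ-complete _)

  -- As long as some vertex is covered by all maximum matchings it is moved to Z; by parity this costs two more
  -- unmatched vertices.
  barrier : Barrier
  barrier with minimum []
  ... | d₀ , (f₀ , mf₀ , le₀ , _) , min₀ =
      grow (length univ) [] d₀ [] (f₀ , mf₀ , le₀ , []) min₀ (ℕ.≤-trans (ℕ.≤-reflexive (ℕ.+-identityʳ _)) le₀)
        (ℕ.m≤m+n _ d₀)
    where
    grow : ∀ n Z d → Unique Z → ∃ (Missing Z d []) → Minimum Z d → deficiency f₀ + (length Z + length Z) ≤ d →
      length univ ≤ n + d → Barrier
    grow n Z d uZ (f , mf , lef , _) min gap left
      with any? (λ v → ¬? (v ∈A? Z) ×-dec ¬? (missing? Z d (v ∷ [])))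
    ... | no none = record
        { m₀ = f₀ ; m = f ; Z = Z ; m₀-matching = mf₀ ; m-matching = mf ; Z-unique = uZ
        ; deficiency-gap = ℕ.≤-trans gap (min f mf)
        ; _~_ = X._~_ ; _~?_ = X._~?_ ; ~-refl = inj₁ refl ; ~-sym = X.~-sym
        ; ~-trans = X.~-trans avoidable ; ~-adjacent = X.~-adjacent avoidable
        ; ~-unmatched = λ { p q (inj₁ e) → e ; p q (inj₂ h) → contradiction (f , mf , lef , p ∷ q ∷ []) h } }
      where
      module X = Exchange Z d min
      avoidable : ∀ v → v ∉ˡ Z → ∃ (Missing Z d (v ∷ []))
      avoidable v v∉ = decidable-stable (missing? Z d (v ∷ [])) (λ ¬m → none (v , v∉ , ¬m))
    ... | yes (v , v∉ , covered) with minimum (v ∷ Z)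
    ...   | d′ , (g , mg , leg , _) , min′ = next n left
      where
      weaken : ∀ h → IsMatching (v ∷ Z) h → IsMatching Z h
      weaken h (i , e) = i , λ x ne → proj₁ (e x ne) , λ x∈ → proj₂ (e x ne) (there x∈)
      v-unmatched : ∀ h → IsMatching (v ∷ Z) h → h v ≡ v
      v-unmatched h mh = decidable-stable (h v ≟ v) λ ne → proj₂ (proj₂ mh v ne) (here refl)
      d<g : d < deficiency g
      d<g = ℕ.≰⇒> λ le → covered (g , weaken g mg , le , v-unmatched g mg ∷ [])
      d+2≤g : 2 + d ≤ deficiency g
      d+2≤g = ℕ.≤∧≢⇒< d<g λ eq →
        let k , p = parity Z f mf
            l , q = parity Z g (weaken g mg)
        in even≢odd l k (ℕ.+-cancelˡ-≡ d _ _ (trans (ℕ.+-suc d (l + l))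
             (trans (cong (_+ (l + l)) eq) (trans (sym q) (trans p (cong (_+ (k + k)) f≡d))))))
        where
        f≡d : deficiency f ≡ d
        f≡d = ℕ.≤-antisym lef (min f mf)
      d+2≤d′ : 2 + d ≤ d′
      d+2≤d′ = ℕ.≤-trans d+2≤g leg
      gap′ : deficiency f₀ + (length (v ∷ Z) + length (v ∷ Z)) ≤ d′
      gap′ = ℕ.≤-trans (ℕ.≤-reflexive (trans (cong (deficiency f₀ +_) (cong suc (ℕ.+-suc (length Z) (length Z))))
          (trans (ℕ.+-suc (deficiency f₀) _) (cong suc (ℕ.+-suc (deficiency f₀) _)))))
        (ℕ.≤-trans (s≤s (s≤s gap)) d+2≤d′)
      next : ∀ n → length univ ≤ n + d → Barrier
      next zero left = contradiction left (ℕ.<⇒≱ (ℕ.≤-trans d<g (deficiency≤size g)))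
      next (suc n) left = grow n (v ∷ Z) d′ (unique-∷ v∉ uZ) (g , mg , leg , []) min′ gap′
        (ℕ.≤-trans left (ℕ.≤-trans (ℕ.≤-reflexive (sym (ℕ.+-suc n d))) (ℕ.+-monoʳ-≤ n (ℕ.≤-trans (ℕ.n≤1+n _) d+2≤d′))))

-- Walks and trees

linked-map-All : {A : Set} {R T : A → A → Set} {P : A → Set} → (∀ {a b} → P a → P b → R a b → T a b) →
  ∀ {xs} → All P xs → Linked R xs → Linked T xs
linked-map-All f _ [] = []
linked-map-All f _ [-] = [-]
linked-map-All f (p ∷ q ∷ ps) (r ∷ rs) = f p q r ∷ linked-map-All f (q ∷ ps) rs

-- The projection `π` allows a walk of coloured vertices to be tested for repetitions of the
-- underlying vertices, whatever their colours.
trace : {A B : Set} {R : A → A → Set} (π : A → B) {x y : A} → Star R x y → List B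
trace π {x} ε = π x ∷ []
trace π {x} (r ◅ w) = π x ∷ trace π w

module _ {A B : Set} {R : A → A → Set} (π : A → B) where

  trace-source : ∀ {x y} (w : Star R x y) → π x ∈ˡ trace π w
  trace-source ε = here refl
  trace-source (r ◅ w) = here refl

  trace-target : ∀ {x y} (w : Star R x y) → π y ∈ˡ trace π w
  trace-target ε = here refl
  trace-target (r ◅ w) = there (trace-target w)

  trace-◅◅⁺ˡ : ∀ {x y z v} (w : Star R x y) {w′ : Star R y z} → v ∈ˡ trace π w → v ∈ˡ trace π (w ◅◅ w′)
  trace-◅◅⁺ˡ ε {w′} (here refl) = trace-source w′
  trace-◅◅⁺ˡ (r ◅ w) (here p) = here p
  trace-◅◅⁺ˡ (r ◅ w) (there p) = there (trace-◅◅⁺ˡ w p)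

  trace-◅◅⁺ʳ : ∀ {x y z v} (w : Star R x y) {w′ : Star R y z} → v ∈ˡ trace π w′ → v ∈ˡ trace π (w ◅◅ w′)
  trace-◅◅⁺ʳ ε p = p
  trace-◅◅⁺ʳ (r ◅ w) p = there (trace-◅◅⁺ʳ w p)

  trace-◅◅⁻ : ∀ {x y z v} (w : Star R x y) {w′ : Star R y z} → v ∈ˡ trace π (w ◅◅ w′) →
    v ∈ˡ trace π w ⊎ v ∈ˡ trace π w′
  trace-◅◅⁻ ε p = inj₂ p
  trace-◅◅⁻ (r ◅ w) (here p) = inj₁ (here p)
  trace-◅◅⁻ (r ◅ w) (there p) = Sum.map₁ there (trace-◅◅⁻ w p)

  Simple : ∀ {x y} → Star R x y → Set
  Simple w = Unique (trace π w)

  simple-◅◅ : ∀ {x y z} (w : Star R x y) {w′ : Star R y z} → Simple w → Simple w′ →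
    (∀ {v} → v ∈ˡ trace π w → v ∈ˡ trace π w′ → v ≡ π y) → Simple (w ◅◅ w′)
  simple-◅◅ ε u u′ d = u′
  simple-◅◅ {y = y} (r ◅ w) {w′} u@(_ ∷ u₁) u′ d =
    unique-∷ (λ p → case trace-◅◅⁻ w p of λ where
        (inj₁ q) → unique-head∉ u q
        (inj₂ q) → unique-head∉ u (subst (_∈ˡ trace π w) (sym (d (here refl) q)) (trace-target w)))
      (simple-◅◅ w u₁ u′ (λ p q → d (there p) q))

  simple-◅◅⁻ : ∀ {x y z} (w : Star R x y) {w′ : Star R y z} → Simple (w ◅◅ w′) →
    Simple w × Simple w′ × (∀ {v} → v ∈ˡ trace π w → v ∈ˡ trace π w′ → v ≡ π y)
  simple-◅◅⁻ ε u = [] ∷ [] , u , λ { (here p) _ → p }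
  simple-◅◅⁻ (r ◅ w) u@(_ ∷ u₁) with simple-◅◅⁻ w u₁
  ... | s , s′ , d = unique-∷ (λ p → unique-head∉ u (trace-◅◅⁺ˡ w p)) s , s′ , λ where
    (here refl) q → contradiction (trace-◅◅⁺ʳ w q) (unique-head∉ u)
    (there p) q → d p q

  Split : ∀ {x y} → Star R x y → B → Set
  Split {x} {y} w v = Σ A λ z → Σ (Star R x z) λ w₁ → Σ (Star R z y) λ w₂ → π z ≡ v × w ≡ w₁ ◅◅ w₂

  split : ∀ {x y v} (w : Star R x y) → v ∈ˡ trace π w → Split w v
  split ε (here p) = _ , ε , ε , sym p , refl
  split (r ◅ w) (here p) = _ , ε , r ◅ w , sym p , refl
  split (r ◅ w) (there p) with split w p
  ... | z , w₁ , w₂ , eq , refl = z , r ◅ w₁ , w₂ , eq , refl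

  trace-map : ∀ {T : A → A → Set} (f : ∀ {a b} → R a b → T a b) {x y} (w : Star R x y) →
    trace π (gmap id f w) ≡ trace π w
  trace-map f ε = refl
  trace-map f (r ◅ w) = cong (π _ ∷_) (trace-map f w)

  trace-linked : ∀ {x y} (w : Star R x y) → Linked R (trace id w)
  trace-linked ε = [-]
  trace-linked (r ◅ ε) = r ∷ [-]
  trace-linked (r ◅ w@(_ ◅ _)) = r ∷ trace-linked w

module _ {A B C : Set} {R : A → A → Set} {T : B → B → Set} (φ : A → B) (f : ∀ {a b} → R a b → T (φ b) (φ a))
         (π : B → C) where

  -- With `φ` the identity this is plain reversal; with `φ` the colour flip it also moves the walk
  -- to the opposite colouring, which is how a breaking path is read from its other end.
  rev : ∀ {x y} → Star R x y → Star T (φ y) (φ x)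
  rev ε = ε
  rev (r ◅ w) = rev w ◅◅ (f r ◅ ε)

  trace-rev⁻ : ∀ {x y v} (w : Star R x y) → v ∈ˡ trace π (rev w) → v ∈ˡ trace (π ∘ φ) w
  trace-rev⁻ ε p = p
  trace-rev⁻ (r ◅ w) p with trace-◅◅⁻ π (rev w) p
  ... | inj₁ q = there (trace-rev⁻ w q)
  ... | inj₂ (here refl) = there (trace-source (π ∘ φ) w)
  ... | inj₂ (there (here refl)) = here refl

  trace-rev⁺ : ∀ {x y v} (w : Star R x y) → v ∈ˡ trace (π ∘ φ) w → v ∈ˡ trace π (rev w)
  trace-rev⁺ ε p = p
  trace-rev⁺ (r ◅ w) (here p) = trace-◅◅⁺ʳ π (rev w) (there (here p))
  trace-rev⁺ (r ◅ w) (there p) = trace-◅◅⁺ˡ π (rev w) (trace-rev⁺ w p)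

  simple-rev : ∀ {x y} (w : Star R x y) → Simple (π ∘ φ) w → Simple π (rev w)
  simple-rev ε u = u
  simple-rev (r ◅ w) u@(_ ∷ u₁) = simple-◅◅ π (rev w) (simple-rev w u₁)
    (unique-∷ (λ { (here p) → unique-head∉ u (subst (_∈ˡ trace (π ∘ φ) w) p (trace-source (π ∘ φ) w)) ; (there ()) }) ([] ∷ []))
    λ where
      p (here q) → q
      p (there (here refl)) → contradiction (trace-rev⁻ w p) (unique-head∉ u)

trace-∘ : {A B C : Set} {R : A → A → Set} (π : A → B) (ρ : B → C) {x y : A} (w : Star R x y) →
  trace (ρ ∘ π) w ≡ map ρ (trace π w)
trace-∘ π ρ ε = refl
trace-∘ π ρ (r ◅ w) = cong (_ ∷_) (trace-∘ π ρ w)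

module _ {A : Set} (_≟_ : DecidableEquality A) {R : A → A → Set} where

  shortcut : ∀ {x y} (w : Star R x y) → Σ (Star R x y) λ w′ → Simple id w′ × (∀ {v} → v ∈ˡ trace id w′ → v ∈ˡ trace id w)
  shortcut ε = ε , [] ∷ [] , id
  shortcut {x} (r ◅ w) with shortcut w
  ... | w′ , u , sub with Any.any? (x ≟_) (trace id w′)
  ...   | no x∉ = r ◅ w′ , unique-∷ x∉ u , λ { (here p) → here p ; (there p) → there (sub p) }
  ...   | yes x∈ with split id w′ x∈
  ...     | _ , w₁ , w₂ , refl , refl = w₂ , proj₁ (proj₂ (simple-◅◅⁻ id w₁ u)) ,
            λ p → there (sub (trace-◅◅⁺ʳ id w₁ p))

module _ {A : Set} {R : A → A → Set} {D : A → Set} (D? : ∀ a → Dec (D a)) where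

  record FirstHit {x y} (w : Star R x y) : Set where
    constructor hit
    field
      {u z} : A
      pre   : Star R x u
      last  : R u z
      rest  : Star R z y
      off   : ∀ {v} → v ∈ˡ trace id pre → ¬ D v
      on    : D z
      eq    : w ≡ pre ◅◅ last ◅ rest

  firstHit : ∀ {x y} (w : Star R x y) → ¬ D x → D y → FirstHit w
  firstHit ε ¬d d = contradiction d ¬d
  firstHit (_◅_ {j = z} e w) ¬d d with D? z
  ... | yes dz = hit ε e w (λ { (here refl) → ¬d }) dz refl
  ... | no ¬dz with firstHit w ¬dz d
  ...   | hit pre last rest off on refl = hit (e ◅ pre) last rest (λ { (here refl) → ¬d ; (there p) → off p }) on refl

module _ {A : Set} {R : A → A → Set} where

  trace-∷ʳ : ∀ {x y} (w : Star R x y) → x ≢ y → ∃ λ mid → trace id w ≡ x ∷ mid ∷ʳ y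
  trace-∷ʳ ε ne = contradiction refl ne
  trace-∷ʳ {x} {y} (r ◅ w) _ with ends w
    where
    ends : ∀ {x} (w : Star R x y) → ∃ λ mid → trace id w ≡ mid ∷ʳ y
    ends ε = [] , refl
    ends {x} (r ◅ w) = case ends w of λ (mid , eq) → x ∷ mid , cong (x ∷_) eq
  ... | mid , eq = mid , cong (x ∷_) eq

  linked⇒walk : ∀ x mid y → Linked R (x ∷ mid ∷ʳ y) → Σ (Star R x y) λ w → trace id w ≡ x ∷ mid ∷ʳ y
  linked⇒walk x [] y (r ∷ [-]) = r ◅ ε , refl
  linked⇒walk x (m ∷ mid) y (r ∷ rs) with linked⇒walk m mid y rs
  ... | w , eq = r ◅ w , cong (x ∷_) eq

walk⇒path : ∀ {n} (H : Sub n) {x y} → V H x → Star (λ a b → E H a b × V H b) x y → x ≡ y ⊎ PathIn H x y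
walk⇒path H {x} {y} vx w with x F.≟ y
... | yes p = inj₁ p
... | no ne with shortcut F._≟_ w
...   | w′ , u , _ with trace-∷ʳ w′ ne
...     | mid , eq = inj₂ (mid , subst Unique eq u ,
            subst (Linked (E H)) eq (linked-map-All {P = λ _ → ⊤} (λ _ _ → proj₁) (All.tabulate (λ _ → tt)) (trace-linked id w′)) ,
            subst (All (V H)) eq (inside vx w′))
  where
  inside : ∀ {x} → V H x → (w : Star (λ a b → E H a b × V H b) x y) → All (V H) (trace id w)
  inside vx ε = vx ∷ []
  inside vx ((_ , vy) ◅ w) = vx ∷ inside vy w

path⇒walk : ∀ {n} (H : Sub n) {x y} → x ≡ y ⊎ PathIn H x y → Star (λ a b → E H a b × V H a × V H b) x y
path⇒walk H (inj₁ refl) = ε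
path⇒walk H {x} {y} (inj₂ (mid , _ , l , a)) =
  proj₁ (linked⇒walk x mid y (linked-map-All (λ p q r → r , p , q) a l))

data Tree {A : Set} (R : A → A → Set) (r : A) : List A → Set where
  root : Tree R r (r ∷ [])
  leaf : ∀ {xs x y} → Tree R r xs → x ∈ˡ xs → y ∉ˡ xs → R x y → Tree R r (y ∷ xs)

module _ {A : Set} {R : A → A → Set} {r : A} where

  TreeEdge : ∀ {xs} → Tree R r xs → A → A → Set
  TreeEdge root a b = ⊥
  TreeEdge (leaf {x = x} {y} t _ _ _) a b = (a ≡ x × b ≡ y) ⊎ (a ≡ y × b ≡ x) ⊎ TreeEdge t a b

  treeEdge-sym : ∀ {xs} (t : Tree R r xs) {a b} → TreeEdge t a b → TreeEdge t b a
  treeEdge-sym (leaf t _ _ _) (inj₁ (p , q)) = inj₂ (inj₁ (q , p))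
  treeEdge-sym (leaf t _ _ _) (inj₂ (inj₁ (p , q))) = inj₁ (q , p)
  treeEdge-sym (leaf t _ _ _) (inj₂ (inj₂ e)) = inj₂ (inj₂ (treeEdge-sym t e))

  treeEdge-∈ : ∀ {xs} (t : Tree R r xs) {a b} → TreeEdge t a b → a ∈ˡ xs × b ∈ˡ xs
  treeEdge-∈ (leaf t x∈ _ _) (inj₁ (refl , refl)) = there x∈ , here refl
  treeEdge-∈ (leaf t x∈ _ _) (inj₂ (inj₁ (refl , refl))) = here refl , there x∈
  treeEdge-∈ (leaf t _ _ _) (inj₂ (inj₂ e)) = case treeEdge-∈ t e of λ (p , q) → there p , there q

  treeEdge-R : (∀ {a b} → R a b → R b a) → ∀ {xs} (t : Tree R r xs) {a b} → TreeEdge t a b → R a b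
  treeEdge-R R-sym (leaf t _ _ e) (inj₁ (refl , refl)) = e
  treeEdge-R R-sym (leaf t _ _ e) (inj₂ (inj₁ (refl , refl))) = R-sym e
  treeEdge-R R-sym (leaf t _ _ _) (inj₂ (inj₂ e)) = treeEdge-R R-sym t e

  tree-root∈ : ∀ {xs} → Tree R r xs → r ∈ˡ xs
  tree-root∈ root = here refl
  tree-root∈ (leaf t _ _ _) = there (tree-root∈ t)

  tree-unique : ∀ {xs} → Tree R r xs → Unique xs
  tree-unique root = [] ∷ []
  tree-unique (leaf t _ y∉ _) = unique-∷ y∉ (tree-unique t)

  tree-walk : ∀ {xs} (t : Tree R r xs) {v} → v ∈ˡ xs → Star (TreeEdge t) r v
  tree-walk root (here refl) = ε
  tree-walk (leaf t x∈ _ _) (here refl) = gmap id (inj₂ ∘ inj₂) (tree-walk t x∈) ◅◅ (inj₁ (refl , refl) ◅ ε)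
  tree-walk (leaf t _ _ _) (there p) = gmap id (inj₂ ∘ inj₂) (tree-walk t p)

  tree-reach : ∀ {xs} (t : Tree R r xs) {v} → v ∈ˡ xs → Star R r v
  tree-reach root (here refl) = ε
  tree-reach (leaf t x∈ _ e) (here refl) = tree-reach t x∈ ◅◅ (e ◅ ε)
  tree-reach (leaf t _ _ _) (there p) = tree-reach t p

module _ {A : Set} {R : A → A → Set} (R-sym : ∀ {a b} → R a b → R b a) where

  TwoNeighbours : A → Set
  TwoNeighbours v = ∃ λ a → ∃ λ b → a ≢ b × R v a × R v b

  private
    inner : ∀ x p l y → Unique (x ∷ p ∷ l ∷ʳ y) → Linked R (p ∷ l ∷ʳ y) → R y x → ∀ {v} → v ∈ˡ l ∷ʳ y → TwoNeighbours v
    inner x p [] y ((x≢p ∷ _) ∷ _) (e ∷ _) e′ (here refl) = p , x , (λ eq → x≢p (sym eq)) , R-sym e , e′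
    inner x p (q ∷ []) y (_ ∷ (_ ∷ p≢y ∷ _) ∷ _) (e ∷ e″ ∷ _) e′ (here refl) = p , y , p≢y , R-sym e , e″
    inner x p (q ∷ s ∷ l) y (_ ∷ (_ ∷ p≢s ∷ _) ∷ _) (e ∷ e″ ∷ _) e′ (here refl) = p , s , p≢s , R-sym e , e″
    inner x p (q ∷ l) y ((_ ∷ x∉) ∷ (_ ∷ u)) (_ ∷ es) e′ (there v∈) = inner x q l y (x∉ ∷ u) es e′ v∈

  cycle-two-neighbours : ∀ x y mid → 1 ≤ length mid → Unique (x ∷ mid ∷ʳ y) → Linked R (x ∷ mid ∷ʳ y) → R y x →
    ∀ {v} → v ∈ˡ x ∷ mid ∷ʳ y → TwoNeighbours v
  cycle-two-neighbours x y [] () _ _ _ _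
  cycle-two-neighbours x y (m ∷ ms) _ (_ ∷ u) (e ∷ es) e′ (here refl) =
    m , y , (λ { refl → unique-head∉ u (∈-++⁺ʳ ms (here refl)) }) , e , R-sym e′
  cycle-two-neighbours x y (m ∷ []) _ ((_ ∷ x≢y ∷ _) ∷ _) (e ∷ e″ ∷ _) e′ (there (here refl)) = x , y , x≢y , R-sym e , e″
  cycle-two-neighbours x y (m ∷ q ∷ ms) _ ((_ ∷ x≢q ∷ _) ∷ _) (e ∷ e″ ∷ _) e′ (there (here refl)) = x , q , x≢q , R-sym e , e″
  cycle-two-neighbours x y (m ∷ ms) _ u (_ ∷ es) e′ (there (there v∈)) = inner x m ms y u es e′ v∈

treeSub : ∀ {n} {R : Fin n → Fin n → Set} {r xs} → Tree R r xs → Sub n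
treeSub {xs = xs} t = record { V = λ x → x ∈ˡ xs ; E = TreeEdge t }

-- For acyclicity the leaves are stripped, newest first: the newest leaf has its parent as only
-- neighbour, whereas a vertex on a cycle has two.
treeSub-isTree : ∀ {n} {R : Fin n → Fin n → Set} {r xs} (t : Tree R r xs) → IsTree (treeSub t)
treeSub-isTree {n} {R} {r} t = (r , tree-root∈ t) , connected , acyclic t
  where
  connected : Connected (treeSub t)
  connected x y x∈ y∈ = walk⇒path (treeSub t) x∈
    (gmap id (λ e → e , proj₂ (treeEdge-∈ t e))
      (rev id (treeEdge-sym t) id (tree-walk t x∈) ◅◅ tree-walk t y∈))
  acyclic : ∀ {xs} (t : Tree R r xs) → Acyclic (treeSub t)
  acyclic root x y (_ ∷ _) _ _ (() ∷ _) _
  acyclic t₀@(leaf {x = p} {y = l} t p∈ l∉ _) x y mid len u es e with Any.any? (l F.≟_) (x ∷ mid ∷ʳ y)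
  ... | yes l∈ with cycle-two-neighbours (λ {a} {b} → treeEdge-sym t₀ {a} {b}) x y mid len u es e l∈
  ...   | a , b , a≢b , ea , eb = a≢b (trans (only ea) (sym (only eb)))
    where
    only : ∀ {a} → TreeEdge t₀ l a → a ≡ p
    only (inj₁ (refl , _)) = contradiction p∈ l∉
    only (inj₂ (inj₁ (_ , q))) = q
    only (inj₂ (inj₂ q)) = contradiction (proj₁ (treeEdge-∈ t q)) l∉
  acyclic (leaf {x = p} {y = l} t p∈ l∉ _) x y mid len u es e | no ∉ℓ =
    acyclic t x y mid len u
      (linked-map-All {P = l ≢_} old (All.tabulate λ v∈ eq → ∉ℓ (subst (_∈ˡ _) (sym eq) v∈)) es)
      (old (λ eq → ∉ℓ (there (subst (_∈ˡ mid ∷ʳ y) (sym eq) (∈-++⁺ʳ mid (here refl))))) (λ eq → ∉ℓ (here eq)) e)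
    where
    old : ∀ {a b} → l ≢ a → l ≢ b → (a ≡ p × b ≡ l) ⊎ (a ≡ l × b ≡ p) ⊎ TreeEdge t a b → TreeEdge t a b
    old _ q (inj₁ (_ , eq)) = contradiction (sym eq) q
    old q _ (inj₂ (inj₁ (eq , _))) = contradiction (sym eq) q
    old _ _ (inj₂ (inj₂ h)) = h

closed-under-walks : {A : Set} {R : A → A → Set} {xs : List A} → (∀ {x y} → x ∈ˡ xs → R x y → y ∈ˡ xs) →
  ∀ {a b} → Star R a b → a ∈ˡ xs → b ∈ˡ xs
closed-under-walks closed ε p = p
closed-under-walks closed (e ◅ w) p = closed-under-walks closed w (closed p e)

gmap-within : {A B : Set} {R : A → A → Set} {T : B → B → Set} (φ : A → B) {x y : A} (w : Star R x y) →
  (∀ {a b} → a ∈ˡ trace id w → b ∈ˡ trace id w → R a b → T (φ a) (φ b)) → Star T (φ x) (φ y)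
gmap-within φ ε f = ε
gmap-within φ (e ◅ w) f = f (here refl) (there (trace-source id w)) e ◅
  gmap-within φ w (λ p q → f (there p) (there q))

module _ {n : ℕ} {R : Fin n → Fin n → Set} (R? : ∀ a b → Dec (R a b)) where

  -- This supplies the trees of the minor and also, its vertex set being closed under `R`, a
  -- decision procedure for reachability.
  spanning : ∀ r → Σ (List (Fin n)) λ xs → Tree R r xs × (∀ {x y} → x ∈ˡ xs → R x y → y ∈ˡ xs)
  spanning r = grow n root (ℕ.m≤m+n n 1)
    where
    grow : ∀ k {xs} → Tree R r xs → n ≤ k + length xs →
      Σ (List (Fin n)) λ xs → Tree R r xs × (∀ {x y} → x ∈ˡ xs → R x y → y ∈ˡ xs)
    grow k {xs} t le with F.any? (λ x → F.any? (λ y → Any.any? (x F.≟_) xs ×-dec (¬? (Any.any? (y F.≟_) xs) ×-dec R? x y)))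
    ... | no none = xs , t , λ {x} {y} x∈ e →
      decidable-stable (Any.any? (y F.≟_) xs) (λ y∉ → none (x , y , x∈ , y∉ , e))
    grow (suc k) {xs} t le | yes (x , y , x∈ , y∉ , e) =
      grow k (leaf t x∈ y∉ e) (ℕ.≤-trans le (ℕ.≤-reflexive (sym (ℕ.+-suc k _))))
    grow zero {xs} t le | yes (x , y , x∈ , y∉ , e) = contradiction le (ℕ.<⇒≱
      (ℕ.≤-trans (unique-⊆⇒length≤ (unique-∷ y∉ (tree-unique t)) (λ _ → ∈-allFin _)) (ℕ.≤-reflexive (L.length-tabulate id))))

  star? : ∀ x y → Dec (Star R x y)
  star? x y with spanning x
  ... | xs , t , closed = map′ (tree-reach t) (λ w → closed-under-walks closed w (tree-root∈ t)) (Any.any? (y F.≟_) xs)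

-- Subsets, finite sums and assignments

elements : ∀ {n} → Subset n → List (Fin n)
elements [] = []
elements (true ∷ p) = zero ∷ map suc (elements p)
elements (false ∷ p) = map suc (elements p)

∈-elements⁺ : ∀ {n} {p : Subset n} {x} → x ∈ p → x ∈ˡ elements p
∈-elements⁺ {p = true ∷ p} {zero} _ = here refl
∈-elements⁺ {p = false ∷ p} {zero} ()
∈-elements⁺ {p = true ∷ p} {suc x} (there x∈) = there (∈-map⁺ suc (∈-elements⁺ x∈))
∈-elements⁺ {p = false ∷ p} {suc x} (there x∈) = ∈-map⁺ suc (∈-elements⁺ x∈)

∈-elements⁻ : ∀ {n} {p : Subset n} {x} → x ∈ˡ elements p → x ∈ p
∈-elements⁻ {p = true ∷ p} (here refl) = here
∈-elements⁻ {p = true ∷ p} (there x∈) with ∈-map⁻ suc x∈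
... | _ , y∈ , refl = there (∈-elements⁻ y∈)
∈-elements⁻ {p = false ∷ p} x∈ with ∈-map⁻ suc x∈
... | _ , y∈ , refl = there (∈-elements⁻ y∈)

elements-unique : ∀ {n} (p : Subset n) → Unique (elements p)
elements-unique [] = []
elements-unique (true ∷ p) = unique-∷ (λ x∈ → case ∈-map⁻ suc x∈ of λ { (_ , _ , ()) })
  (Uniq.map⁺ F.suc-injective (elements-unique p))
elements-unique (false ∷ p) = Uniq.map⁺ F.suc-injective (elements-unique p)

length-elements : ∀ {n} (p : Subset n) → length (elements p) ≡ ∣ p ∣
length-elements [] = refl
length-elements (true ∷ p) = cong suc (trans (L.length-map suc (elements p)) (length-elements p))
length-elements (false ∷ p) = trans (L.length-map suc (elements p)) (length-elements p)

subsetOf : ∀ {n} {P : Fin n → Set} → (∀ x → Dec (P x)) → Subset n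
subsetOf P? = tabulate (does ∘ P?)

∈-subsetOf⁺ : ∀ {n} {P : Fin n → Set} (P? : ∀ x → Dec (P x)) {x} → P x → x ∈ subsetOf P?
∈-subsetOf⁺ P? {x} p = lookup⇒[]= x (subsetOf P?) (trans (lookup∘tabulate (does ∘ P?) x) (dec-true (P? x) p))

∈-subsetOf⁻ : ∀ {n} {P : Fin n → Set} (P? : ∀ x → Dec (P x)) {x} → x ∈ subsetOf P? → P x
∈-subsetOf⁻ P? {x} x∈ = decidable-stable (P? x) λ ¬p →
  case trans (sym (trans (sym (lookup∘tabulate (does ∘ P?) x)) ([]=⇒lookup x∈))) (dec-false (P? x) ¬p) of λ ()

-- `A` itself need not be decidable: it is the side on which `f X` falls that is tested for each of
-- the finitely many subsets.
search-subsets : ∀ {n a} {A : Subset n → Set a} {B : Subset n → Set} → (∀ X → A X ⊎ B X) → ¬ (∀ X → B X) → ∃ A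
search-subsets {A = A} {B} f ¬B = decide (anySubset? (λ X → is₁? (f X)))
  where
  Is₁ : ∀ {X} → A X ⊎ B X → Set
  Is₁ (inj₁ _) = ⊤
  Is₁ (inj₂ _) = ⊥
  is₁? : ∀ {X} (x : A X ⊎ B X) → Dec (Is₁ x)
  is₁? (inj₁ _) = yes tt
  is₁? (inj₂ _) = no λ ()
  from₁ : ∀ {X} (x : A X ⊎ B X) → Is₁ x → A X
  from₁ (inj₁ a) _ = a
  from₂ : ∀ {X} (x : A X ⊎ B X) → ¬ Is₁ x → B X
  from₂ (inj₁ _) h = contradiction tt h
  from₂ (inj₂ b) _ = b
  decide : Dec (∃ λ X → Is₁ (f X)) → ∃ A
  decide (yes (X , p)) = X , from₁ (f X) p
  decide (no none) = contradiction (λ X → from₂ (f X) (λ p → none (X , p))) ¬B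

sumFin : ∀ {k} → (Fin k → ℕ) → ℕ
sumFin {zero} f = 0
sumFin {suc k} f = f zero + sumFin (f ∘ suc)

sumFin-≤ : ∀ {k} {f g : Fin k → ℕ} → (∀ i → f i ≤ g i) → sumFin f ≤ sumFin g
sumFin-≤ {zero} h = z≤n
sumFin-≤ {suc k} h = ℕ.+-mono-≤ (h zero) (sumFin-≤ (h ∘ suc))

sumFin-< : ∀ {k} {f g : Fin k → ℕ} → (∀ i → f i ≤ g i) → ∀ j → f j < g j → sumFin f < sumFin g
sumFin-< h zero lt = ℕ.+-mono-<-≤ lt (sumFin-≤ (h ∘ suc))
sumFin-< h (suc j) lt = ℕ.+-mono-≤-< (h zero) (sumFin-< (h ∘ suc) j lt)

all-or-one : ∀ {k} {P : Fin k → Set} {B : Set} → (∀ i → P i ⊎ B) → (∀ i → P i) ⊎ B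
all-or-one {zero} h = inj₁ λ ()
all-or-one {suc k} h with h zero | all-or-one (h ∘ suc)
... | inj₂ b | _ = inj₂ b
... | inj₁ _ | inj₂ b = inj₂ b
... | inj₁ p | inj₁ ps = inj₁ λ { zero → p ; (suc i) → ps i }

<ᵇ⁺ : ∀ {a b} → a < b → (a <ᵇ b) ≡ true
<ᵇ⁺ {a} {b} lt with a <ᵇ b | ℕ.<⇒<ᵇ lt
... | true | _ = refl

toNat : Bool → ℕ
toNat false = 0
toNat true = 1

-- `D` marks the positions that must be filled from `L`. In the application `L` holds the free
-- clique vertices and `M` the other free branch vertices.
record Assignment {A : Set} (k : ℕ) (D : Fin k → Bool) (L M : List A) : Set where
  field
    choice    : Fin k → A
    injective : ∀ {i j} → choice i ≡ choice j → i ≡ j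
    chosen∈   : ∀ i → choice i ∈ˡ L ++ M
    where-D   : ∀ i → D i ≡ true → choice i ∈ˡ L

assign-cons : ∀ {A : Set} {k D} {L M L′ M′ : List A} {x} → Assignment k (D ∘ suc) L M → x ∉ˡ L ++ M → x ∈ˡ L′ ++ M′ →
  (∀ {y} → y ∈ˡ L ++ M → y ∈ˡ L′ ++ M′) → (∀ {y} → y ∈ˡ L → y ∈ˡ L′) → (D zero ≡ true → x ∈ˡ L′) →
  Assignment (suc k) D L′ M′
assign-cons {x = x} a x∉ x∈ sub subL needy = record
  { choice = λ { zero → x ; (suc i) → choice i }
  ; injective = λ
      { {zero} {zero} _ → refl
      ; {zero} {suc j} e → contradiction (subst (_∈ˡ _) (sym e) (chosen∈ j)) x∉
      ; {suc i} {zero} e → contradiction (subst (_∈ˡ _) e (chosen∈ i)) x∉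
      ; {suc i} {suc j} e → cong suc (injective e) }
  ; chosen∈ = λ { zero → x∈ ; (suc i) → sub (chosen∈ i) }
  ; where-D = λ { zero e → needy e ; (suc i) e → subL (where-D i e) } }
  where open Assignment a

-- Where D fails, the elements of M are used up first.
assign : ∀ {A : Set} k (D : Fin k → Bool) (L M : List A) → Unique (L ++ M) →
  sumFin (toNat ∘ D) ≤ length L → k ≤ length L + length M → Assignment k D L M
assign zero D L M u d t = record { choice = λ () ; injective = λ { {()} } ; chosen∈ = λ () ; where-D = λ () }
assign {A} (suc k) D L M u d t with D zero in D₀
... | true = needed L u d t
  where
  needed : ∀ L → Unique (L ++ M) → 1 + sumFin (toNat ∘ D ∘ suc) ≤ length L → suc k ≤ length L + length M →
    Assignment (suc k) D L M
  needed (x ∷ L) u@(_ ∷ u′) (s≤s d) (s≤s t) = assign-cons (assign k (D ∘ suc) L M u′ d t)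
    (unique-head∉ u) (here refl) there there (λ _ → here refl)
... | false = free L M u d t
  where
  sum≤ : ∀ {k} (D : Fin k → Bool) → sumFin (toNat ∘ D) ≤ k
  sum≤ {zero} D = z≤n
  sum≤ {suc k} D with D zero
  ... | true = s≤s (sum≤ (D ∘ suc))
  ... | false = ℕ.m≤n⇒m≤1+n (sum≤ (D ∘ suc))
  impossible : ∀ {B : Set} → D zero ≡ true → B
  impossible e = case trans (sym e) D₀ of λ ()
  free : ∀ L M → Unique (L ++ M) → sumFin (toNat ∘ D ∘ suc) ≤ length L → suc k ≤ length L + length M →
    Assignment (suc k) D L M
  free [] [] _ _ ()
  free (x ∷ L) [] u@(_ ∷ u′) d (s≤s t) = assign-cons
    (assign k (D ∘ suc) L [] u′ (ℕ.≤-trans (sum≤ (D ∘ suc)) (ℕ.≤-trans t (ℕ.≤-reflexive (ℕ.+-identityʳ _)))) t)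
    (unique-head∉ u) (here refl) there there impossible
  free L (x ∷ M) u d t with unique-++⁻ L u
  ... | uL , uM@(_ ∷ u′) , dis = assign-cons
    (assign k (D ∘ suc) L M (unique-++ uL u′ (λ p q → dis p (there q))) d
      (s≤s⁻¹ (ℕ.≤-trans t (ℕ.≤-reflexive (ℕ.+-suc (length L) (length M))))))
    (λ p → [ (λ q → dis q (here refl)) , unique-head∉ uM ]′ (∈-++⁻ L p))
    (∈-++⁺ʳ L (here refl)) (λ p → [ ∈-++⁺ˡ , (λ q → ∈-++⁺ʳ L (there q)) ]′ (∈-++⁻ L p)) id impossible

fails : {A : Set} → Dec A → Bool
fails (yes _) = false
fails (no _) = true

fails-no : {A : Set} (d : Dec A) → ¬ A → fails d ≡ true
fails-no (yes a) ¬a = contradiction a ¬a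
fails-no (no _) _ = refl

failures : {A : Set} {P : A → Set} → (∀ a → Dec (P a)) → A → ℕ
failures P? a = toNat (fails (P? a))

filter-tabulate : {A : Set} {P : A → Set} (P? : ∀ a → Dec (P a)) → ∀ {k} (f : Fin k → A) →
  length (filter P? (Data.List.tabulate f)) + sumFin (failures P? ∘ f) ≡ k
filter-tabulate P? {zero} f = refl
filter-tabulate P? {suc k} f with P? (f zero)
... | yes _ = cong suc (filter-tabulate P? (f ∘ suc))
... | no _ = trans (ℕ.+-suc _ _) (cong suc (filter-tabulate P? (f ∘ suc)))

sumFin-member : ∀ {k} (f : Fin k → ℕ) i → f i ≤ sumFin f
sumFin-member f zero = ℕ.m≤m+n _ _
sumFin-member f (suc i) = ℕ.≤-trans (sumFin-member (f ∘ suc) i) (ℕ.m≤n+m _ _)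

does-cong : {A B : Set} → (A → B) → (B → A) → (d : Dec A) (d′ : Dec B) → does d ≡ does d′
does-cong f g (yes a) d′ = sym (dec-true d′ (f a))
does-cong f g (no ¬a) d′ = sym (dec-false d′ (¬a ∘ g))

does⇒ : {A : Set} (d : Dec A) → does d ≡ true → A
does⇒ (yes a) _ = a

unique-map : {A B : Set} (f : A → B) {xs : List A} → Unique xs →
  (∀ {x y} → x ∈ˡ xs → y ∈ˡ xs → f x ≡ f y → x ≡ y) → Unique (map f xs)
unique-map f [] _ = []
unique-map f u@(_ ∷ u′) inj = unique-∷
  (λ p → case ∈-map⁻ f p of λ (y , y∈ , e) → unique-head∉ u (subst (_∈ˡ _) (sym (inj (here refl) (there y∈) e)) y∈))
  (unique-map f u′ (λ p q → inj (there p) (there q)))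

-- The letters stand for the deficiency `d` of a matching, its `p` edges, among them `c` copy edges
-- and `ρ` rungs, the `u` vertices with an unmatched rung, the `g` segments obtained, the `b` branch
-- vertices and all `ν` vertices of the graph. Everything is doubled because `d` counts vertices and
-- `g` counts paths with two ends.
count-bound : ∀ d p c ρ u g b ν → ν + ν ≡ d + (p + p) → p ≤ c + ρ → u + (ρ + b) ≤ ν → c ≤ u + g → b + b ≤ d + (g + g)
count-bound d p c ρ u g b ν eq p≤ u≤ c≤ = ℕ.+-cancelˡ-≤ (p + p) _ _ (begin
  (p + p) + (b + b) ≡⟨ interchange p p b b ⟩
  (p + b) + (p + b) ≤⟨ ℕ.+-mono-≤ half half ⟩
  (g + ν) + (g + ν) ≡⟨ interchange g ν g ν ⟩
  (g + g) + (ν + ν) ≡⟨ cong ((g + g) +_) eq ⟩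
  (g + g) + (d + (p + p)) ≡⟨ ℕ.+-comm (g + g) _ ⟩
  (d + (p + p)) + (g + g) ≡⟨ cong (_+ (g + g)) (ℕ.+-comm d (p + p)) ⟩
  ((p + p) + d) + (g + g) ≡⟨ ℕ.+-assoc (p + p) d (g + g) ⟩
  (p + p) + (d + (g + g)) ∎)
  where
  open ℕ.≤-Reasoning
  half : p + b ≤ g + ν
  half = begin
    p + b ≤⟨ ℕ.+-monoˡ-≤ b p≤ ⟩
    (c + ρ) + b ≤⟨ ℕ.+-monoˡ-≤ b (ℕ.+-monoˡ-≤ ρ c≤) ⟩
    ((u + g) + ρ) + b ≡⟨ cong (λ t → (t + ρ) + b) (ℕ.+-comm u g) ⟩
    ((g + u) + ρ) + b ≡⟨ ℕ.+-assoc (g + u) ρ b ⟩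
    (g + u) + (ρ + b) ≡⟨ ℕ.+-assoc g u (ρ + b) ⟩
    g + (u + (ρ + b)) ≤⟨ ℕ.+-monoʳ-≤ g u≤ ⟩
    g + ν ∎

-- Breaking paths and their rerouting

record Subdivision : Set where
  field
    G   : Graph
    s r : ℕ
    br  : Fin (s + r) → Fin (Graph.n G)
    P   : Fin (s + r) → Fin (s + r) → List (Fin (Graph.n G))
    col : Fin (Graph.n G) → Bool
    br-inj : ∀ i j → br i ≡ br j → i ≡ j
    P-path : ∀ i j → KplusI s r i j ≡ true → toℕ i < toℕ j →
      Unique (br i ∷ P i j ∷ʳ br j) ×
      Linked (Edge G) (br i ∷ P i j ∷ʳ br j) ×
      Linked (λ x y → col x ≢ col y) (br i ∷ P i j ∷ʳ br j) ×
      (∀ x k → x ∈ᴸ P i j → x ≢ br k)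
    P-disjoint : ∀ i j i' j' → KplusI s r i j ≡ true → toℕ i < toℕ j →
      KplusI s r i' j' ≡ true → toℕ i' < toℕ j' →
      ¬ (i ≡ i' × j ≡ j') → ∀ x → x ∈ᴸ P i j → x ∈ᴸ P i' j' → ⊥

module Setup (D : Subdivision) where
  open Subdivision D

  n = Graph.n G
  m = s + r

  edge-sym : ∀ {x y} → Edge G x y → Edge G y x
  edge-sym {x} {y} e = trans (Graph.sym G y x) e

  Clique : Fin m → Set
  Clique i = toℕ i < s

  clique? : ∀ i → Dec (Clique i)
  clique? i = toℕ i ℕ.<? s

  Adj : Fin m → Fin m → Set
  Adj i j = i ≢ j × (Clique i ⊎ Clique j)

  adj? : ∀ i j → Dec (Adj i j)
  adj? i j = ¬? (i F.≟ j) ×-dec (clique? i ⊎-dec clique? j)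

  Adj-sym : ∀ {i j} → Adj i j → Adj j i
  Adj-sym (ne , k) = (λ e → ne (sym e)) , Sum.swap k

  KplusI-adj : ∀ {i j} → Adj i j → KplusI s r i j ≡ true
  KplusI-adj {i} {j} (ne , k) with toℕ i ≡ᵇ toℕ j | ℕ.≡ᵇ⇒≡ (toℕ i) (toℕ j)
  ... | true | f = contradiction (F.toℕ-injective (f tt)) ne
  ... | false | _ with k
  ...   | inj₁ p rewrite <ᵇ⁺ p = refl
  ...   | inj₂ q rewrite <ᵇ⁺ q = 𝔹.∨-zeroʳ (toℕ i <ᵇ s)

  -- The subdivision supplies a path only for `i` below `j`; the interior is made independent of the
  -- order of the ends.
  inner : Fin m → Fin m → List (Fin n)
  inner i j with toℕ i ℕ.<? toℕ j
  ... | yes _ = P i j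
  ... | no _ = P j i

  data Oriented (i j : Fin m) : Set where
    up   : toℕ i < toℕ j → inner i j ≡ P i j → Oriented i j
    down : toℕ j < toℕ i → inner i j ≡ P j i → Oriented i j

  orient : ∀ {i j} → Adj i j → Oriented i j
  orient {i} {j} (ne , _) with toℕ i ℕ.<? toℕ j in eq
  ... | yes p = up p lem
    where
    lem : inner i j ≡ P i j
    lem rewrite eq = refl
  ... | no ¬p = down (ℕ.≤∧≢⇒< (ℕ.≮⇒≥ ¬p) (λ e → ne (F.toℕ-injective (sym e)))) lem
    where
    lem : inner i j ≡ P j i
    lem rewrite eq = refl

  inner-sym : ∀ {i j v} → Adj i j → v ∈ˡ inner i j → v ∈ˡ inner j i
  inner-sym {i} {j} a v∈ with orient a | orient (Adj-sym a)
  ... | up p e | down q e′ = subst (_ ∈ˡ_) (trans e (sym e′)) v∈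
  ... | down p e | up q e′ = subst (_ ∈ˡ_) (trans e (sym e′)) v∈
  ... | up p _ | up q _ = contradiction p (ℕ.<-asym q)
  ... | down p _ | down q _ = contradiction p (ℕ.<-asym q)

  inner≢br : ∀ {i j v} → Adj i j → v ∈ˡ inner i j → ∀ k → v ≢ br k
  inner≢br {i} {j} {v} a v∈ k with orient a
  ... | up p e = proj₂ (proj₂ (proj₂ (P-path i j (KplusI-adj a) p))) v k (subst (v ∈ˡ_) e v∈)
  ... | down p e = proj₂ (proj₂ (proj₂ (P-path j i (KplusI-adj (Adj-sym a)) p))) v k (subst (v ∈ˡ_) e v∈)

  P-same : ∀ {i j i′ j′ v} → Adj i j → toℕ i < toℕ j → Adj i′ j′ → toℕ i′ < toℕ j′ →
    v ∈ˡ P i j → v ∈ˡ P i′ j′ → i ≡ i′ × j ≡ j′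
  P-same {i} {j} {i′} {j′} a p a′ p′ v∈ v∈′ = decidable-stable ((i F.≟ i′) ×-dec (j F.≟ j′))
    λ ne → P-disjoint i j i′ j′ (KplusI-adj a) p (KplusI-adj a′) p′ ne _ v∈ v∈′

  inner-disjoint : ∀ {i j i′ j′ v} → Adj i j → Adj i′ j′ → v ∈ˡ inner i j → v ∈ˡ inner i′ j′ →
    (i ≡ i′ × j ≡ j′) ⊎ (i ≡ j′ × j ≡ i′)
  inner-disjoint {v = v} a a′ v∈ v∈′ with orient a | orient a′
  ... | up p e | up p′ e′ = inj₁ (P-same a p a′ p′ (subst (v ∈ˡ_) e v∈) (subst (v ∈ˡ_) e′ v∈′))
  ... | up p e | down p′ e′ = inj₂ (P-same a p (Adj-sym a′) p′ (subst (v ∈ˡ_) e v∈) (subst (v ∈ˡ_) e′ v∈′))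
  ... | down p e | up p′ e′ = case P-same (Adj-sym a) p a′ p′ (subst (v ∈ˡ_) e v∈) (subst (v ∈ˡ_) e′ v∈′) of
          λ (q , q′) → inj₂ (q′ , q)
  ... | down p e | down p′ e′ = case P-same (Adj-sym a) p (Adj-sym a′) p′ (subst (v ∈ˡ_) e v∈) (subst (v ∈ˡ_) e′ v∈′) of
          λ (q , q′) → inj₁ (q′ , q)

  OnQ : Fin m → Fin m → Fin n → Set
  OnQ i j v = v ≡ br i ⊎ v ≡ br j ⊎ v ∈ˡ inner i j

  onQ? : ∀ i j v → Dec (OnQ i j v)
  onQ? i j v = (v F.≟ br i) ⊎-dec ((v F.≟ br j) ⊎-dec Any.any? (v F.≟_) (inner i j))

  onQ-sym : ∀ {i j v} → Adj i j → OnQ i j v → OnQ j i v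
  onQ-sym a (inj₁ p) = inj₂ (inj₁ p)
  onQ-sym a (inj₂ (inj₁ p)) = inj₁ p
  onQ-sym a (inj₂ (inj₂ p)) = inj₂ (inj₂ (inner-sym a p))

  QStep : Fin m → Fin m → Fin n → Fin n → Set
  QStep i j x y = (Edge G x y × col x ≢ col y) × OnQ i j x × OnQ i j y

  private
    upward : ∀ {i j} → Adj i j → toℕ i < toℕ j → inner i j ≡ P i j → Σ (Star (QStep i j) (br i) (br j)) (Simple id)
    upward {i} {j} a p eq =
      let u , l₁ , l₂ , _ = P-path i j (KplusI-adj a) p
          w , tr = linked⇒walk (br i) (P i j) (br j)
            (linked-map-All (λ q q′ e → e , q , q′) (All.tabulate on) (zipLinked l₁ l₂))
      in w , subst Unique (sym tr) u
      where
      zipLinked : {R T : Fin n → Fin n → Set} → ∀ {xs} → Linked R xs → Linked T xs → Linked (λ x y → R x y × T x y) xs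
      zipLinked [] _ = []
      zipLinked [-] _ = [-]
      zipLinked (e ∷ l) (e′ ∷ l′) = (e , e′) ∷ zipLinked l l′
      on : ∀ {v} → v ∈ˡ br i ∷ P i j ∷ʳ br j → OnQ i j v
      on (here q) = inj₁ q
      on (there q) with ∈-++⁻ (P i j) q
      ... | inj₁ q′ = inj₂ (inj₂ (subst (_ ∈ˡ_) (sym eq) q′))
      ... | inj₂ (here q′) = inj₂ (inj₁ q′)

  qStep-sym : ∀ {i j} → Adj i j → ∀ {x y} → QStep i j x y → QStep j i y x
  qStep-sym a ((e , ne) , p , q) = (edge-sym e , (λ eq → ne (sym eq))) , onQ-sym a q , onQ-sym a p

  Q : ∀ {i j} → Adj i j → Σ (Star (QStep i j) (br i) (br j)) (Simple id)
  Q {i} {j} a with orient a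
  ... | up p e = upward a p e
  ... | down p e with orient (Adj-sym a)
  ...   | down q _ = contradiction p (ℕ.<-asym q)
  ...   | up _ e′ with upward (Adj-sym a) p e′
  ...     | w , u = rev id (qStep-sym (Adj-sym a)) id w , simple-rev id (qStep-sym (Adj-sym a)) id w u

  walk-onQ : ∀ {i j x y} (w : Star (QStep i j) x y) → OnQ i j x → ∀ {v} → v ∈ˡ trace id w → OnQ i j v
  walk-onQ ε p (here refl) = p
  walk-onQ (_ ◅ w) p (here refl) = p
  walk-onQ ((_ , _ , q) ◅ w) p (there v∈) = walk-onQ w q v∈

  Coloured : Set
  Coloured = Fin n × Bool

  flip : Coloured → Coloured
  flip (v , a) = v , not a

  -- The colour flips at every step, so it records the parity of the walk: a walk from `own x` ends
  -- at `own y` if its alternating colouring agrees with `col` at `y`, and at `flip (own y)` if it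
  -- does not.
  AStep : Coloured → Coloured → Set
  AStep (x , a) (y , b) = Edge G x y × b ≡ not a

  aStep-flip : ∀ {p q} → AStep p q → AStep (flip q) (flip p)
  aStep-flip (e , refl) = edge-sym e , sym (cong not (not-involutive _))

  own : Fin n → Coloured
  own v = v , col v

  qStep⇒aStep : ∀ {i j x y} → QStep i j x y → AStep (own x) (own y)
  qStep⇒aStep ((e , ne) , _) = e , ¬-not (λ eq → ne (sym eq))

  -- Only edges between the interior of a subdivided edge and a vertex off it are charged. Chords of
  -- a subdivided edge are free; it suffices that a subdivided edge costs nothing and that entering
  -- one elsewhere than at its ends costs something.
  Bad : Fin n → Fin n → Set
  Bad x y = ∃ λ i → ∃ λ j → Adj i j × ((x ∈ˡ inner i j × ¬ OnQ i j y) ⊎ (y ∈ˡ inner i j × ¬ OnQ i j x))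

  bad? : ∀ x y → Dec (Bad x y)
  bad? x y = F.any? λ i → F.any? λ j → adj? i j ×-dec
    ((Any.any? (x F.≟_) (inner i j) ×-dec ¬? (onQ? i j y)) ⊎-dec (Any.any? (y F.≟_) (inner i j) ×-dec ¬? (onQ? i j x)))

  badness : Fin n → Fin n → ℕ
  badness x y with bad? x y
  ... | yes _ = 1
  ... | no _ = 0

  badness-bad : ∀ {x y} → Bad x y → badness x y ≡ 1
  badness-bad {x} {y} b with bad? x y
  ... | yes _ = refl
  ... | no ¬b = contradiction b ¬b

  badness-not : ∀ {x y} → ¬ Bad x y → badness x y ≡ 0
  badness-not {x} {y} ¬b with bad? x y
  ... | yes b = contradiction b ¬b
  ... | no _ = refl

  badness-sym : ∀ x y → badness x y ≡ badness y x
  badness-sym x y with bad? x y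
  ... | yes (i , j , a , b) = sym (badness-bad (i , j , a , Sum.swap b))
  ... | no ¬b = sym (badness-not λ (i , j , a , b) → ¬b (i , j , a , Sum.swap b))

  onQ-¬bad : ∀ {i j x y} → Adj i j → OnQ i j x → OnQ i j y → ¬ Bad x y
  onQ-¬bad {i} {j} a ox oy (i′ , j′ , a′ , b) = [ (λ (p , q) → q (other ox p oy)) , (λ (p , q) → q (other oy p ox)) ]′ b
    where
    other : ∀ {v w} → OnQ i j v → v ∈ˡ inner i′ j′ → OnQ i j w → OnQ i′ j′ w
    other (inj₁ refl) v∈ = contradiction refl (inner≢br a′ v∈ i)
    other (inj₂ (inj₁ refl)) v∈ = contradiction refl (inner≢br a′ v∈ j)
    other (inj₂ (inj₂ p)) v∈ ow with inner-disjoint a a′ p v∈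
    ... | inj₁ (refl , refl) = ow
    ... | inj₂ (refl , refl) = onQ-sym a ow

  weight : ∀ {p q} → Star AStep p q → ℕ
  weight ε = 0
  weight (_◅_ {i = x , _} {j = y , _} _ w) = badness x y + weight w

  weight-◅◅ : ∀ {p q t} (w : Star AStep p q) (w′ : Star AStep q t) → weight (w ◅◅ w′) ≡ weight w + weight w′
  weight-◅◅ ε w′ = refl
  weight-◅◅ (_◅_ {i = x , _} {j = y , _} e w) w′ =
    trans (cong (badness x y +_) (weight-◅◅ w w′)) (sym (ℕ.+-assoc (badness x y) _ _))

  revA : ∀ {p q} → Star AStep p q → Star AStep (flip q) (flip p)
  revA = rev flip (λ {p} {q} → aStep-flip {p} {q}) id

  simple-revA : ∀ {p q} (w : Star AStep p q) → Simple proj₁ w → Simple proj₁ (revA w)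
  simple-revA w = simple-rev flip (λ {p} {q} → aStep-flip {p} {q}) proj₁ w

  revA⁻ : ∀ {B : Set} (π : Coloured → B) {p q v} (w : Star AStep p q) → v ∈ˡ trace π (revA w) → v ∈ˡ trace (π ∘ flip) w
  revA⁻ π w = trace-rev⁻ flip (λ {p} {q} → aStep-flip {p} {q}) π w

  weight-rev : ∀ {p q} (w : Star AStep p q) → weight (revA w) ≡ weight w
  weight-rev ε = refl
  weight-rev (_◅_ {i = x , a} {j = y , b} e w) =
    trans (weight-◅◅ (revA w) _) (trans (cong₂ _+_ (weight-rev w) (trans (ℕ.+-identityʳ _) (badness-sym y x)))
      (ℕ.+-comm (weight w) _))

  liftQ : ∀ {i j x y} → Star (QStep i j) x y → Star AStep (own x) (own y)
  liftQ {i} {j} = gmap own (λ {x} {y} → qStep⇒aStep {i} {j} {x} {y})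

  weight-lift : ∀ {i j} → Adj i j → ∀ {x y} (w : Star (QStep i j) x y) → weight (liftQ w) ≡ 0
  weight-lift a ε = refl
  weight-lift a (e@(_ , ox , oy) ◅ w) = cong₂ _+_ (badness-not (onQ-¬bad a ox oy)) (weight-lift a w)

  trace-lift : ∀ {i j x y} (w : Star (QStep i j) x y) → trace proj₁ (liftQ w) ≡ trace id w
  trace-lift ε = refl
  trace-lift (_ ◅ w) = cong (_ ∷_) (trace-lift w)

  -- The first vertex of the walk on the subdivided edge is neither of its ends, hence an inner one,
  -- and the edge by which it is reached is bad.
  crossing-weight : ∀ {i j} → Adj i j → ∀ {p q} (w : Star AStep p q) → ¬ OnQ i j (proj₁ p) → OnQ i j (proj₁ q) →
    (∀ {v} → v ∈ˡ trace proj₁ w → v ≢ br i × v ≢ br j) → 1 ≤ weight w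
  crossing-weight a ε op oq off = contradiction oq op
  crossing-weight {i} {j} a (_◅_ {j = y , _} _ w) op oq off with onQ? i j y
  ... | no oy = ℕ.≤-trans (crossing-weight a w oy oq (off ∘ there)) (ℕ.m≤n+m _ _)
  ... | yes (inj₁ e) = contradiction e (proj₁ (off (there (trace-source proj₁ w))))
  ... | yes (inj₂ (inj₁ e)) = contradiction e (proj₂ (off (there (trace-source proj₁ w))))
  ... | yes (inj₂ (inj₂ y∈)) = ℕ.≤-trans (ℕ.≤-reflexive (sym (badness-bad (i , j , a , inj₂ (y∈ , op))))) (ℕ.m≤m+n _ _)

  -- A path between branch vertices that cannot be coloured consistently with col.
  record BPath : Set where
    field
      ia ib  : Fin m
      walk   : Star AStep (own (br ia)) (flip (own (br ib)))
      simple : Simple proj₁ walk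
      inside : ∀ k → br k ∈ˡ trace proj₁ walk → k ≡ ia ⊎ k ≡ ib

    vertices : List (Fin n)
    vertices = trace proj₁ walk

  open BPath

  ∈-vertices : ∀ p {v} → v ∈ˡ vertices p → ∃ λ a → (v , a) ∈ˡ trace id (walk p)
  ∈-vertices p {v} v∈ with ∈-map⁻ proj₁ (subst (v ∈ˡ_) (trace-∘ id proj₁ (walk p)) v∈)
  ... | (_ , a) , m∈ , refl = a , m∈

  vertices-∈ : ∀ p {v a} → (v , a) ∈ˡ trace id (walk p) → v ∈ˡ vertices p
  vertices-∈ p {v} m∈ = subst (v ∈ˡ_) (sym (trace-∘ id proj₁ (walk p))) (∈-map⁺ proj₁ m∈)

  unique-colour : ∀ {v a b} {xs : List Coloured} → Unique (map proj₁ xs) → (v , a) ∈ˡ xs → (v , b) ∈ˡ xs → a ≡ b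
  unique-colour u (here refl) (here refl) = refl
  unique-colour u (here refl) (there q) = contradiction (∈-map⁺ proj₁ q) (unique-head∉ u)
  unique-colour u (there p) (here refl) = contradiction (∈-map⁺ proj₁ p) (unique-head∉ u)
  unique-colour (_ ∷ u) (there p) (there q) = unique-colour u p q

  colour-unique : ∀ p {v a b} → (v , a) ∈ˡ trace id (walk p) → (v , b) ∈ˡ trace id (walk p) → a ≡ b
  colour-unique p = unique-colour (subst Unique (trace-∘ id proj₁ (walk p)) (simple p))

  flip-flip : ∀ v → flip (flip (own v)) ≡ own v
  flip-flip v = cong (v ,_) (not-involutive (col v))

  private
    source-cast : ∀ {p p′ q} → p ≡ p′ → Star AStep p q → Star AStep p′ q
    source-cast refl w = w

    trace-cast : ∀ {B : Set} (π : Coloured → B) {p p′ q} (e : p ≡ p′) (w : Star AStep p q) →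
      trace π (source-cast e w) ≡ trace π w
    trace-cast π refl w = refl

    weight-cast : ∀ {p p′ q} (e : p ≡ p′) (w : Star AStep p q) → weight (source-cast e w) ≡ weight w
    weight-cast refl w = refl

  reverseB : BPath → BPath
  reverseB p = record
    { ia = ib p ; ib = ia p
    ; walk = source-cast (flip-flip (br (ib p))) (revA (walk p))
    ; simple = subst Unique (sym (trace-cast proj₁ (flip-flip _) (revA (walk p))))
        (simple-revA (walk p) (simple p))
    ; inside = λ k k∈ → Sum.swap (inside p k (revA⁻ proj₁ (walk p)
        (subst (br k ∈ˡ_) (trace-cast proj₁ (flip-flip _) (revA (walk p))) k∈)))
    }

  vertices-reverse⁻ : ∀ p {v} → v ∈ˡ vertices (reverseB p) → v ∈ˡ vertices p
  vertices-reverse⁻ p {v} v∈ = revA⁻ proj₁ (walk p)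
    (subst (v ∈ˡ_) (trace-cast proj₁ (flip-flip _) (revA (walk p))) v∈)

  coloured-reverse : ∀ p {v a} → (v , a) ∈ˡ trace id (walk p) → (v , not a) ∈ˡ trace id (walk (reverseB p))
  coloured-reverse p {v} {a} v∈ = subst ((v , not a) ∈ˡ_) (sym (trace-cast id (flip-flip _) (revA (walk p))))
    (trace-rev⁺ flip (λ {p} {q} → aStep-flip {p} {q}) id (walk p)
      (subst ((v , not a) ∈ˡ_) (sym (trace-∘ id flip (walk p))) (∈-map⁺ flip v∈)))

  weight-reverse : ∀ p → weight (walk (reverseB p)) ≡ weight (walk p)
  weight-reverse p = trans (weight-cast (flip-flip _) (revA (walk p))) (weight-rev (walk p))

  -- The part of p before z is replaced by a piece of a subdivided edge starting at the branch vertex f.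
  reroute : ∀ p {f e u z} → Adj f e → f ≢ ia p → (pre : Star (QStep f e) (br f) u) (last : QStep f e u z) →
    Simple id pre →
    (∀ {v} → v ∈ˡ trace id pre → v ∉ˡ vertices p) → br e ∉ˡ trace id pre →
    own z ∈ˡ trace id (walk p) → ia p ≢ e →
    Σ BPath λ p′ → weight (walk p′) < weight (walk p) ×
      (∀ {v} → v ∈ˡ vertices p′ → v ∈ˡ trace id pre ⊎ v ∈ˡ vertices p)
  reroute p {f} {e} {u} {z} a f≢ia pre last simp off e∉ z∈ ia≢e with split id (walk p) z∈
  ... | _ , w₁ , w₂ , refl , eq = p′ , lighter , covered
    where
    L : Star AStep (own (br f)) (own z)
    L = liftQ (pre ◅◅ (last ◅ ε))
    L∈ : ∀ {v} → v ∈ˡ trace proj₁ L → v ∈ˡ trace id pre ⊎ v ≡ z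
    L∈ {v} v∈ with trace-◅◅⁻ id pre (subst (v ∈ˡ_) (trace-lift (pre ◅◅ (last ◅ ε))) v∈)
    ... | inj₁ q = inj₁ q
    ... | inj₂ (here refl) = inj₁ (trace-target id pre)
    ... | inj₂ (there (here q)) = inj₂ q
    simples = simple-◅◅⁻ proj₁ w₁ {w₂} (subst (Simple proj₁) eq (simple p))
    w₁⊆ : ∀ {v} → v ∈ˡ trace proj₁ w₁ → v ∈ˡ vertices p
    w₁⊆ {v} v∈ = subst (λ w → v ∈ˡ trace proj₁ w) (sym eq) (trace-◅◅⁺ˡ proj₁ w₁ {w₂} v∈)
    w₂⊆ : ∀ {v} → v ∈ˡ trace proj₁ w₂ → v ∈ˡ vertices p
    w₂⊆ {v} v∈ = subst (λ w → v ∈ˡ trace proj₁ w) (sym eq) (trace-◅◅⁺ʳ proj₁ w₁ {w₂} v∈)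
    z∈p : z ∈ˡ vertices p
    z∈p = w₁⊆ (trace-target proj₁ w₁)
    f∉p : br f ∉ˡ vertices p
    f∉p = off (trace-source id pre)
    e∉w₁ : br e ∉ˡ trace proj₁ w₁
    e∉w₁ e∈ with inside p e (w₁⊆ e∈)
    ... | inj₁ eq′ = ia≢e (sym eq′)
    -- If `e` were the last end of `p`, its vertex would lie on both parts of `p` and thus be `z`.
    -- But `p` visits `z` in its own colour and its last vertex in the opposite one.
    ... | inj₂ refl = not-¬ {col (br e)} refl
      (colour-unique p (subst (λ v → own v ∈ˡ trace id (walk p)) (sym (proj₂ (proj₂ simples) e∈ (trace-target proj₁ w₂))) z∈)
        (trace-target id (walk p)))
    z≢f : z ≢ br f
    z≢f refl = f∉p z∈p
    z≢e : z ≢ br e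
    z≢e refl = e∉w₁ (trace-target proj₁ w₁)
    z-inner : z ∈ˡ inner f e
    z-inner with proj₂ (proj₂ last)
    ... | inj₁ q = contradiction q z≢f
    ... | inj₂ (inj₁ q) = contradiction q z≢e
    ... | inj₂ (inj₂ q) = q
    simp′ : Simple id (pre ◅◅ (last ◅ ε))
    simp′ = simple-◅◅ id pre simp
      (unique-∷ (λ { (here refl) → off (trace-target id pre) z∈p ; (there ()) }) ([] ∷ []))
      λ { v∈ (here q) → q ; v∈ (there (here refl)) → contradiction z∈p (off v∈) }
    p′ : BPath
    p′ = record
      { ia = f ; ib = ib p ; walk = L ◅◅ w₂
      ; simple = simple-◅◅ proj₁ L (subst Unique (sym (trace-lift (pre ◅◅ (last ◅ ε)))) simp′) (proj₁ (proj₂ simples))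
          (λ p q → case L∈ p of λ { (inj₁ r) → contradiction (w₂⊆ q) (off r) ; (inj₂ r) → r })
      ; inside = λ k k∈ → case trace-◅◅⁻ proj₁ L k∈ of λ where
          (inj₁ q) → case L∈ q of λ where
            (inj₁ r) → case walk-onQ pre (inj₁ refl) r of λ where
              (inj₁ t) → inj₁ (br-inj k f t)
              (inj₂ (inj₁ t)) → contradiction (subst (_∈ˡ trace id pre) t r) e∉
              (inj₂ (inj₂ t)) → contradiction refl (inner≢br a t k)
            (inj₂ r) → contradiction (sym r) (inner≢br a z-inner k)
          (inj₂ q) → case inside p k (w₂⊆ q) of λ where
            (inj₁ refl) → contradiction (sym (proj₂ (proj₂ simples) (trace-source proj₁ w₁) q)) (inner≢br a z-inner k)
            (inj₂ t) → inj₂ t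
      }
    ia-off : ¬ OnQ f e (br (ia p))
    ia-off (inj₁ q) = f≢ia (br-inj f (ia p) (sym q))
    ia-off (inj₂ (inj₁ q)) = ia≢e (br-inj (ia p) e q)
    ia-off (inj₂ (inj₂ q)) = inner≢br a q (ia p) refl
    lighter : weight (L ◅◅ w₂) < weight (walk p)
    -- The new piece runs along a subdivided edge and weighs nothing. The discarded part `w₁` starts
    -- off that edge, enters it at `z` and avoids its two ends, so it weighs at least one.
    lighter = subst₂ _<_
      (sym (trans (weight-◅◅ L w₂) (cong (_+ weight w₂) (weight-lift a (pre ◅◅ (last ◅ ε))))))
      (sym (trans (cong weight eq) (weight-◅◅ w₁ w₂)))
      (ℕ.+-monoˡ-≤ (weight w₂) (crossing-weight a w₁ ia-off (inj₂ (inj₂ z-inner))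
        (λ v∈ → (λ { refl → f∉p (w₁⊆ v∈) }) , (λ { refl → e∉w₁ v∈ }))))
    covered : ∀ {v} → v ∈ˡ trace proj₁ (L ◅◅ w₂) → v ∈ˡ trace id pre ⊎ v ∈ˡ vertices p
    covered v∈ with trace-◅◅⁻ proj₁ L v∈
    ... | inj₂ q = inj₂ (w₂⊆ q)
    ... | inj₁ q with L∈ q
    ...   | inj₁ r = inj₁ r
    ...   | inj₂ refl = inj₂ z∈p

  end : BPath → Bool → Fin m
  end p false = ia p
  end p true = ib p

  -- The walk of a breaking path reaches its second end in the colour opposite to `col`; seen from
  -- that end, all its colours have to be flipped.
  side : Bool → Bool → Bool
  side false a = a
  side true a = not a

  end∈ : ∀ p τ → br (end p τ) ∈ˡ vertices p
  end∈ p false = trace-source proj₁ (walk p)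
  end∈ p true = trace-target proj₁ (walk p)

  ia≢ib : ∀ p → ia p ≢ ib p
  ia≢ib p eq = not-¬ {col (br (ia p))} refl (colour-unique p (trace-source id (walk p))
    (subst (λ i → flip (own (br i)) ∈ˡ trace id (walk p)) (sym eq) (trace-target id (walk p))))

  end-inj : ∀ p τ τ′ → end p τ ≡ end p τ′ → τ ≡ τ′
  end-inj p false false _ = refl
  end-inj p true true _ = refl
  end-inj p false true e = contradiction e (ia≢ib p)
  end-inj p true false e = contradiction (sym e) (ia≢ib p)

  towards : Bool → BPath → BPath
  towards false p = p
  towards true p = reverseB p

  ia-towards : ∀ τ p → ia (towards τ p) ≡ end p τ
  ia-towards false p = refl
  ia-towards true p = refl

  vertices-towards⁻ : ∀ τ p {v} → v ∈ˡ vertices (towards τ p) → v ∈ˡ vertices p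
  vertices-towards⁻ false p v∈ = v∈
  vertices-towards⁻ true p v∈ = vertices-reverse⁻ p v∈

  weight-towards : ∀ τ p → weight (walk (towards τ p)) ≡ weight (walk p)
  weight-towards false p = refl
  weight-towards true p = weight-reverse p

  own-towards : ∀ τ p {z} → (z , side τ (col z)) ∈ˡ trace id (walk p) → own z ∈ˡ trace id (walk (towards τ p))
  own-towards false p z∈ = z∈
  own-towards true p {z} z∈ = subst (λ a → (z , a) ∈ˡ trace id (walk (reverseB p))) (not-involutive (col z)) (coloured-reverse p z∈)

  -- Systems of disjoint breaking paths and their spokes

  record System (k : ℕ) : Set where
    field
      path     : Fin k → BPath
      disjoint : ∀ {l l′ v} → v ∈ˡ vertices (path l) → v ∈ˡ vertices (path l′) → l ≡ l′

  open System

  module _ {k : ℕ} where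

    OnSystem : System k → Fin n → Set
    OnSystem σ v = ∃ λ l → v ∈ˡ vertices (path σ l)

    onSystem? : ∀ σ v → Dec (OnSystem σ v)
    onSystem? σ v = F.any? λ l → Any.any? (v F.≟_) (vertices (path σ l))

    Free : System k → Fin m → Set
    Free σ f = ¬ OnSystem σ (br f)

    totalWeight : System k → ℕ
    totalWeight σ = sumFin λ l → weight (walk (path σ l))

    -- The subdivided edge from f to the end e = end l τ first meets the system on the path l, at a vertex z whose
    -- colour, propagated along the path from e, is the original one.
    record Spoke (σ : System k) (f : Fin m) (l : Fin k) (τ : Bool) : Set where
      field
        {u z} : Fin n
        pre   : Star (QStep f (end (path σ l) τ)) (br f) u
        last  : QStep f (end (path σ l) τ) u z
        off   : ∀ {v} → v ∈ˡ trace id pre → ¬ OnSystem σ v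
        on    : (z , side τ (col z)) ∈ˡ trace id (walk (path σ l))

    replace : (σ : System k) (l : Fin k) (p : BPath) →
      (∀ v l′ → v ∈ˡ vertices p → v ∈ˡ vertices (path σ l′) → l ≡ l′) → System k
    replace σ l p d = record { path = new ; disjoint = λ {l₁} {l₂} → disj l₁ l₂ }
      where
      new : Fin k → BPath
      new l′ with l′ F.≟ l
      ... | yes _ = p
      ... | no _ = path σ l′
      disj : ∀ l₁ l₂ {v} → v ∈ˡ vertices (new l₁) → v ∈ˡ vertices (new l₂) → l₁ ≡ l₂
      disj l₁ l₂ v∈ v∈′ with l₁ F.≟ l | l₂ F.≟ l
      ... | yes refl | yes refl = refl
      ... | yes refl | no _ = d _ l₂ v∈ v∈′
      ... | no _ | yes refl = sym (d _ l₁ v∈′ v∈)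
      ... | no _ | no _ = disjoint σ v∈ v∈′

    replace-weight : ∀ σ l p d → weight (walk p) < weight (walk (path σ l)) → totalWeight (replace σ l p d) < totalWeight σ
    replace-weight σ l p d lt = sumFin-< le l lt′
      where
      le : ∀ l′ → weight (walk (path (replace σ l p d) l′)) ≤ weight (walk (path σ l′))
      le l′ with l′ F.≟ l
      ... | yes refl = ℕ.<⇒≤ lt
      ... | no _ = ℕ.≤-refl
      lt′ : weight (walk (path (replace σ l p d) l)) < weight (walk (path σ l))
      lt′ with l F.≟ l
      ... | yes _ = lt
      ... | no ne = contradiction refl ne

    -- Let `z` be the first vertex of the subdivided edge on the system. Since the path through `z`
    -- is breaking, `z` has its original colour when coloured from exactly one of the two ends.
    -- Replacing the part between this end and `z` by the piece from `f` keeps the path breaking and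
    -- makes it lighter, unless this end is the very end `e` that the subdivided edge leads to.
    spoke-or-lighter : ∀ σ f l τ → Free σ f → Adj f (end (path σ l) τ) →
      Spoke σ f l τ ⊎ Σ (System k) λ σ′ → totalWeight σ′ < totalWeight σ
    spoke-or-lighter σ f l τ free a with Q a
    ... | q , q-simple with firstHit (onSystem? σ) q free (l , end∈ (path σ l) τ)
    ...   | hit {u} {z} pre last rest off (l′ , z∈) eq = decide (proj₂ (∈-vertices (path σ l′) z∈))
      where
      e = end (path σ l) τ
      colour-side : ∀ α → ∃ λ τ′ → α ≡ side τ′ (col z)
      colour-side α with α 𝔹.≟ col z
      ... | yes p = false , p
      ... | no ¬p = true , ¬-not ¬p
      lighten : ∀ {l′ τ′} → (z , side τ′ (col z)) ∈ˡ trace id (walk (path σ l′)) → end (path σ l′) τ′ ≢ e →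
        Σ (System k) λ σ′ → totalWeight σ′ < totalWeight σ
      lighten {l′} {τ′} mem ne with reroute (towards τ′ (path σ l′)) a
        (λ eq → free (l′ , subst (λ i → br i ∈ˡ vertices (path σ l′)) (trans (sym (ia-towards τ′ _)) (sym eq)) (end∈ _ τ′)))
        pre last (proj₁ (simple-◅◅⁻ id pre (subst (Simple id) eq q-simple)))
        (λ v∈ v∈′ → off v∈ (l′ , vertices-towards⁻ τ′ _ v∈′))
        (λ e∈ → off e∈ (l , end∈ (path σ l) τ)) (own-towards τ′ (path σ l′) mem)
        (λ eq → ne (trans (sym (ia-towards τ′ _)) eq))
      ... | p′ , lt , cover = replace σ l′ p′ separate , replace-weight σ l′ p′ separate
        (subst (weight (walk p′) <_) (weight-towards τ′ (path σ l′)) lt)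
        where
        separate : ∀ v l″ → v ∈ˡ vertices p′ → v ∈ˡ vertices (path σ l″) → l′ ≡ l″
        separate v l″ v∈ v∈′ with cover v∈
        ... | inj₁ q = contradiction (_ , v∈′) (off q)
        ... | inj₂ q = disjoint σ (vertices-towards⁻ τ′ _ q) v∈′
      decide : ∀ {α} → (z , α) ∈ˡ trace id (walk (path σ l′)) → Spoke σ f l τ ⊎ Σ (System k) λ σ′ → totalWeight σ′ < totalWeight σ
      decide {α} mem with colour-side α
      ... | τ′ , refl with l′ F.≟ l | τ′ 𝔹.≟ τ
      ...   | yes refl | yes refl = inj₁ record { pre = pre ; last = last ; off = off ; on = mem }
      ...   | yes refl | no ne = inj₂ (lighten {τ′ = τ′} mem λ eq → ne (end-inj (path σ l) τ′ τ eq))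
      ...   | no ne | _ = inj₂ (lighten {τ′ = τ′} mem λ eq → ne (disjoint σ
                (subst (λ i → br i ∈ˡ vertices (path σ l′)) eq (end∈ (path σ l′) τ′)) (end∈ (path σ l) τ)))

    AllSpokes : System k → Set
    AllSpokes σ = ∀ f l τ → Free σ f → Adj f (end (path σ l) τ) → Spoke σ f l τ

    all-spokes-or-lighter : ∀ σ → AllSpokes σ ⊎ Σ (System k) λ σ′ → totalWeight σ′ < totalWeight σ
    all-spokes-or-lighter σ with all-or-one (λ f → all-or-one (λ l → both (try f l false) (try f l true)))
      where
      both : ∀ {Pr : Bool → Set} {B : Set} → Pr false ⊎ B → Pr true ⊎ B → (∀ τ → Pr τ) ⊎ B
      both (inj₂ b) _ = inj₂ b
      both (inj₁ _) (inj₂ b) = inj₂ b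
      both (inj₁ p) (inj₁ q) = inj₁ λ { false → p ; true → q }
      try : ∀ f l τ → (Free σ f → Adj f (end (path σ l) τ) → Spoke σ f l τ) ⊎ Σ (System k) λ σ′ → totalWeight σ′ < totalWeight σ
      try f l τ with ¬? (onSystem? σ (br f)) | adj? f (end (path σ l) τ)
      ... | no ¬free | _ = inj₁ λ free → contradiction free ¬free
      ... | yes _ | no ¬a = inj₁ λ _ a → contradiction a ¬a
      ... | yes free | yes a = Sum.map₁ (λ g _ _ → g) (spoke-or-lighter σ f l τ free a)
    ... | inj₁ h = inj₁ h
    ... | inj₂ h = inj₂ h

    spoked-system : System k → Σ (System k) AllSpokes
    spoked-system σ = loop (totalWeight σ) σ ℕ.≤-refl
      where
      loop : ∀ b σ → totalWeight σ ≤ b → Σ (System k) AllSpokes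
      loop b σ le with all-spokes-or-lighter σ
      ... | inj₁ h = σ , h
      loop zero σ le | inj₂ (σ′ , lt) = contradiction (ℕ.≤-trans lt le) λ ()
      loop (suc b) σ le | inj₂ (σ′ , lt) = loop b σ′ (s≤s⁻¹ (ℕ.≤-trans lt le))

  -- The odd minor

  side-side : ∀ o a → side o (side o a) ≡ a
  side-side false a = refl
  side-side true a = not-involutive a

  side-not : ∀ o a → side o (side (not o) a) ≡ not a
  side-not false a = refl
  side-not true a = refl

  side-∘not : ∀ o a → side o (not a) ≡ not (side o a)
  side-∘not false a = refl
  side-∘not true a = refl

  module OddMinor {k : ℕ} (s≡ : s ≡ k + k) (r≡ : r ≡ suc k) (σ : System k) (spokes : AllSpokes σ) where
    open System

    private
      -- The implication is what makes trees of two paths adjacent: a finish outside the clique then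
      -- betrays a start outside it, and such a start is served by a centre in the clique.
      orientation : ∀ p → Dec (Clique (ia p)) → Dec (Clique (ib p)) → Σ Bool λ o → Clique (end p o) → Clique (end p (not o))
      orientation p _ (yes c) = false , λ _ → c
      orientation p (yes _) (no ¬c) = true , λ c → contradiction c ¬c
      orientation p (no ¬c) (no _) = false , λ c → contradiction c ¬c

      oriented : ∀ l → Σ Bool λ o → Clique (end (path σ l) o) → Clique (end (path σ l) (not o))
      oriented l = orientation (path σ l) (clique? _) (clique? _)

    tag : Fin k → Bool
    tag l = proj₁ (oriented l)

    start finish : Fin k → Fin m
    start l = end (path σ l) (tag l)
    finish l = end (path σ l) (not (tag l))

    clique-start⇒finish : ∀ l → Clique (start l) → Clique (finish l)
    clique-start⇒finish l = proj₂ (oriented l)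

    on-start : ∀ l → OnSystem σ (br (start l))
    on-start l = l , end∈ (path σ l) (tag l)

    on-finish : ∀ l → OnSystem σ (br (finish l))
    on-finish l = l , end∈ (path σ l) (not (tag l))

    starts finishes : List (Fin m)
    starts = Data.List.tabulate start
    finishes = Data.List.tabulate finish

    free? : ∀ f → Dec (Free σ f)
    free? f = ¬? (onSystem? σ (br f))

    L L′ : List (Fin m)
    L = filter (λ f → free? f ×-dec clique? f) (allFin m)
    L′ = filter (λ f → free? f ×-dec ¬? (clique? f)) (allFin m)

    L⁻ : ∀ {f} → f ∈ˡ L → Free σ f × Clique f
    L⁻ f∈ = proj₂ (∈-filter⁻ (λ f → free? f ×-dec clique? f) {xs = allFin m} f∈)

    L′⁻ : ∀ {f} → f ∈ˡ L′ → Free σ f × ¬ Clique f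
    L′⁻ f∈ = proj₂ (∈-filter⁻ (λ f → free? f ×-dec ¬? (clique? f)) {xs = allFin m} f∈)

    LL′-unique : Unique (L ++ L′)
    LL′-unique = unique-++ (Uniq.filter⁺ _ (Uniq.allFin⁺ m)) (Uniq.filter⁺ _ (Uniq.allFin⁺ m))
      (λ p q → proj₂ (L′⁻ q) (proj₂ (L⁻ p)))

    LL′-free : ∀ {f} → f ∈ˡ L ++ L′ → Free σ f
    LL′-free p = [ proj₁ ∘ L⁻ , proj₁ ∘ L′⁻ ]′ (∈-++⁻ L p)

    end-cases : ∀ l τ → end (path σ l) τ ≡ start l ⊎ end (path σ l) τ ≡ finish l
    end-cases l τ with τ 𝔹.≟ tag l
    ... | yes refl = inj₁ refl
    ... | no ne = inj₂ (cong (end (path σ l)) (¬-not ne))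

    nonfree-end : ∀ i → OnSystem σ (br i) → i ∈ˡ starts ⊎ i ∈ˡ finishes
    nonfree-end i (l , i∈) with inside (path σ l) i i∈
    ... | inj₁ eq = which (end-cases l false)
      where
      which : ia (path σ l) ≡ start l ⊎ ia (path σ l) ≡ finish l → i ∈ˡ starts ⊎ i ∈ˡ finishes
      which (inj₁ e) = inj₁ (subst (_∈ˡ starts) (trans (sym e) (sym eq)) (∈-tabulate⁺ l))
      which (inj₂ e) = inj₂ (subst (_∈ˡ finishes) (trans (sym e) (sym eq)) (∈-tabulate⁺ l))
    ... | inj₂ eq = which (end-cases l true)
      where
      which : ib (path σ l) ≡ start l ⊎ ib (path σ l) ≡ finish l → i ∈ˡ starts ⊎ i ∈ˡ finishes
      which (inj₁ e) = inj₁ (subst (_∈ˡ starts) (trans (sym e) (sym eq)) (∈-tabulate⁺ l))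
      which (inj₂ e) = inj₂ (subst (_∈ˡ finishes) (trans (sym e) (sym eq)) (∈-tabulate⁺ l))

    enough : suc k ≤ length L + length L′
    enough = ℕ.+-cancelˡ-≤ (k + k) _ _ (subst₂ _≤_ (cong₂ _+_ s≡ r≡) total
      (ℕ.≤-trans (ℕ.≤-reflexive (sym (L.length-tabulate id))) (unique-⊆⇒length≤ (Uniq.allFin⁺ m) sub)))
      where
      total : length ((starts ++ finishes) ++ L ++ L′) ≡ (k + k) + (length L + length L′)
      total = trans (L.length-++ (starts ++ finishes)) (cong₂ _+_
        (trans (L.length-++ starts) (cong₂ _+_ (L.length-tabulate start) (L.length-tabulate finish)))
        (L.length-++ L))
      sub : ∀ {i} → i ∈ˡ allFin m → i ∈ˡ (starts ++ finishes) ++ L ++ L′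
      sub {i} i∈ with onSystem? σ (br i) | clique? i
      ... | yes on | _ = ∈-++⁺ˡ ([ ∈-++⁺ˡ , ∈-++⁺ʳ starts ]′ (nonfree-end i on))
      ... | no free | yes c = ∈-++⁺ʳ (starts ++ finishes) (∈-++⁺ˡ (∈-filter⁺ _ i∈ (free , c)))
      ... | no free | no ¬c = ∈-++⁺ʳ (starts ++ finishes) (∈-++⁺ʳ L (∈-filter⁺ _ i∈ (free , ¬c)))

    -- The centre `suc l` has to be joined to the start of path `l`, and the centre `zero`, which
    -- has no path of its own, to all finishes. Where such an end lies outside the clique, the
    -- centre must lie inside.
    needy : Fin (suc k) → Bool
    needy zero = fails (F.all? λ l → clique? (finish l))
    needy (suc l) = fails (clique? (start l))

    -- Each clique vertex is free or an end, so there are as many free clique vertices as ends outside the clique.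
    needs-met : sumFin (toNat ∘ needy) ≤ length L
    needs-met = ℕ.≤-trans needs (ℕ.+-cancelʳ-≤ (κs + κf) _ _ (ℕ.≤-trans (ℕ.≤-reflexive balance) clique-count))
      where
      ιs = sumFin (failures clique? ∘ start)
      ιf = sumFin (failures clique? ∘ finish)
      κs = length (filter clique? starts)
      κf = length (filter clique? finishes)
      balance : (ιs + ιf) + (κs + κf) ≡ s
      balance = trans (interchange ιs ιf κs κf) (trans (cong₂ _+_
        (trans (ℕ.+-comm ιs κs) (filter-tabulate clique? start))
        (trans (ℕ.+-comm ιf κf) (filter-tabulate clique? finish))) (sym s≡))
      clique-count : s ≤ length L + (κs + κf)
      clique-count = subst₂ _≤_ (trans (L.length-map (_↑ˡ r) (allFin s)) (L.length-tabulate id))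
        (trans (L.length-++ L) (cong (length L +_) (L.length-++ (filter clique? starts))))
        (unique-⊆⇒length≤ (Uniq.map⁺ (F.↑ˡ-injective r _ _) (Uniq.allFin⁺ s)) sub)
        where
        sub : ∀ {i} → i ∈ˡ map (_↑ˡ r) (allFin s) → i ∈ˡ L ++ filter clique? starts ++ filter clique? finishes
        sub i∈ with ∈-map⁻ (_↑ˡ r) i∈
        ... | j , _ , refl with onSystem? σ (br (j ↑ˡ r))
        ...   | no free = ∈-++⁺ˡ (∈-filter⁺ _ (∈-allFin _) (free , c))
          where
          c : Clique (j ↑ˡ r)
          c = subst (_< s) (sym (F.toℕ-↑ˡ j r)) (F.toℕ<n j)
        ...   | yes on = ∈-++⁺ʳ L ([ (λ p → ∈-++⁺ˡ (∈-filter⁺ clique? p c)) ,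
                  (λ p → ∈-++⁺ʳ (filter clique? starts) (∈-filter⁺ clique? p c)) ]′ (nonfree-end _ on))
          where
          c : Clique (j ↑ˡ r)
          c = subst (_< s) (sym (F.toℕ-↑ˡ j r)) (F.toℕ<n j)
      -- The centre `zero` is needy only if some finish lies outside the clique; that finish pays
      -- for it.
      zero-needs : toNat (needy zero) ≤ ιf
      zero-needs with F.all? (λ l → clique? (finish l))
      ... | yes _ = z≤n
      ... | no ¬all with F.any? (λ l → ¬? (clique? (finish l)))
      ...   | no none = contradiction (λ l → decidable-stable (clique? (finish l)) (λ ¬c → none (l , ¬c))) ¬all
      ...   | yes (l , ¬c) = ℕ.≤-trans (ℕ.≤-reflexive (sym (cong toNat (fails-no (clique? (finish l)) ¬c))))
                (sumFin-member (failures clique? ∘ finish) l)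
      needs : sumFin (toNat ∘ needy) ≤ ιs + ιf
      needs = ℕ.≤-trans (ℕ.+-mono-≤ zero-needs ℕ.≤-refl) (ℕ.≤-reflexive (ℕ.+-comm ιf ιs))

    module Centred (centre : Fin (suc k) → Fin m) (centre-inj : ∀ {i j} → centre i ≡ centre j → i ≡ j)
      (centre-free : ∀ i → Free σ (centre i)) (centre-clique : ∀ i → needy i ≡ true → Clique (centre i)) where

      centre≢ : ∀ i {j} → OnSystem σ (br j) → centre i ≢ j
      centre≢ i on refl = centre-free i on

      adj-start : ∀ l → Adj (centre (suc l)) (start l)
      adj-start l = centre≢ (suc l) (on-start l) , (case clique? (start l) of λ where
        (yes c) → inj₂ c
        (no ¬c) → inj₁ (centre-clique (suc l) (fails-no (clique? (start l)) ¬c)))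

      adj-finish₀ : ∀ l → Adj (centre zero) (finish l)
      adj-finish₀ l = centre≢ zero (on-finish l) , (case clique? (finish l) of λ where
        (yes c) → inj₂ c
        (no ¬c) → inj₁ (centre-clique zero (fails-no (F.all? λ l → clique? (finish l)) (λ all → ¬c (all l)))))

      -- One of the two directions is enough for a monochromatic edge between the trees. If the
      -- finish of `l′` is outside the clique, so is its start, and the centre of `l′` is therefore
      -- a clique vertex joined to every finish.
      adj-finish : ∀ l l′ → Adj (centre (suc l)) (finish l′) ⊎ Adj (centre (suc l′)) (finish l)
      adj-finish l l′ with clique? (finish l′)
      ... | yes c = inj₁ (centre≢ (suc l) (on-finish l′) , inj₂ c)
      ... | no ¬c = inj₂ (centre≢ (suc l′) (on-finish l) ,
              inj₁ (centre-clique (suc l′) (fails-no (clique? (start l′)) (λ c → ¬c (clique-start⇒finish l′ c)))))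

      -- On a path this is the alternating colouring that agrees with `col` at the start, elsewhere
      -- it is `col` itself. So the colouring turns against `col` towards the finishes.
      α : Fin n → Bool
      α v with onSystem? σ v
      ... | yes (l , v∈) = side (tag l) (proj₁ (∈-vertices (path σ l) v∈))
      ... | no _ = col v

      α-on : ∀ {l v a} → (v , a) ∈ˡ trace id (walk (path σ l)) → α v ≡ side (tag l) a
      α-on {l} {v} {a} m∈ with onSystem? σ v
      ... | no ¬on = contradiction (l , vertices-∈ (path σ l) m∈) ¬on
      ... | yes (l′ , v∈) with disjoint σ v∈ (vertices-∈ (path σ l) m∈)
      ...   | refl = cong (side (tag l)) (colour-unique (path σ l) (proj₂ (∈-vertices (path σ l) v∈)) m∈)

      α-off : ∀ {v} → ¬ OnSystem σ v → α v ≡ col v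
      α-off {v} ¬on with onSystem? σ v
      ... | yes on = contradiction on ¬on
      ... | no _ = refl

      spoke : ∀ i l τ → Adj (centre i) (end (path σ l) τ) → Spoke σ (centre i) l τ
      spoke i l τ = spokes (centre i) l τ (centre-free i)

      spokeVertices : Fin (suc k) → Fin k → Bool → List (Fin n)
      spokeVertices i l τ with adj? (centre i) (end (path σ l) τ)
      ... | yes a = trace id (Spoke.pre (spoke i l τ a))
      ... | no _ = []

      spokeVertices-adj : ∀ i l τ → Adj (centre i) (end (path σ l) τ) →
        Σ (Spoke σ (centre i) l τ) λ g → spokeVertices i l τ ≡ trace id (Spoke.pre g)
      spokeVertices-adj i l τ a with adj? (centre i) (end (path σ l) τ)
      ... | yes a′ = spoke i l τ a′ , refl
      ... | no ¬a = contradiction a ¬a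

      spokeVertices⇒adj : ∀ i l τ {v} → v ∈ˡ spokeVertices i l τ → Adj (centre i) (end (path σ l) τ)
      spokeVertices⇒adj i l τ v∈ with adj? (centre i) (end (path σ l) τ)
      ... | yes a = a

      -- All spokes of the centre are included up to, but without, their last vertices, which lie on
      -- paths. There is one centre more than there are paths, and the set of `zero` contains no
      -- path.
      Branch : Fin (suc k) → Fin n → Set
      Branch i v = v ≡ br (centre i) ⊎ (∃ λ l → i ≡ suc l × v ∈ˡ vertices (path σ l)) ⊎
        (∃ λ l → ∃ λ τ → v ∈ˡ spokeVertices i l τ)

      branch? : ∀ i v → Dec (Branch i v)
      branch? i v = (v F.≟ br (centre i)) ⊎-dec
        ((F.any? λ l → (i F.≟ suc l) ×-dec Any.any? (v F.≟_) (vertices (path σ l))) ⊎-dec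
         (F.any? λ l → map′ [ (λ p → false , p) , (λ p → true , p) ]′ (λ { (false , p) → inj₁ p ; (true , p) → inj₂ p })
            (Any.any? (v F.≟_) (spokeVertices i l false) ⊎-dec Any.any? (v F.≟_) (spokeVertices i l true))))

      BranchEdge : Fin (suc k) → Fin n → Fin n → Set
      BranchEdge i x y = (Edge G x y × α x ≢ α y) × Branch i x × Branch i y

      branchEdge? : ∀ i x y → Dec (BranchEdge i x y)
      branchEdge? i x y = ((Graph.adj G x y 𝔹.≟ true) ×-dec ¬? (α x 𝔹.≟ α y)) ×-dec (branch? i x ×-dec branch? i y)

      branchEdge-sym : ∀ {i x y} → BranchEdge i x y → BranchEdge i y x
      branchEdge-sym ((e , ne) , p , q) = (edge-sym e , λ eq → ne (sym eq)) , q , p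

      -- This is the information on which disjointness rests: away from the paths, a vertex is the
      -- centre or lies inside a subdivided edge from the centre to an end of some path.
      Position : Fin (suc k) → Fin n → Set
      Position i v = (∃ λ l → i ≡ suc l × v ∈ˡ vertices (path σ l)) ⊎
        (¬ OnSystem σ v × (v ≡ br (centre i) ⊎ ∃ λ e → OnSystem σ (br e) × Adj (centre i) e × v ∈ˡ inner (centre i) e))

      position : ∀ {i v} → Branch i v → Position i v
      position {i} (inj₁ refl) = inj₂ (centre-free i , inj₁ refl)
      position (inj₂ (inj₁ p)) = inj₁ p
      position {i} {v} (inj₂ (inj₂ (l , τ , v∈))) with adj? (centre i) (end (path σ l) τ)
      ... | yes a = inj₂ (off v∈ , (case walk-onQ pre (inj₁ refl) v∈ of λ where
              (inj₁ p) → inj₁ p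
              (inj₂ (inj₁ refl)) → contradiction (l , end∈ (path σ l) τ) (off v∈)
              (inj₂ (inj₂ p)) → inj₂ (_ , (l , end∈ (path σ l) τ) , a , p)))
        where
        open Spoke (spoke i l τ a)

      branches-disjoint : ∀ {i j v} → i ≢ j → Branch i v → Branch j v → ⊥
      branches-disjoint {i} {j} {v} i≢j bi bj with position bi | position bj
      ... | inj₁ (l , refl , p) | inj₁ (l′ , refl , q) = i≢j (cong suc (disjoint σ p q))
      ... | inj₁ (l , _ , p) | inj₂ (off , _) = off (l , p)
      ... | inj₂ (off , _) | inj₁ (l , _ , q) = off (l , q)
      ... | inj₂ (_ , inj₁ refl) | inj₂ (_ , inj₁ q) = i≢j (centre-inj (br-inj _ _ q))
      ... | inj₂ (_ , inj₁ refl) | inj₂ (_ , inj₂ (e , _ , a , q)) = inner≢br a q (centre i) refl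
      ... | inj₂ (_ , inj₂ (e , _ , a , p)) | inj₂ (_ , inj₁ refl) = inner≢br a p (centre j) refl
      ... | inj₂ (_ , inj₂ (e , _ , a , p)) | inj₂ (_ , inj₂ (e′ , on , a′ , q)) with inner-disjoint a a′ p q
      ...   | inj₁ (eq , _) = i≢j (centre-inj eq)
      -- The same subdivided edge read in the opposite direction would make a centre an end of a
      -- path, but centres are free.
      ...   | inj₂ (eq , _) = centre≢ i on eq

      spoke-walk : ∀ i l τ → Adj (centre i) (end (path σ l) τ) → Σ (Spoke σ (centre i) l τ) λ g →
        spokeVertices i l τ ≡ trace id (Spoke.pre g) × (∀ {v} → v ∈ˡ trace id (Spoke.pre g) → Branch i v × Star (BranchEdge i) (br (centre i)) v)
      spoke-walk i l τ a with spokeVertices-adj i l τ a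
      ... | g , eq = g , eq , λ v∈ → branch v∈ , (case split id pre v∈ of λ { (_ , w₁ , w₂ , refl , eq′) →
          gmap-within id w₁ λ {x} {y} x∈ y∈ ((e , ne) , _) →
            let x∈′ = subst (λ w → x ∈ˡ trace id w) (sym eq′) (trace-◅◅⁺ˡ id w₁ x∈)
                y∈′ = subst (λ w → y ∈ˡ trace id w) (sym eq′) (trace-◅◅⁺ˡ id w₁ y∈)
            in (e , subst₂ _≢_ (sym (α-off (off x∈′))) (sym (α-off (off y∈′))) ne) , branch x∈′ , branch y∈′ })
        where
        open Spoke g
        branch : ∀ {v} → v ∈ˡ trace id pre → Branch i v
        branch v∈ = inj₂ (inj₂ (l , τ , subst (_ ∈ˡ_) (sym eq) v∈))

      from-source : ∀ l {v} → v ∈ˡ vertices (path σ l) → Star (BranchEdge (suc l)) (br (ia (path σ l))) v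
      from-source l v∈ with split proj₁ (walk (path σ l)) v∈
      ... | _ , w₁ , w₂ , refl , eq = gmap-within proj₁ w₁ step
        where
        step : ∀ {p q} → p ∈ˡ trace id w₁ → q ∈ˡ trace id w₁ → AStep p q → BranchEdge (suc l) (proj₁ p) (proj₁ q)
        step {x , a} {y , b} p∈ q∈ (e , refl) =
          (e , subst₂ _≢_ (sym (α-on (widen p∈))) (sym (trans (α-on (widen q∈)) (side-∘not (tag l) a))) (not-¬ refl)) ,
          inj₂ (inj₁ (l , refl , vertices-∈ (path σ l) (widen p∈))) , inj₂ (inj₁ (l , refl , vertices-∈ (path σ l) (widen q∈)))
          where
          widen : ∀ {p} → p ∈ˡ trace id w₁ → p ∈ˡ trace id (walk (path σ l))
          widen {p} p∈ = subst (λ w → p ∈ˡ trace id w) (sym eq) (trace-◅◅⁺ˡ id w₁ p∈)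

      branch-connected : ∀ {i v} → Branch i v → Star (BranchEdge i) (br (centre i)) v
      branch-connected (inj₁ refl) = ε
      branch-connected {i} (inj₂ (inj₂ (l , τ , v∈))) with spoke-walk i l τ (spokeVertices⇒adj i l τ v∈)
      ... | g , eq , reach = proj₂ (reach (subst (_ ∈ˡ_) eq v∈))
      branch-connected (inj₂ (inj₁ (l , refl , v∈))) with spoke-walk (suc l) l (tag l) (adj-start l)
      ... | g , _ , reach = proj₂ (reach (trace-target id pre)) ◅◅
          (((proj₁ (proj₁ last) , subst₂ _≢_ (sym (α-off (off (trace-target id pre)))) (sym αz) (proj₂ (proj₁ last))) ,
            proj₁ (reach (trace-target id pre)) , inj₂ (inj₁ (l , refl , z∈))) ◅
           (rev id branchEdge-sym id (from-source l z∈) ◅◅ from-source l v∈))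
        where
        open Spoke g
        z∈ : z ∈ˡ vertices (path σ l)
        z∈ = vertices-∈ (path σ l) on
        -- The two flips of `side` cancel because the spoke leads to the start; its last edge is
        -- therefore properly coloured and may belong to the tree.
        αz : α z ≡ col z
        αz = trans (α-on on) (side-side (tag l) (col z))

      branchTree : ∀ i → Σ (List (Fin n)) λ xs → Tree (BranchEdge i) (br (centre i)) xs ×
        (∀ {v} → v ∈ˡ xs → Branch i v) × (∀ {v} → Branch i v → v ∈ˡ xs)
      branchTree i with spanning (branchEdge? i) (br (centre i))
      ... | xs , t , closed = xs , t , (λ v∈ → only (tree-reach t v∈) (inj₁ refl)) ,
          λ b → closed-under-walks closed (branch-connected b) (tree-root∈ t)
        where
        only : ∀ {x y} → Star (BranchEdge i) x y → Branch i x → Branch i y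
        only ε b = b
        only ((_ , _ , b) ◅ w) _ = only w b

      Touching : Fin (suc k) → Fin (suc k) → Set
      Touching i j = ∃ λ x → ∃ λ y → Branch i x × Branch j y × Edge G x y × α x ≡ α y

      touching-sym : ∀ {i j} → Touching i j → Touching j i
      touching-sym (x , y , p , q , e , eq) = y , x , q , p , edge-sym e , sym eq

      -- The spoke is coloured by `col`, and its last vertex `z` has colour `col z` when coloured
      -- from the finish, hence the opposite colour under `α`. This makes the last edge of the spoke
      -- monochromatic.
      touching-finish : ∀ i l → Adj (centre i) (finish l) → Touching i (suc l)
      touching-finish i l a with spoke-walk i l (not (tag l)) a
      ... | g , _ , reach = u , z , proj₁ (reach (trace-target id pre)) ,
          inj₂ (inj₁ (l , refl , vertices-∈ (path σ l) on)) , proj₁ (proj₁ last) ,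
          trans (α-off (off (trace-target id pre))) (trans (¬-not (proj₂ (proj₁ last)))
            (sym (trans (α-on on) (side-not (tag l) (col z)))))
        where
        open Spoke g

      touching : ∀ i j → i ≢ j → Touching i j
      touching zero zero ne = contradiction refl ne
      touching zero (suc l) _ = touching-finish zero l (adj-finish₀ l)
      touching (suc l) zero _ = touching-sym (touching-finish zero l (adj-finish₀ l))
      touching (suc l) (suc l′) _ = [ touching-finish (suc l) l′ , (λ a → touching-sym (touching-finish (suc l′) l a)) ]′
        (adj-finish l l′)

      oddMinor-centred : HasOddKMinor G (suc k)
      oddMinor-centred = (λ i → treeSub (tree i)) , α ,
        (λ i → ((λ _ _ → tt) , (λ x y e → proj₁ (proj₁ (treeEdge-R branchEdge-sym (tree i) e)) , treeEdge-∈ (tree i) e) ,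
          λ x y e → treeEdge-sym (tree i) e) , treeSub-isTree (tree i)) ,
        (λ i j v ne p q → branches-disjoint ne (tree⇒branch i p) (tree⇒branch j q)) ,
        (λ i x y e → proj₂ (proj₁ (treeEdge-R branchEdge-sym (tree i) e))) ,
        λ i j ne → case touching i j ne of λ (x , y , p , q , e , eq) →
          x , y , branch⇒tree i p , branch⇒tree j q , e , eq
        where
        tree : ∀ i → Tree (BranchEdge i) (br (centre i)) (proj₁ (branchTree i))
        tree i = proj₁ (proj₂ (branchTree i))
        tree⇒branch : ∀ i {v} → v ∈ˡ proj₁ (branchTree i) → Branch i v
        tree⇒branch i = proj₁ (proj₂ (proj₂ (branchTree i)))
        branch⇒tree : ∀ i {v} → Branch i v → v ∈ˡ proj₁ (branchTree i)
        branch⇒tree i = proj₂ (proj₂ (proj₂ (branchTree i)))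

    oddMinor : HasOddKMinor G (suc k)
    oddMinor = Centred.oddMinor-centred A.choice A.injective (LL′-free ∘ A.chosen∈) (λ i e → proj₂ (L⁻ (A.where-D i e)))
      where
      A : Assignment (suc k) needy L L′
      A = assign (suc k) needy L L′ LL′-unique needs-met enough
      module A = Assignment A

  system⇒oddMinor : ∀ {k} → s ≡ k + k → r ≡ suc k → System k → HasOddKMinor G (suc k)
  system⇒oddMinor s≡ r≡ σ = case spoked-system σ of λ (σ′ , spokes) → OddMinor.oddMinor s≡ r≡ σ′ spokes

  -- The block

  aStep-sym : ∀ {p q} → AStep p q → AStep q p
  aStep-sym (e , refl) = edge-sym e , sym (not-involutive _)

  record Deletion : Set where
    field
      X     : Subset n
      i₀    : Fin m
      i₀∉K  : ¬ Clique i₀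
      small : ∣ X ∣ + 2 ≤ s

  module Avoiding (𝒳 : Deletion) where
    open Deletion 𝒳

    Outer : Fin n → Fin n → Set
    Outer x y = Edge G x y × x ∉ X × y ∉ X

    outer? : ∀ x y → Dec (Outer x y)
    outer? x y = (Graph.adj G x y 𝔹.≟ true) ×-dec (¬? (x ∈? X) ×-dec ¬? (y ∈? X))

    outer-sym : ∀ {x y} → Outer x y → Outer y x
    outer-sym (e , p , q) = edge-sym e , q , p

    outer-irrefl : ∀ {x y} → Outer x y → x ≢ y
    outer-irrefl {x} (e , _) refl = case trans (sym e) (Graph.irrefl G x) of λ ()

    record Breaking : Set where
      field
        {i j}  : Fin m
        walk   : Star AStep (own (br i)) (flip (own (br j)))
        simple : Simple proj₁ walk
        avoids : ∀ {v} → v ∈ˡ trace proj₁ walk → v ∉ X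

    OuterBut : List (Fin n) → Fin n → Fin n → Set
    OuterBut C x y = Outer x y × x ∉ˡ C × y ∉ˡ C

    outerBut-sym : ∀ {C x y} → OuterBut C x y → OuterBut C y x
    outerBut-sym (e , p , q) = outer-sym e , q , p

    -- Deleting X and at most one more vertex leaves one of the s internally disjoint routes from i to j, the k-th
    -- of which passes through the clique vertex k; for k = i this is replaced by i₀, and the route through j is the
    -- subdivided edge itself.
    module _ (C : List (Fin n)) (C-small : length C ≤ 1) {i j : Fin m} (i≢j : i ≢ j) (j∈K : Clique j)
      (i∉X : br i ∉ X) (i∉C : br i ∉ˡ C) (j∉X : br j ∉ X) (j∉C : br j ∉ˡ C) where

      private
        Y : List (Fin n)
        Y = C ++ elements X

        Y-small : length Y < s
        Y-small = ℕ.≤-trans (s≤s (subst (_≤ 1 + ∣ X ∣) (sym (trans (L.length-++ C) (cong (length C +_) (length-elements X))))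
            (ℕ.+-monoˡ-≤ ∣ X ∣ C-small))) (ℕ.≤-trans (ℕ.≤-reflexive (ℕ.+-comm 2 ∣ X ∣)) small)

        i∉Y : br i ∉ˡ Y
        i∉Y p = [ i∉C , (λ q → i∉X (∈-elements⁻ q)) ]′ (∈-++⁻ C p)

        j∉Y : br j ∉ˡ Y
        j∉Y p = [ j∉C , (λ q → j∉X (∈-elements⁻ q)) ]′ (∈-++⁻ C p)

        via : Fin s → Fin m
        via k with (k ↑ˡ r) F.≟ i
        ... | yes _ = i₀
        ... | no _ = k ↑ˡ r

        ↑-clique : ∀ (k : Fin s) → Clique (k ↑ˡ r)
        ↑-clique k = subst (_< s) (sym (F.toℕ-↑ˡ k r)) (F.toℕ<n k)

        via-adj : ∀ k → Adj i (via k)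
        via-adj k with (k ↑ˡ r) F.≟ i
        ... | yes refl = (λ e → i₀∉K (subst Clique e (↑-clique k))) , inj₁ (↑-clique k)
        ... | no ne = (λ e → ne (sym e)) , inj₂ (↑-clique k)

        via-inj : ∀ {k l} → via k ≡ via l → k ≡ l
        via-inj {k} {l} e with (k ↑ˡ r) F.≟ i | (l ↑ˡ r) F.≟ i
        ... | yes p | yes q = F.↑ˡ-injective r k l (trans p (sym q))
        ... | yes _ | no _ = contradiction (subst Clique (sym e) (↑-clique l)) i₀∉K
        ... | no _ | yes _ = contradiction (subst Clique e (↑-clique k)) i₀∉K
        ... | no _ | no _ = F.↑ˡ-injective r k l e

        Via : Fin m → Fin n → Set
        Via v y = y ∈ˡ inner i v ⊎ (v ≢ j × (y ≡ br v ⊎ y ∈ˡ inner v j))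

        via? : ∀ v y → Dec (Via v y)
        via? v y = Any.any? (y F.≟_) (inner i v) ⊎-dec (¬? (v F.≟ j) ×-dec ((y F.≟ br v) ⊎-dec Any.any? (y F.≟_) (inner v j)))

        via-to : ∀ {v} → v ≢ j → Adj v j
        via-to ne = ne , inj₂ j∈K

        via-disjoint : ∀ {v v′ y} → Adj i v → Adj i v′ → Via v y → Via v′ y → v ≡ v′
        via-disjoint a a′ (inj₁ p) (inj₁ q) with inner-disjoint a a′ p q
        ... | inj₁ (_ , e) = e
        ... | inj₂ (e , _) = contradiction e (proj₁ a′)
        via-disjoint a a′ (inj₁ p) (inj₂ (_ , inj₁ refl)) = contradiction refl (inner≢br a p _)
        via-disjoint a a′ (inj₁ p) (inj₂ (ne , inj₂ q)) with inner-disjoint a (via-to ne) p q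
        ... | inj₁ (e , _) = contradiction e (proj₁ a′)
        ... | inj₂ (e , _) = contradiction e i≢j
        via-disjoint a a′ (inj₂ (_ , inj₁ refl)) (inj₁ q) = contradiction refl (inner≢br a′ q _)
        via-disjoint a a′ (inj₂ (_ , inj₁ refl)) (inj₂ (_ , inj₁ e)) = br-inj _ _ e
        via-disjoint a a′ (inj₂ (_ , inj₁ refl)) (inj₂ (ne , inj₂ q)) = contradiction refl (inner≢br (via-to ne) q _)
        via-disjoint a a′ (inj₂ (ne , inj₂ p)) (inj₁ q) with inner-disjoint a′ (via-to ne) q p
        ... | inj₁ (e , _) = contradiction e (proj₁ a)
        ... | inj₂ (e , _) = contradiction e i≢j
        via-disjoint a a′ (inj₂ (ne , inj₂ p)) (inj₂ (_ , inj₁ refl)) = contradiction refl (inner≢br (via-to ne) p _)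
        via-disjoint a a′ (inj₂ (ne , inj₂ p)) (inj₂ (ne′ , inj₂ q)) with inner-disjoint (via-to ne) (via-to ne′) p q
        ... | inj₁ (e , _) = e
        ... | inj₂ (e , _) = contradiction e ne

        ∉Y : ∀ {x} → x ∉ˡ Y → x ∉ X × x ∉ˡ C
        ∉Y x∉ = (λ p → x∉ (∈-++⁺ʳ C (∈-elements⁺ p))) , λ p → x∉ (∈-++⁺ˡ p)

        clear : ∀ {x y} → Edge G x y → x ∉ˡ Y → y ∉ˡ Y → OuterBut C x y
        clear e p q = (e , proj₁ (∉Y p) , proj₁ (∉Y q)) , proj₂ (∉Y p) , proj₂ (∉Y q)

        piece : ∀ {i j} → Adj i j → br i ∉ˡ Y → br j ∉ˡ Y → (∀ {y} → y ∈ˡ inner i j → y ∉ˡ Y) →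
          Star (OuterBut C) (br i) (br j)
        piece {i} {j} a i∉ j∉ in∉ = gmap id (λ ((e , _) , p , q) → clear e (on∉ p) (on∉ q)) (proj₁ (Q a))
          where
          on∉ : ∀ {v} → OnQ i j v → v ∉ˡ Y
          on∉ (inj₁ refl) = i∉
          on∉ (inj₂ (inj₁ refl)) = j∉
          on∉ (inj₂ (inj₂ p)) = in∉ p

        route : ∀ k → (∃ λ y → y ∈ˡ Y × Via (via k) y) ⊎ Star (OuterBut C) (br i) (br j)
        route k with Any.any? (via? (via k)) Y
        ... | yes p = inj₁ (_ , proj₂ (find p))
        ... | no free with via k F.≟ j
        ...   | yes e = inj₂ (subst (λ v → Star (OuterBut C) (br i) (br v)) e
                  (piece (via-adj k) i∉Y (subst (λ v → br v ∉ˡ Y) (sym e) j∉Y) (λ p y∈ → free (lose y∈ (inj₁ p)))))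
        ...   | no ne = inj₂ (piece (via-adj k) i∉Y v∉Y (λ p y∈ → free (lose y∈ (inj₁ p))) ◅◅
                  piece (via-to ne) v∉Y j∉Y (λ p y∈ → free (lose y∈ (inj₂ (ne , inj₂ p)))))
          where
          v∉Y : br (via k) ∉ˡ Y
          v∉Y y∈ = free (lose y∈ (inj₂ (ne , inj₁ refl)))

      joined : Star (OuterBut C) (br i) (br j)
      joined with all-or-one route
      ... | inj₂ w = w
      ... | inj₁ blocked = contradiction Y-small (ℕ.≤⇒≯ (subst (_≤ length Y) (L.length-tabulate (proj₁ ∘ blocked))
              (unique-⊆⇒length≤ (Uniq.tabulate⁺ inj)
                λ y∈ → case ∈-tabulate⁻ y∈ of λ { (k , refl) → proj₁ (proj₂ (blocked k)) })))
        where
        inj : ∀ {k l} → proj₁ (blocked k) ≡ proj₁ (blocked l) → k ≡ l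
        inj {k} {l} e = via-inj (via-disjoint (via-adj k) (via-adj l) (proj₂ (proj₂ (blocked k)))
          (subst (Via (via l)) (sym e) (proj₂ (proj₂ (blocked l)))))

    -- Ear systems grown from two clique vertices

    record Hubs : Set where
      field
        {k₁ k₂} : Fin m
        k₁≢k₂ : k₁ ≢ k₂
        k₁∈K  : Clique k₁
        k₂∈K  : Clique k₂
        k₁∉X  : br k₁ ∉ X
        k₂∉X  : br k₂ ∉ X

    module Ears (ℋ : Hubs) where
      open Hubs ℋ

      hub : Bool → Fin m
      hub true = k₁
      hub false = k₂

      hub-clique : ∀ b → Clique (hub b)
      hub-clique true = k₁∈K
      hub-clique false = k₂∈K

      hub∉X : ∀ b → br (hub b) ∉ X
      hub∉X true = k₁∉X
      hub∉X false = k₂∉X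

      hub-≢ : ∀ b → br (hub b) ≢ br (hub (not b))
      hub-≢ true e = k₁≢k₂ (br-inj _ _ e)
      hub-≢ false e = k₁≢k₂ (sym (br-inj _ _ e))

      other-hub : ∀ w → ∃ λ b → br (hub b) ≢ w
      other-hub w with br k₁ F.≟ w
      ... | no ne = true , ne
      ... | yes refl = false , hub-≢ false

      keys : List Coloured → List (Fin n)
      keys = map proj₁

      keys∈ : ∀ {W p} → p ∈ˡ W → proj₁ p ∈ˡ keys W
      keys∈ = ∈-map⁺ proj₁

      key? : ∀ W x → Dec (x ∈ˡ keys W)
      key? W x = Any.any? (x F.≟_) (keys W)

      trace-keys : ∀ {p q} (w : Star AStep p q) {v} → v ∈ˡ trace proj₁ w → ∃ λ x → x ∈ˡ trace id w × proj₁ x ≡ v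
      trace-keys w {v} v∈ = case ∈-map⁻ proj₁ (subst (v ∈ˡ_) (trace-∘ id proj₁ w) v∈) of λ (x , x∈ , e) → x , x∈ , sym e

      keys-trace : ∀ {p q} (w : Star AStep p q) {x} → x ∈ˡ trace id w → proj₁ x ∈ˡ trace proj₁ w
      keys-trace w x∈ = subst (_ ∈ˡ_) (sym (trace-∘ id proj₁ w)) (∈-map⁺ proj₁ x∈)

      record Link (W : List Coloured) (p q : Coloured) : Set where
        field
          b      : Bool
          walk₁  : Star AStep (own (br (hub b))) p
          walk₂  : Star AStep (own (br (hub (not b)))) q
          simple : Unique (trace proj₁ walk₁ ++ trace proj₁ walk₂)
          in₁    : ∀ {x} → x ∈ˡ trace id walk₁ → x ∈ˡ W
          in₂    : ∀ {x} → x ∈ˡ trace id walk₂ → x ∈ˡ W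

      open Link

      Apart : ∀ {W p q} → Link W p q → Fin n → Set
      Apart l v = v ∉ˡ trace proj₁ (walk₁ l) × v ∉ˡ trace proj₁ (walk₂ l)

      link-swap : ∀ {W p q} → Link W p q → Link W q p
      link-swap l with b l | walk₁ l | walk₂ l | simple l | in₁ l | in₂ l
      ... | true | w₁ | w₂ | u | i₁ | i₂ = record { b = false ; walk₁ = w₂ ; walk₂ = w₁ ; in₁ = i₂ ; in₂ = i₁
            ; simple = case unique-++⁻ (trace proj₁ w₁) u of λ (p , q , d) → unique-++ q p (λ x y → d y x) }
      ... | false | w₁ | w₂ | u | i₁ | i₂ = record { b = true ; walk₁ = w₂ ; walk₂ = w₁ ; in₁ = i₂ ; in₂ = i₁
            ; simple = case unique-++⁻ (trace proj₁ w₁) u of λ (p , q , d) → unique-++ q p (λ x y → d y x) }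

      apart-swap : ∀ {W p q} (l : Link W p q) {v} → Apart l v → Apart (link-swap l) v
      apart-swap l (x , y) with b l | walk₁ l | walk₂ l | simple l | in₁ l | in₂ l
      ... | true | w₁ | w₂ | u | i₁ | i₂ = y , x
      ... | false | w₁ | w₂ | u | i₁ | i₂ = y , x

      link-widen : ∀ {W W′ p q} → (∀ {x} → x ∈ˡ W → x ∈ˡ W′) → Link W p q → Link W′ p q
      link-widen sub l = record { b = b l ; walk₁ = walk₁ l ; walk₂ = walk₂ l ; simple = simple l
        ; in₁ = sub ∘ in₁ l ; in₂ = sub ∘ in₂ l }

      extend : ∀ {W p q x} (l : Link W p q) (e : Star AStep p x) → Simple proj₁ e →
        (∀ {v} → v ∈ˡ trace proj₁ e → v ≡ proj₁ p ⊎ Apart l v) → (∀ {v} → v ∈ˡ trace id e → v ∈ˡ W) → Link W x q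
      extend {p = p} l e simp off in-e with unique-++⁻ (trace proj₁ (walk₁ l)) (simple l)
      ... | u₁ , u₂ , d = record
        { b = b l ; walk₁ = walk₁ l ◅◅ e ; walk₂ = walk₂ l
        ; simple = unique-++
            (simple-◅◅ proj₁ (walk₁ l) u₁ simp λ v∈ v∈e → case off v∈e of λ where
              (inj₁ r) → r
              (inj₂ r) → contradiction v∈ (proj₁ r)) u₂
            λ v∈ v∈₂ → case trace-◅◅⁻ proj₁ (walk₁ l) v∈ of λ where
              (inj₁ r) → d r v∈₂
              (inj₂ r) → case off r of λ where
                (inj₁ refl) → d (trace-target proj₁ (walk₁ l)) v∈₂
                (inj₂ t) → proj₂ t v∈₂
        ; in₁ = λ v∈ → [ in₁ l , in-e ]′ (trace-◅◅⁻ id (walk₁ l) v∈)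
        ; in₂ = in₂ l }

      apart-extend : ∀ {W p q x} (l : Link W p q) (e : Star AStep p x) (simp : Simple proj₁ e)
        (off : ∀ {v} → v ∈ˡ trace proj₁ e → v ≡ proj₁ p ⊎ Apart l v) (in-e : ∀ {v} → v ∈ˡ trace id e → v ∈ˡ W) →
        ∀ {v} → Apart l v → v ∉ˡ trace proj₁ e → Apart (extend l e simp off in-e) v
      apart-extend l e simp off in-e (a₁ , a₂) v∉ with unique-++⁻ (trace proj₁ (walk₁ l)) (simple l)
      ... | u₁ , u₂ , d = (λ v∈ → [ a₁ , v∉ ]′ (trace-◅◅⁻ proj₁ (walk₁ l) v∈)) , a₂

      link-key : ∀ {W p q} (l : Link W p q) {v} → v ∉ˡ keys W → Apart l v
      link-key {W} l {v} v∉ = (λ v∈ → case trace-keys (walk₁ l) v∈ of λ { (x , x∈ , refl) → v∉ (keys∈ (in₁ l x∈)) }) ,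
        (λ v∈ → case trace-keys (walk₂ l) v∈ of λ { (x , x∈ , refl) → v∉ (keys∈ (in₂ l x∈)) })

      -- Links are a stronger invariant than 2-connectedness, and serve twice: a link closes any
      -- violation of the colouring into a breaking path, and the link of a vertex with a deleted
      -- one shows that the former still reaches a hub.
      record EarSystem : Set where
        field
          W      : List Coloured
          unique : Unique (keys W)
          hub∈   : ∀ b → own (br (hub b)) ∈ˡ W
          avoids : ∀ {p} → p ∈ˡ W → proj₁ p ∉ X
          link   : ∀ {p q} → p ∈ˡ W → q ∈ˡ W → proj₁ p ≢ proj₁ q → Link W p q

      open EarSystem

      initial : EarSystem
      initial = record
        { W = W₀ ; unique = unique-∷ (λ { (here e) → k₁≢k₂ (br-inj _ _ e) ; (there ()) }) ([] ∷ [])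
        ; hub∈ = hub∈₀
        ; avoids = λ { (here refl) → k₁∉X ; (there (here refl)) → k₂∉X }
        ; link = λ { (here refl) (here refl) ne → contradiction refl ne
                   ; (here refl) (there (here refl)) _ → trivial true
                   ; (there (here refl)) (here refl) _ → trivial false
                   ; (there (here refl)) (there (here refl)) ne → contradiction refl ne } }
        where
        W₀ : List Coloured
        W₀ = own (br k₁) ∷ own (br k₂) ∷ []
        hub∈₀ : ∀ b → own (br (hub b)) ∈ˡ W₀
        hub∈₀ true = here refl
        hub∈₀ false = there (here refl)
        trivial : ∀ b → Link W₀ (own (br (hub b))) (own (br (hub (not b))))
        trivial b = record { b = b ; walk₁ = ε ; walk₂ = ε
          ; simple = unique-∷ (λ { (here e) → hub-≢ b e ; (there ()) }) ([] ∷ [])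
          ; in₁ = λ { (here refl) → hub∈₀ b } ; in₂ = λ { (here refl) → hub∈₀ (not b) } }

      -- The link leads back from q to the other hub, with all colours flipped.
      breaking : ∀ (S : EarSystem) {p q} → Link (W S) p q → (e : Star AStep p (flip q)) → Simple proj₁ e →
        (∀ {v} → v ∈ˡ trace proj₁ e → v ≡ proj₁ p ⊎ v ≡ proj₁ q ⊎ v ∉ˡ keys (W S)) →
        (∀ {v} → v ∈ˡ trace proj₁ e → v ∉ X) → Breaking
      breaking S {p} {q} l e simp off out = record
        { walk = walk₁ l ◅◅ e ◅◅ revA (walk₂ l)
        ; simple = simple-◅◅ proj₁ (walk₁ l) u₁
            (simple-◅◅ proj₁ e simp (simple-revA (walk₂ l) u₂)
              λ v∈ v∈₂ → case off v∈ of λ where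
                (inj₁ refl) → contradiction (back v∈₂) (d (trace-target proj₁ (walk₁ l)))
                (inj₂ (inj₁ r)) → r
                (inj₂ (inj₂ r)) → contradiction (back v∈₂) (proj₂ (link-key l r)))
            (λ v∈₁ v∈ → case trace-◅◅⁻ proj₁ e v∈ of λ where
              (inj₂ r) → contradiction (back r) (d v∈₁)
              (inj₁ r) → case off r of λ where
                (inj₁ t) → t
                (inj₂ (inj₁ refl)) → contradiction (trace-target proj₁ (walk₂ l)) (d v∈₁)
                (inj₂ (inj₂ t)) → contradiction v∈₁ (proj₁ (link-key l t)))
        ; avoids = λ v∈ → case trace-◅◅⁻ proj₁ (walk₁ l) v∈ of λ where
            (inj₁ r) → case trace-keys (walk₁ l) r of λ { (x , x∈ , refl) → avoids S (in₁ l x∈) }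
            (inj₂ r) → case trace-◅◅⁻ proj₁ e r of λ where
              (inj₁ t) → out t
              (inj₂ t) → case trace-keys (walk₂ l) (back t) of λ { (x , x∈ , refl) → avoids S (in₂ l x∈) } }
        where
        back : ∀ {v} → v ∈ˡ trace proj₁ (revA (walk₂ l)) → v ∈ˡ trace proj₁ (walk₂ l)
        back = revA⁻ proj₁ (walk₂ l)
        u₁ = proj₁ (unique-++⁻ (trace proj₁ (walk₁ l)) (simple l))
        u₂ = proj₁ (proj₂ (unique-++⁻ (trace proj₁ (walk₁ l)) (simple l)))
        d : ∀ {v} → v ∈ˡ trace proj₁ (walk₁ l) → v ∉ˡ trace proj₁ (walk₂ l)
        d = proj₂ (proj₂ (unique-++⁻ (trace proj₁ (walk₁ l)) (simple l)))

      aRev : ∀ {p q} → Star AStep p q → Star AStep q p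
      aRev = rev id (λ {p} {q} → aStep-sym {p} {q}) id

      aRev-simple : ∀ {p q} (w : Star AStep p q) → Simple proj₁ w → Simple proj₁ (aRev w)
      aRev-simple w = simple-rev id (λ {p} {q} → aStep-sym {p} {q}) proj₁ w

      aRev⁻ : ∀ {p q} {B : Set} (π : Coloured → B) (w : Star AStep p q) {v} → v ∈ˡ trace π (aRev w) → v ∈ˡ trace π w
      aRev⁻ π w = trace-rev⁻ id (λ {p} {q} → aStep-sym {p} {q}) π w

      module AddEar (S : EarSystem) {p q y y′ : Coloured} (p∈ : p ∈ˡ W S) (q∈ : q ∈ˡ W S) (p≢q : proj₁ p ≢ proj₁ q)
        (first : AStep p y) (w : Star AStep y y′) (last : AStep y′ q) (w-simple : Simple proj₁ w)
        (fresh : ∀ {v} → v ∈ˡ trace proj₁ w → v ∉ˡ keys (W S)) where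

        ear : Star AStep p q
        ear = first ◅ (w ◅◅ (last ◅ ε))

        C W′ : List Coloured
        C = trace id w
        W′ = C ++ W S

        C-fresh : ∀ {x} → x ∈ˡ C → proj₁ x ∉ˡ keys (W S)
        C-fresh x∈ = fresh (keys-trace w x∈)

        ear-keys : ∀ {v} → v ∈ˡ trace proj₁ ear → v ≡ proj₁ p ⊎ v ≡ proj₁ q ⊎ v ∉ˡ keys (W S)
        ear-keys (here e) = inj₁ e
        ear-keys (there v∈) with trace-◅◅⁻ proj₁ w v∈
        ... | inj₁ r = inj₂ (inj₂ (fresh r))
        ... | inj₂ (here refl) = inj₂ (inj₂ (fresh (trace-target proj₁ w)))
        ... | inj₂ (there (here e)) = inj₂ (inj₁ e)

        ear-W′ : ∀ {x} → x ∈ˡ trace id ear → x ∈ˡ W′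
        ear-W′ (here refl) = ∈-++⁺ʳ C p∈
        ear-W′ (there x∈) with trace-◅◅⁻ id w x∈
        ... | inj₁ r = ∈-++⁺ˡ r
        ... | inj₂ (here refl) = ∈-++⁺ˡ (trace-target id w)
        ... | inj₂ (there (here refl)) = ∈-++⁺ʳ C q∈

        C-ear : ∀ {x} → x ∈ˡ C → x ∈ˡ trace id ear
        C-ear x∈ = there (trace-◅◅⁺ˡ id w x∈)

        ear-simple : Simple proj₁ ear
        ear-simple = unique-∷ p∉ (simple-◅◅ proj₁ w w-simple
            (unique-∷ (λ { (here e) → fresh (trace-target proj₁ w) (subst (_∈ˡ keys (W S)) (sym e) (keys∈ q∈)) ; (there ()) })
              ([] ∷ []))
            λ { v∈ (here e) → e ; v∈ (there (here refl)) → contradiction (keys∈ q∈) (fresh v∈) })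
          where
          p∉ : proj₁ p ∉ˡ trace proj₁ (w ◅◅ (last ◅ ε))
          p∉ m∈ with trace-◅◅⁻ proj₁ w m∈
          ... | inj₁ r = fresh r (keys∈ p∈)
          ... | inj₂ (here e) = fresh (trace-target proj₁ w) (subst (_∈ˡ keys (W S)) e (keys∈ p∈))
          ... | inj₂ (there (here e)) = p≢q e

        module Cut {x : Coloured} (e₁ : Star AStep p x) (e₂ : Star AStep x q) (eq : ear ≡ e₁ ◅◅ e₂)
          (x∉ : proj₁ x ∉ˡ keys (W S)) where

          private
            parts = simple-◅◅⁻ proj₁ e₁ {e₂} (subst (Simple proj₁) eq ear-simple)

          simple₁ : Simple proj₁ e₁
          simple₁ = proj₁ parts

          simple₂ : Simple proj₁ e₂
          simple₂ = proj₁ (proj₂ parts)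

          meet : ∀ {v} → v ∈ˡ trace proj₁ e₁ → v ∈ˡ trace proj₁ e₂ → v ≡ proj₁ x
          meet = proj₂ (proj₂ parts)

          in₁-W′ : ∀ {v} → v ∈ˡ trace id e₁ → v ∈ˡ W′
          in₁-W′ {v} v∈ = ear-W′ (subst (λ e → v ∈ˡ trace id e) (sym eq) (trace-◅◅⁺ˡ id e₁ v∈))

          in₂-W′ : ∀ {v} → v ∈ˡ trace id e₂ → v ∈ˡ W′
          in₂-W′ {v} v∈ = ear-W′ (subst (λ e → v ∈ˡ trace id e) (sym eq) (trace-◅◅⁺ʳ id e₁ v∈))

          off₁ : ∀ {v} → v ∈ˡ trace proj₁ e₁ → v ≡ proj₁ p ⊎ v ∉ˡ keys (W S)
          off₁ {v} v∈ with ear-keys (subst (λ e → v ∈ˡ trace proj₁ e) (sym eq) (trace-◅◅⁺ˡ proj₁ e₁ v∈))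
          ... | inj₁ r = inj₁ r
          ... | inj₂ (inj₂ r) = inj₂ r
          ... | inj₂ (inj₁ refl) = contradiction (subst (_∈ˡ keys (W S)) (meet v∈ (trace-target proj₁ e₂)) (keys∈ q∈)) x∉

          off₂ : ∀ {v} → v ∈ˡ trace proj₁ e₂ → v ≡ proj₁ q ⊎ v ∉ˡ keys (W S)
          off₂ {v} v∈ with ear-keys (subst (λ e → v ∈ˡ trace proj₁ e) (sym eq) (trace-◅◅⁺ʳ proj₁ e₁ v∈))
          ... | inj₂ r = r
          ... | inj₁ refl = contradiction (subst (_∈ˡ keys (W S)) (meet (trace-source proj₁ e₁) v∈) (keys∈ p∈)) x∉

        old : ∀ {x} → x ∈ˡ W S → x ∈ˡ W′
        old = ∈-++⁺ʳ C

        -- The link of `p` with `z` is prolonged along the ear to `x`; if `z` is `p` itself, the ear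
        -- is entered from `q` instead.
        link-mixed : ∀ {x z} → x ∈ˡ C → z ∈ˡ W S → Link W′ x z
        link-mixed {x} {z} x∈ z∈ with split id ear (C-ear x∈)
        ... | _ , e₁ , e₂ , refl , eq with proj₁ p F.≟ proj₁ z
        ...   | no ne = extend (link-widen old (link S p∈ z∈ ne)) e₁ simple₁
                  (Sum.map₂ (link-key (link S p∈ z∈ ne)) ∘ off₁) in₁-W′
          where open Cut e₁ e₂ eq (C-fresh x∈)
        ...   | yes refl = extend (link-widen old (link S q∈ z∈ (λ e → p≢q (sym e)))) (aRev e₂) (aRev-simple e₂ simple₂)
                  (Sum.map₂ (link-key (link S q∈ z∈ (λ e → p≢q (sym e)))) ∘ off₂ ∘ aRev⁻ proj₁ e₂) (in₂-W′ ∘ aRev⁻ id e₂)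
          where open Cut e₁ e₂ eq (C-fresh x∈)

        -- With `x` before `z` on the ear, the link of `p` with `q` is prolonged at both ends:
        -- forwards from `p` to `x` and backwards from `q` to `z`.
        link-ordered : ∀ {x z} (e₁ : Star AStep p x) (e₂ : Star AStep x z) (e₃ : Star AStep z q) →
          ear ≡ e₁ ◅◅ e₂ ◅◅ e₃ → x ∈ˡ C → z ∈ˡ C → proj₁ x ≢ proj₁ z → Link W′ x z
        link-ordered {x} {z} e₁ e₂ e₃ eq x∈ z∈ ne = link-swap
          (extend (link-swap l₁) (aRev e₃) (aRev-simple e₃ Z.simple₂)
            (λ v∈ → Sum.map₂ (λ v∉ → apart-swap l₁ (apart-extend l₀ e₁ X.simple₁ off X.in₁-W′ (link-key l v∉) (beyond (aRev⁻ proj₁ e₃ v∈))))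
              (Z.off₂ (aRev⁻ proj₁ e₃ v∈)))
            (Z.in₂-W′ ∘ aRev⁻ id e₃))
          where
          module X = Cut e₁ (e₂ ◅◅ e₃) eq (C-fresh x∈)
          module Z = Cut (e₁ ◅◅ e₂) e₃ (trans eq (sym (Star.◅◅-assoc e₁ e₂ e₃))) (C-fresh z∈)
          l = link S p∈ q∈ p≢q
          l₀ = link-widen old l
          off : ∀ {v} → v ∈ˡ trace proj₁ e₁ → v ≡ proj₁ p ⊎ Apart l₀ v
          off v∈ = Sum.map₂ (link-key l) (X.off₁ v∈)
          l₁ = extend l₀ e₁ X.simple₁ off X.in₁-W′
          -- The ear being simple, a vertex common to the two outer pieces would equal both `x` and
          -- `z`.
          beyond : ∀ {v} → v ∈ˡ trace proj₁ e₃ → v ∉ˡ trace proj₁ e₁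
          beyond {v} v∈₃ v∈₁ = ne (trans (sym (X.meet v∈₁ (trace-◅◅⁺ʳ proj₁ e₂ v∈₃)))
            (Z.meet (trace-◅◅⁺ˡ proj₁ e₁ v∈₁) v∈₃))

        link-new : ∀ {x z} → x ∈ˡ C → z ∈ˡ C → proj₁ x ≢ proj₁ z → Link W′ x z
        link-new {x} {z} x∈ z∈ ne with split id ear (C-ear x∈)
        ... | _ , e₁ , e₂ , refl , eq with trace-◅◅⁻ id e₁ (subst (λ e → z ∈ˡ trace id e) eq (C-ear z∈))
        ...   | inj₂ z∈₂ with split id e₂ z∈₂
        ...     | _ , f₁ , f₂ , refl , refl = link-ordered e₁ f₁ f₂ eq x∈ z∈ ne
        link-new {x} {z} x∈ z∈ ne | _ , e₁ , e₂ , refl , eq | inj₁ z∈₁ with split id e₁ z∈₁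
        ...     | _ , f₁ , f₂ , refl , refl = link-swap (link-ordered f₁ f₂ e₂ (trans eq (Star.◅◅-assoc f₁ f₂ e₂)) z∈ x∈
                    (λ e → ne (sym e)))

        extended : (∀ {v} → v ∈ˡ trace proj₁ w → v ∉ X) → EarSystem
        extended out = record
          { W = W′
          ; unique = subst Unique (sym (L.map-++ proj₁ C (W S)))
              (unique-++ (subst Unique (trace-∘ id proj₁ w) w-simple) (unique S)
                (λ v∈ → fresh (subst (_ ∈ˡ_) (sym (trace-∘ id proj₁ w)) v∈)))
          ; hub∈ = λ b → old (hub∈ S b)
          ; avoids = λ x∈ → [ (λ r → out (keys-trace w r)) , avoids S ]′ (∈-++⁻ C x∈)
          ; link = λ x∈ z∈ → links (∈-++⁻ C x∈) (∈-++⁻ C z∈) }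
          where
          links : ∀ {x z} → x ∈ˡ C ⊎ x ∈ˡ W S → z ∈ˡ C ⊎ z ∈ˡ W S → proj₁ x ≢ proj₁ z → Link W′ x z
          links (inj₁ x∈) (inj₁ z∈) ne = link-new x∈ z∈ ne
          links (inj₁ x∈) (inj₂ z∈) ne = link-mixed x∈ z∈
          links (inj₂ x∈) (inj₁ z∈) ne = link-swap (link-mixed z∈ x∈)
          links (inj₂ x∈) (inj₂ z∈) ne = link-widen old (link S x∈ z∈ ne)

      Off : List (Fin n) → Fin n → Fin n → Set
      Off K x y = Outer x y × x ∉ˡ K × y ∉ˡ K

      -- An ear has to bring a new vertex. Edges between vertices already present belong to the
      -- induced subgraph anyway and are checked for colour separately, by `clash`.
      Ear : List (Fin n) → Set
      Ear K = ∃ λ u → ∃ λ v → ∃ λ y → ∃ λ y′ →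
        (u ∈ˡ K × v ∈ˡ K × u ≢ v) × (Outer u y × y ∉ˡ K × Outer y′ v) × Star (Off K) y y′

      ear? : ∀ K → Dec (Ear K)
      ear? K = F.any? λ u → F.any? λ v → F.any? λ y → F.any? λ y′ →
        (in? u ×-dec (in? v ×-dec ¬? (u F.≟ v))) ×-dec ((outer? u y ×-dec (¬? (in? y) ×-dec outer? y′ v)) ×-dec
          star? (λ a b → outer? a b ×-dec (¬? (in? a) ×-dec ¬? (in? b))) y y′)
        where
        in? : ∀ x → Dec (x ∈ˡ K)
        in? x = Any.any? (x F.≟_) K

      paint : ∀ {T : Fin n → Fin n → Set} → (∀ {x y} → T x y → Edge G x y) → ∀ {x y} a (w : Star T x y) →
        ∃ λ b → Σ (Star AStep (x , a) (y , b)) λ w′ → trace proj₁ w′ ≡ trace id w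
      paint f a ε = a , ε , refl
      paint f a (e ◅ w) with paint f (not a) w
      ... | b , w′ , eq = b , (f e , refl) ◅ w′ , cong (_ ∷_) eq

      coloured : ∀ {W u} → u ∈ˡ keys W → ∃ λ a → (u , a) ∈ˡ W
      coloured u∈ = case ∈-map⁻ proj₁ u∈ of λ { ((_ , a) , x∈ , refl) → a , x∈ }

      add-ear : ∀ S → Ear (keys (W S)) → Breaking ⊎ Σ EarSystem λ S′ → length (W S) < length (W S′)
      add-ear S (u , v , y , y′ , (u∈ , v∈ , u≢v) , ((e , _) , y∉ , (e′ , y′∉X , _)) , star) with shortcut F._≟_ star
      ... | w , w-simple , _ with coloured {W S} u∈ | coloured {W S} v∈
      ...   | a , p∈ | d , q∈ with paint (proj₁ ∘ proj₁) (not a) w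
      ...     | b , w′ , eq = result
        where
        w′-simple : Simple proj₁ w′
        w′-simple = subst Unique (sym eq) w-simple
        off : ∀ {x y} (w : Star (Off (keys (W S))) x y) → x ∉ˡ keys (W S) → y ∉ X → ∀ {v} → v ∈ˡ trace id w →
          v ∉ˡ keys (W S) × v ∉ X
        off ε p q (here refl) = p , q
        off (((_ , r , _) , _) ◅ w) p q (here refl) = p , r
        off ((_ , _ , r) ◅ w) p q (there m∈) = off w r q m∈
        off′ : ∀ {v} → v ∈ˡ trace proj₁ w′ → v ∉ˡ keys (W S) × v ∉ X
        off′ m∈ = off w y∉ y′∉X (subst (_ ∈ˡ_) eq m∈)
        result : Breaking ⊎ Σ EarSystem λ S′ → length (W S) < length (W S′)
        result with d 𝔹.≟ not b
        ... | yes refl = inj₂ (extended (proj₂ ∘ off′) ,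
                longer w′)
          where
          open AddEar S p∈ q∈ u≢v (e , refl) w′ (e′ , refl) w′-simple (proj₁ ∘ off′)
          longer : ∀ {p q} (w : Star AStep p q) → length (W S) < length (trace id w ++ W S)
          longer ε = ℕ.≤-refl
          longer (_ ◅ w) = ℕ.m≤n⇒m≤1+n (longer w)
        -- The ear arrives at `v` in the wrong colour, that is, at the flipped vertex from which
        -- `breaking` continues to the other hub.
        ... | no ne = inj₁ (breaking S (link S p∈ q∈ u≢v) ear ear-simple′ ear-off ear-out)
          where
          last : AStep (y′ , b) (v , not d)
          last = e′ , cong not (trans (¬-not ne) (not-involutive b))
          ear : Star AStep (u , a) (v , not d)
          ear = (e , refl) ◅ (w′ ◅◅ (last ◅ ε))
          ear-off : ∀ {x} → x ∈ˡ trace proj₁ ear → x ≡ u ⊎ x ≡ v ⊎ x ∉ˡ keys (W S)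
          ear-off (here r) = inj₁ r
          ear-off (there x∈) with trace-◅◅⁻ proj₁ w′ x∈
          ... | inj₁ r = inj₂ (inj₂ (proj₁ (off′ r)))
          ... | inj₂ (here refl) = inj₂ (inj₂ (proj₁ (off′ (trace-target proj₁ w′))))
          ... | inj₂ (there (here r)) = inj₂ (inj₁ r)
          ear-out : ∀ {x} → x ∈ˡ trace proj₁ ear → x ∉ X
          ear-out (here refl) = avoids S p∈
          ear-out (there x∈) with trace-◅◅⁻ proj₁ w′ x∈
          ... | inj₁ r = proj₂ (off′ r)
          ... | inj₂ (here refl) = y′∉X
          ... | inj₂ (there (here refl)) = avoids S q∈
          ear-simple′ : Simple proj₁ ear
          ear-simple′ = unique-∷ u∉ (simple-◅◅ proj₁ w′ w′-simple
              (unique-∷ (λ { (here refl) → proj₁ (off′ (trace-target proj₁ w′)) v∈ ; (there ()) }) ([] ∷ []))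
              λ { _ (here r) → r ; m∈ (there (here refl)) → contradiction v∈ (proj₁ (off′ m∈)) })
            where
            u∉ : u ∉ˡ trace proj₁ (w′ ◅◅ (last ◅ ε))
            u∉ m∈ with trace-◅◅⁻ proj₁ w′ m∈
            ... | inj₁ r = proj₁ (off′ r) u∈
            ... | inj₂ (here refl) = proj₁ (off′ (trace-target proj₁ w′)) u∈
            ... | inj₂ (there (here r)) = u≢v r

      closed-system : Breaking ⊎ Σ EarSystem λ S → ¬ Ear (keys (W S))
      closed-system = loop n initial (ℕ.m≤m+n n _)
        where
        bounded : ∀ S → length (W S) ≤ n
        bounded S = subst₂ _≤_ (L.length-map proj₁ (W S)) (L.length-tabulate id)
          (unique-⊆⇒length≤ (unique S) (λ _ → ∈-allFin _))
        loop : ∀ k S → n ≤ k + length (W S) → Breaking ⊎ Σ EarSystem λ S → ¬ Ear (keys (W S))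
        loop k S le with ear? (keys (W S))
        ... | no closed = inj₂ (S , closed)
        ... | yes ear with add-ear S ear
        ...   | inj₁ b = inj₁ b
        loop zero S le | yes ear | inj₂ (S′ , lt) = contradiction (bounded S′) (ℕ.<⇒≱ (ℕ.≤-trans (s≤s le) lt))
        loop (suc k) S le | yes ear | inj₂ (S′ , lt) = loop k S′ (ℕ.≤-trans le
          (ℕ.≤-trans (ℕ.≤-reflexive (sym (ℕ.+-suc k _))) (ℕ.+-monoʳ-≤ k lt)))

      -- The block spanned by an ear system without further ears

      module Closed (S : EarSystem) (closed : ¬ Ear (keys (W S))) where

        K : List (Fin n)
        K = keys (W S)

        in? : ∀ x → Dec (x ∈ˡ K)
        in? = key? (W S)

        hub∈K : ∀ b → br (hub b) ∈ˡ K
        hub∈K b = keys∈ (hub∈ S b)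

        K-avoids : ∀ {x} → x ∈ˡ K → x ∉ X
        K-avoids x∈ = avoids S (proj₂ (coloured {W S} x∈))

        colour : Fin n → Bool
        colour x with in? x
        ... | yes x∈ = proj₁ (coloured {W S} x∈)
        ... | no _ = false

        colour-W : ∀ {x} → x ∈ˡ K → (x , colour x) ∈ˡ W S
        colour-W {x} x∈ with in? x
        ... | yes x∈′ = proj₂ (coloured {W S} x∈′)
        ... | no x∉ = contradiction x∈ x∉

        Proper : Fin n → Fin n → Set
        Proper x y = x ∈ˡ K → y ∈ˡ K → Edge G x y → colour x ≢ colour y

        clash : ∀ {x y} → x ∈ˡ K → y ∈ˡ K → Edge G x y → colour x ≡ colour y → Breaking
        clash {x} {y} x∈ y∈ e eq = breaking S (link S (colour-W x∈) (colour-W y∈) x≢y) ((e , cong not (sym eq)) ◅ ε)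
          (unique-∷ (λ { (here r) → x≢y r ; (there ()) }) ([] ∷ []))
          (λ { (here r) → inj₁ r ; (there (here r)) → inj₂ (inj₁ r) })
          (λ { (here refl) → K-avoids x∈ ; (there (here refl)) → K-avoids y∈ })
          where
          x≢y : x ≢ y
          x≢y = outer-irrefl (e , K-avoids x∈ , K-avoids y∈)

        proper-or-breaking : (∀ x y → Proper x y) ⊎ Breaking
        proper-or-breaking = all-or-one λ x → all-or-one λ y →
          check (in? x) (in? y) (Graph.adj G x y 𝔹.≟ true) (colour x 𝔹.≟ colour y)
          where
          check : ∀ {x y} → Dec (x ∈ˡ K) → Dec (y ∈ˡ K) → Dec (Edge G x y) → Dec (colour x ≡ colour y) → Proper x y ⊎ Breaking
          check (no x∉) _ _ _ = inj₁ λ x∈ → contradiction x∈ x∉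
          check (yes _) (no y∉) _ _ = inj₁ λ _ y∈ → contradiction y∈ y∉
          check (yes _) (yes _) (no ¬e) _ = inj₁ λ _ _ e → contradiction e ¬e
          check (yes _) (yes _) (yes _) (no ne) = inj₁ λ _ _ _ → ne
          check (yes x∈) (yes y∈) (yes e) (yes eq) = inj₂ (clash x∈ y∈ e eq)

        off-walk : ∀ {T : Fin n → Fin n → Set} → (∀ {x y} → T x y → Outer x y) → ∀ {x y} (w : Star T x y) →
          (∀ {v} → v ∈ˡ trace id w → v ∉ˡ K) → Star (Off K) x y
        off-walk f w off = gmap-within id w λ p q e → f e , off p , off q

        -- The first excursion from `K` would be an ear, up to its return; its two ends are distinct
        -- because the walk is simple.
        stays-inside : ∀ {x y} (w : Star Outer x y) → Simple id w → x ∈ˡ K → y ∈ˡ K → ∀ {v} → v ∈ˡ trace id w → v ∈ˡ K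
        stays-inside ε _ x∈ _ (here refl) = x∈
        stays-inside (e ◅ w) u x∈ y∈ (here refl) = x∈
        stays-inside (_◅_ {j = z} e w) u@(_ ∷ u′) x∈ y∈ (there v∈) with in? z
        ... | yes z∈ = stays-inside w u′ z∈ y∈ v∈
        ... | no z∉ with firstHit in? w z∉ y∈
        ...   | hit pre last rest off z′∈ refl = contradiction
                (_ , _ , _ , _ , (x∈ , z′∈ , λ { refl → unique-head∉ u (trace-◅◅⁺ʳ id pre (there (trace-source id rest))) }) ,
                  (e , z∉ , last) , off-walk id pre off) closed

        -- From outside, a first walk reaches `K` at some `z`; with `z` deleted, a second one
        -- reaches it at another vertex. Together they contain an ear. Branch vertices and the
        -- vertices of a larger 2-connected subgraph are both caught in this way.
        captured : ∀ {x} → (∀ {w} → w ∈ˡ K → ∃ λ t → t ∈ˡ K × Star (OuterBut (w ∷ [])) x t) → x ∈ˡ K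
        captured {x} reach with in? x
        ... | yes x∈ = x∈
        -- For the first walk any vertex of `K` may be deleted; a hub is at hand.
        ... | no x∉ with reach (hub∈K true)
        ...   | t , t∈ , w with firstHit in? w x∉ t∈
        ...     | hit {z = z} pre last _ off z∈ _ with reach z∈
        ...       | t′ , t′∈ , w′ with firstHit in? w′ x∉ t′∈
        ...         | hit {z = z′} pre′ last′ _ off′ z′∈ _ = contradiction
                      (z , z′ , _ , _ , (z∈ , z′∈ , λ { refl → proj₂ (proj₂ last′) (here refl) }) ,
                        (outer-sym (proj₁ last) , off (trace-target id pre) , proj₁ last′) ,
                        (rev id (λ (e , p , q) → outer-sym e , q , p) id (off-walk proj₁ pre off) ◅◅ off-walk proj₁ pre′ off′))
                      closed

        InsideBut : List (Fin n) → Fin n → Fin n → Set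
        InsideBut C x y = OuterBut C x y × x ∈ˡ K × y ∈ˡ K

        insideBut-sym : ∀ {C x y} → InsideBut C x y → InsideBut C y x
        insideBut-sym (e , p , q) = outerBut-sym e , q , p

        module _ (C : List (Fin n)) (C-small : length C ≤ 1) where

          hubs-joined : br k₁ ∉ˡ C → br k₂ ∉ˡ C → Star (InsideBut C) (br k₁) (br k₂)
          hubs-joined p q with shortcut F._≟_ (joined C C-small k₁≢k₂ k₂∈K k₁∉X p k₂∉X q)
          ... | w , simp , _ = gmap-within id w λ x∈ y∈ e → e , within x∈ , within y∈
            where
            within : ∀ {v} → v ∈ˡ trace id w → v ∈ˡ K
            within v∈ = stays-inside (gmap id proj₁ w) (subst Unique (sym (trace-map id proj₁ w)) simp) (hub∈K true) (hub∈K false)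
              (subst (_ ∈ˡ_) (sym (trace-map id proj₁ w)) v∈)

          -- The walk to `p` is disjoint from the one to `q`, so it survives the deletion of `q`.
          linked-hub : ∀ {p q} → Link (W S) p q → (∀ {v} → v ∈ˡ C → v ∈ˡ K → v ≡ proj₁ q) →
            ∃ λ b → br (hub b) ∉ˡ C × Star (InsideBut C) (br (hub b)) (proj₁ p)
          linked-hub {p} {q} l only = b l , keep (trace-source id (walk₁ l)) , gmap-within proj₁ (walk₁ l) λ x∈ y∈ (e , _) →
              ((e , avoids S (in₁ l x∈) , avoids S (in₁ l y∈)) , keep x∈ , keep y∈) , keys∈ (in₁ l x∈) , keys∈ (in₁ l y∈)
            where
            keep : ∀ {x} → x ∈ˡ trace id (walk₁ l) → proj₁ x ∉ˡ C
            keep x∈ c∈ = proj₂ (proj₂ (unique-++⁻ (trace proj₁ (walk₁ l)) (simple l))) (keys-trace (walk₁ l) x∈)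
              (subst (_∈ˡ trace proj₁ (walk₂ l)) (sym (only c∈ (keys∈ (in₁ l x∈)))) (trace-target proj₁ (walk₂ l)))

          to-hub : ∀ {x} → x ∈ˡ K → x ∉ˡ C → ∃ λ b → br (hub b) ∉ˡ C × Star (InsideBut C) (br (hub b)) x
          to-hub {x} x∈ x∉ with Any.any? in? C
          ... | yes m∈ = case find m∈ of λ (v , v∈ , v∈K) →
                linked-hub (link S (colour-W x∈) (colour-W v∈K) (λ { refl → x∉ v∈ })) (λ c∈ _ → single C-small c∈ v∈)
            where
            single : ∀ {C : List (Fin n)} {x y} → length C ≤ 1 → x ∈ˡ C → y ∈ˡ C → x ≡ y
            single le (here refl) (here refl) = refl
            single (s≤s ()) (here refl) (there (here _))
            single (s≤s ()) (here refl) (there (there _))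
            single (s≤s ()) (there (here _)) _
            single (s≤s ()) (there (there _)) _
          ... | no none with other-hub x
          ...   | b , ne = linked-hub (link S (colour-W x∈) (hub∈ S b) (λ e → ne (sym e))) (λ c∈ k∈ → contradiction (lose c∈ k∈) none)

          -- Empty `C` gives the connectedness of the block, a singleton `C` the absence of a cut
          -- vertex.
          inside-connected : ∀ {x y} → x ∈ˡ K → x ∉ˡ C → y ∈ˡ K → y ∉ˡ C → Star (InsideBut C) x y
          inside-connected x∈ x∉ y∈ y∉ with to-hub x∈ x∉ | to-hub y∈ y∉
          ... | b , h∉ , w | b′ , h∉′ , w′ = rev id insideBut-sym id w ◅◅ (hubs b b′ h∉ h∉′ ◅◅ w′)
            where
            hubs : ∀ b b′ → br (hub b) ∉ˡ C → br (hub b′) ∉ˡ C → Star (InsideBut C) (br (hub b)) (br (hub b′))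
            hubs true true _ _ = ε
            hubs false false _ _ = ε
            hubs true false p q = hubs-joined p q
            hubs false true p q = rev id insideBut-sym id (hubs-joined q p)

        branch∈K : ∀ i → br i ∉ X → br i ∈ˡ K
        branch∈K i i∉X with in? (br i)
        ... | yes i∈ = i∈
        ... | no i∉ = captured λ {w} w∈ → case other-hub w of λ (b , ne) → br (hub b) , hub∈K b ,
              joined (w ∷ []) ℕ.≤-refl (λ { refl → i∉ (hub∈K b) }) (hub-clique b) i∉X
                (λ { (here refl) → i∉ w∈ }) (hub∉X b) (λ { (here e) → ne e })

        U : Subset n
        U = subsetOf in?

        FU : Fin n → Fin n → Set
        FU x y = Edge G x y × x ∈ U × y ∈ U

        U⁺ : ∀ {x} → x ∈ˡ K → x ∈ U
        U⁺ = ∈-subsetOf⁺ in?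

        U⁻ : ∀ {x} → x ∈ U → x ∈ˡ K
        U⁻ = ∈-subsetOf⁻ in?

        isBlock : IsBlock G (λ x → x ∉ X) (mkSub U FU)
        isBlock =
          ((λ x x∈ → K-avoids (U⁻ x∈)) , (λ x y e → e) , λ x y (e , p , q) → edge-sym e , q , p) ,
          (λ x y x∈ y∈ → walk⇒path (mkSub U FU) x∈
            (gmap id (λ (((e , _) , _) , p , q) → (e , U⁺ p , U⁺ q) , U⁺ q) (inside-connected [] z≤n (U⁻ x∈) (λ ()) (U⁻ y∈) (λ ())))) ,
          (λ v _ x y (x∈ , x≢) (y∈ , y≢) → walk⇒path (Delete (mkSub U FU) v) (x∈ , x≢)
            (gmap id (λ (((e , _) , p∉ , q∉) , p , q) → ((e , U⁺ p , U⁺ q) , (λ r → p∉ (here r)) , λ r → q∉ (here r)) , U⁺ q , λ r → q∉ (here r))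
              (inside-connected (v ∷ []) ℕ.≤-refl (U⁻ x∈) (λ { (here r) → x≢ r }) (U⁻ y∈) (λ { (here r) → y≢ r })))) ,
          maximal
          where
          maximal : ∀ H′ → IsSubgraphOf G (λ x → x ∉ X) H′ → Connected H′ → NoCutVertex H′ → mkSub U FU ⊑ H′ → H′ ⊑ mkSub U FU
          maximal H′ (V⊆ , E⊆ , _) conn nocut (U⊆ , _) = vertex , λ x y e →
              case E⊆ x y e of λ (g , p , q) → g , vertex x p , vertex y q
            where
            vertex : ∀ x → V H′ x → x ∈ U
            vertex x x∈ with in? x
            ... | yes p = U⁺ p
            -- Since `w` does not separate `H′`, the vertex `x` reaches a hub different from `w`
            -- without passing through `w`.
            ... | no x∉ = U⁺ (captured λ {w} w∈ → case other-hub w of λ (b , ne) → br (hub b) , hub∈K b ,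
                  gmap id (λ { ((e , a≢ , b≢) , (a∈ , _) , (b∈ , _)) →
                      (proj₁ (E⊆ _ _ e) , V⊆ _ a∈ , V⊆ _ b∈) , (λ { (here r) → a≢ r }) , λ { (here r) → b≢ r } })
                    (path⇒walk (Delete H′ w) (nocut w (U⊆ w (U⁺ w∈)) x (br (hub b))
                      (x∈ , λ { refl → x∉ w∈ }) (U⊆ _ (U⁺ (hub∈K b)) , ne))))

        bipartite : (∀ x y → Proper x y) → Bipartite (mkSub U FU)
        bipartite proper = colour , λ x y (e , p , q) → proper x y (U⁻ p) (U⁻ q) e

        -- A subdivided edge between equally coloured branch vertices has an inner vertex; unless X meets it,
        -- all of it lies in the block.
        extra : ∀ {i j} → Adj i j → br i ∉ X → br j ∉ X → col (br i) ≢ col (br j) ⊎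
          (∃ λ q → (∀ k → q ≢ br k) × (q ∈ X ⊎ q ∈ˡ K))
        extra {i} {j} a i∉ j∉ with Q a
        ... | w , simp with Any.any? (_∈? X) (trace id w)
        ...   | yes x∈ = case find x∈ of λ (v , v∈ , v∈X) → case walk-onQ w (inj₁ refl) v∈ of λ where
                (inj₁ refl) → contradiction v∈X i∉
                (inj₂ (inj₁ refl)) → contradiction v∈X j∉
                (inj₂ (inj₂ p)) → inj₂ (v , inner≢br a p , inj₁ v∈X)
        ...   | no none = second w refl λ v∈ → stays-inside (gmap id proj₁ w′) (subst Unique (sym same) simp) (branch∈K i i∉) (branch∈K j j∉)
                  (subst (_ ∈ˡ_) (sym same) v∈)
          where
          w′ : Star (λ x y → Outer x y × ⊤) (br i) (br j)
          w′ = gmap-within id w λ x∈ y∈ ((e , _) , _) → (e , (λ p → none (lose x∈ p)) , λ p → none (lose y∈ p)) , tt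
          trace-within : ∀ {R T : Fin n → Fin n → Set} {x y} (w : Star R x y)
            (f : ∀ {a b} → a ∈ˡ trace id w → b ∈ˡ trace id w → R a b → T a b) → trace id (gmap-within {T = T} id w f) ≡ trace id w
          trace-within ε f = refl
          trace-within (e ◅ w) f = cong (_ ∷_) (trace-within w (λ p q → f (there p) (there q)))
          same : trace id (gmap id proj₁ w′) ≡ trace id w
          same = trans (trace-map id proj₁ w′) (trace-within w _)
          second : ∀ {x} (w : Star (QStep i j) x (br j)) → x ≡ br i → (∀ {v} → v ∈ˡ trace id w → v ∈ˡ K) →
            col (br i) ≢ col (br j) ⊎ (∃ λ q → (∀ k → q ≢ br k) × (q ∈ X ⊎ q ∈ˡ K))
          second ε e _ = contradiction (br-inj _ _ (sym e)) (proj₁ a)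
          second (((_ , ne) , _ , inj₁ p) ◅ w) e sub = contradiction (cong col (trans e (sym p))) ne
          second (((_ , ne) , _ , inj₂ (inj₁ refl)) ◅ w) refl sub = inj₁ ne
          second (((_ , ne) , _ , inj₂ (inj₂ p)) ◅ w) e sub = inj₂ (_ , inner≢br a p , inj₂ (sub (there (trace-source id w))))

        -- All branch vertices and `q` lie in the block or in `X`. So `q` helps in `X` too: it uses
        -- up one of the deletions without costing a branch vertex.
        size-bound : (∃ λ q → (∀ k → q ≢ br k) × (q ∈ X ⊎ q ∈ˡ K)) → suc m ≤ ∣ U ∣ + ∣ X ∣
        size-bound (q , q≢ , q∈) = subst₂ _≤_ (cong suc (trans (L.length-map br (allFin m)) (L.length-tabulate id)))
          (trans (L.length-++ (elements U)) (cong₂ _+_ (length-elements U) (length-elements X)))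
          (unique-⊆⇒length≤ (unique-∷ (λ p → case ∈-map⁻ br p of λ (k , _ , e) → q≢ k e)
              (Uniq.map⁺ (br-inj _ _) (Uniq.allFin⁺ m))) sub)
          where
          place : ∀ {x} → x ∈ X ⊎ x ∈ˡ K → x ∈ˡ elements U ++ elements X
          place (inj₁ p) = ∈-++⁺ʳ (elements U) (∈-elements⁺ p)
          place (inj₂ p) = ∈-++⁺ˡ (∈-elements⁺ (U⁺ p))
          sub : ∀ {x} → x ∈ˡ q ∷ map br (allFin m) → x ∈ˡ elements U ++ elements X
          sub (here refl) = place q∈
          sub (there p) with ∈-map⁻ br p
          ... | k , _ , refl with br k ∈? X
          ...   | yes k∈ = place (inj₁ k∈)
          ...   | no k∉ = place (inj₂ (branch∈K k k∉))

        -- As `k₁` and `k₂` are clique vertices, all three pairs are joined by subdivided edges,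
        -- wherever `k₃` lies; and two colours cannot differ pairwise on three vertices.
        large : ∀ {k₃} → k₃ ≢ k₁ → k₃ ≢ k₂ → br k₃ ∉ X → suc m ≤ ∣ U ∣ + ∣ X ∣
        large {k₃} ne₁ ne₂ k₃∉X with extra (k₁≢k₂ , inj₁ k₁∈K) k₁∉X k₂∉X
             | extra {k₁} {k₃} ((λ e → ne₁ (sym e)) , inj₁ k₁∈K) k₁∉X k₃∉X | extra {k₂} {k₃} ((λ e → ne₂ (sym e)) , inj₁ k₂∈K) k₂∉X k₃∉X
        ... | inj₁ n₁₂ | inj₁ n₁₃ | inj₁ n₂₃ = contradiction (trans (¬-not n₁₂) (sym (¬-not (λ e → n₂₃ (sym e))))) n₁₃
        ... | inj₂ q | _ | _ = size-bound q
        ... | inj₁ _ | inj₂ q | _ = size-bound q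
        ... | inj₁ _ | inj₁ _ | inj₂ q = size-bound q

    Conclusion : ℕ → Set₁
    Conclusion t = Σ (Subset n) λ U → Σ (Fin n → Fin n → Set) λ F →
      IsBlock G (λ x → x ∉ X) (mkSub U F) × Bipartite (mkSub U F) × t + 3 ≤ ∣ U ∣

    private
      available : List (Fin m)
      available = filter (λ k → clique? k ×-dec ¬? (br k ∈? X)) (allFin m)

      available⁻ : ∀ {k} → k ∈ˡ available → Clique k × br k ∉ X
      available⁻ k∈ = proj₂ (∈-filter⁻ (λ k → clique? k ×-dec ¬? (br k ∈? X)) {xs = allFin m} k∈)

      available-many : 2 ≤ length available
      available-many = ℕ.+-cancelˡ-≤ ∣ X ∣ _ _ (ℕ.≤-trans small (subst₂ _≤_
          (trans (L.length-map _ (allFin s)) (L.length-tabulate id))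
          (trans (L.length-++ (elements X)) (cong₂ _+_ (length-elements X) (L.length-map br available)))
          (unique-⊆⇒length≤ {xs = map (λ k → br (k ↑ˡ r)) (allFin s)}
            (Uniq.map⁺ (λ e → F.↑ˡ-injective r _ _ (br-inj _ _ e)) (Uniq.allFin⁺ s)) sub)))
        where
        sub : ∀ {x} → x ∈ˡ map (λ k → br (k ↑ˡ r)) (allFin s) → x ∈ˡ elements X ++ map br available
        sub x∈ with ∈-map⁻ (λ k → br (k ↑ˡ r)) x∈
        ... | k , _ , refl with br (k ↑ˡ r) ∈? X
        ...   | yes p = ∈-++⁺ˡ (∈-elements⁺ p)
        ...   | no ¬p = ∈-++⁺ʳ (elements X) (∈-map⁺ br (∈-filter⁺ _ (∈-allFin _) (subst (_< s) (sym (F.toℕ-↑ˡ k r)) (F.toℕ<n k) , ¬p)))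

      third : ∀ k₁ k₂ → 1 ≤ r → ∃ λ k₃ → k₃ ≢ k₁ × k₃ ≢ k₂ × br k₃ ∉ X
      third k₁ k₂ 1≤r with F.any? (λ k → ¬? (k F.≟ k₁) ×-dec (¬? (k F.≟ k₂) ×-dec ¬? (br k ∈? X)))
      ... | yes p = p
      ... | no none = contradiction (subst₂ _≤_ (trans (L.length-map br (allFin m)) (L.length-tabulate id))
              (cong (λ a → 2 + a) (length-elements X))
              (unique-⊆⇒length≤ (Uniq.map⁺ (br-inj _ _) (Uniq.allFin⁺ m)) sub))
            (ℕ.<⇒≱ (ℕ.≤-trans (ℕ.≤-reflexive (trans (ℕ.+-comm 1 _) (cong (_+ 1) (ℕ.+-comm 2 ∣ X ∣)))) (ℕ.+-mono-≤ small 1≤r)))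
        where
        sub : ∀ {x} → x ∈ˡ map br (allFin m) → x ∈ˡ br k₁ ∷ br k₂ ∷ elements X
        sub x∈ with ∈-map⁻ br x∈
        ... | k , _ , refl with k F.≟ k₁ | k F.≟ k₂ | br k ∈? X
        ...   | yes refl | _ | _ = here refl
        ...   | no _ | yes refl | _ = there (here refl)
        ...   | no _ | no _ | yes p = there (there (∈-elements⁺ p))
        ...   | no p | no q | no t = contradiction (k , p , q , t) none

    block-or-breaking : ∀ t → r ≡ t → 1 ≤ t → Conclusion t ⊎ Breaking
    block-or-breaking t refl 1≤t with available | available⁻ | available-many | Uniq.filter⁺ (λ k → clique? k ×-dec ¬? (br k ∈? X)) (Uniq.allFin⁺ m)
    ... | [] | _ | () | _
    ... | _ ∷ [] | _ | s≤s () | _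
    ... | k₁ ∷ k₂ ∷ _ | ok | _ | (k₁≢k₂ ∷ _) ∷ _ = result
      where
      hubs : Hubs
      hubs = record
        { k₁≢k₂ = k₁≢k₂
        ; k₁∈K = proj₁ (ok (here refl)) ; k₂∈K = proj₁ (ok (there (here refl)))
        ; k₁∉X = proj₂ (ok (here refl)) ; k₂∉X = proj₂ (ok (there (here refl))) }
      open Ears hubs
      result : Conclusion r ⊎ Breaking
      result with closed-system
      ... | inj₁ b = inj₂ b
      ... | inj₂ (S , closed) with Closed.proper-or-breaking S closed
      ...   | inj₂ b = inj₂ b
      ...   | inj₁ proper = inj₁ (U , FU , isBlock , bipartite proper ,
                (case third k₁ k₂ 1≤t of λ (k₃ , ne₁ , ne₂ , k₃∉) → arith (large ne₁ ne₂ k₃∉)))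
        where
        open Closed S closed
        arith : suc m ≤ ∣ U ∣ + ∣ X ∣ → r + 3 ≤ ∣ U ∣
        -- The 3 consists of the 2 by which `s` exceeds the bound on `X` and the one vertex beyond
        -- the branch vertices.
        arith le = ℕ.+-cancelˡ-≤ ∣ X ∣ _ _ (ℕ.≤-trans (ℕ.≤-reflexive
            (trans (cong (∣ X ∣ +_) (ℕ.+-comm r 3)) (trans (sym (ℕ.+-assoc ∣ X ∣ 3 r))
              (cong (_+ r) (trans (ℕ.+-suc ∣ X ∣ 2) refl)))))
          (ℕ.≤-trans (s≤s (ℕ.+-monoˡ-≤ r small)) (ℕ.≤-trans le (ℕ.≤-reflexive (ℕ.+-comm ∣ U ∣ ∣ X ∣)))))

  -- The hitting set

  bit : Bool → Fin 2
  bit false = zero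
  bit true = suc zero

  unbit : Fin 2 → Bool
  unbit zero = false
  unbit (suc zero) = true

  finiteColoured : Finite Coloured
  finiteColoured = record
    { size = n * 2
    ; idx = λ (v , b) → combine v (bit b)
    ; at = λ i → proj₁ (remQuot {n} 2 i) , unbit (proj₂ (remQuot {n} 2 i))
    ; at-idx = λ { (v , false) → cong (map₂ unbit) (F.remQuot-combine v zero)
                 ; (v , true) → cong (map₂ unbit) (F.remQuot-combine v (suc zero)) }
    ; idx-at = λ i → trans (cong (combine (proj₁ (remQuot {n} 2 i))) (bit-unbit (proj₂ (remQuot {n} 2 i)))) (F.combine-remQuot {n} 2 i) }
    where
    bit-unbit : ∀ i → bit (unbit i) ≡ i
    bit-unbit zero = refl
    bit-unbit (suc zero) = refl

  open Finite finiteColoured using (univ; univ-complete; univ-unique) renaming (_≟_ to _≟ᶜ_; any? to anyᶜ?)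

  IsBr : Fin n → Set
  IsBr v = ∃ λ k → br k ≡ v

  isBr? : ∀ v → Dec (IsBr v)
  isBr? v = F.any? λ k → br k F.≟ v

  Active : Coloured → Set
  Active (v , b) = ¬ IsBr v ⊎ b ≡ col v

  active? : ∀ p → Dec (Active p)
  active? (v , b) = ¬? (isBr? v) ⊎-dec (b 𝔹.≟ col v)

  -- The auxiliary graph: two copies of G, each branch vertex being kept only in the copy of its own colour, with
  -- the two copies of every other vertex joined by a rung.
  data HEdge : Coloured → Coloured → Set where
    copy : ∀ {v w b} → Edge G v w → Active (v , b) → Active (w , b) → HEdge (v , b) (w , b)
    rung : ∀ {v b} → ¬ IsBr v → HEdge (v , b) (v , not b)

  hEdge-sym : ∀ {p q} → HEdge p q → HEdge q p
  hEdge-sym (copy e a a′) = copy (edge-sym e) a′ a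
  hEdge-sym (rung {v} {b} ¬s) = subst (λ c → HEdge (v , not b) (v , c)) (not-involutive b) (rung ¬s)

  hEdge? : ∀ p q → Dec (HEdge p q)
  hEdge? (v , b) (w , c) = map′ to from
    (((b 𝔹.≟ c) ×-dec ((Graph.adj G v w 𝔹.≟ true) ×-dec (active? (v , b) ×-dec active? (w , c)))) ⊎-dec
     ((v F.≟ w) ×-dec ((c 𝔹.≟ not b) ×-dec ¬? (isBr? v))))
    where
    to : _ → HEdge (v , b) (w , c)
    to (inj₁ (refl , e , a , a′)) = copy e a a′
    to (inj₂ (refl , refl , ¬s)) = rung ¬s
    from : HEdge (v , b) (w , c) → _
    from (copy e a a′) = inj₁ (refl , e , a , a′)
    from (rung ¬s) = inj₂ (refl , refl , ¬s)

  hAdj : Coloured → Coloured → Bool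
  hAdj p q = does (hEdge? p q)

  module Aux = Matching finiteColoured hAdj (λ p q → does-cong hEdge-sym hEdge-sym (hEdge? p q) (hEdge? q p))
  open Aux using (Barrier; barrier; IsMatching; deficiency; unmatched⁻; unmatched-unique)

  -- This is the matching of all rungs. Its fixed points are both copies of each branch vertex,
  -- including the inactive copy, which is isolated; its deficiency 2 (`s` + `r`) is the value with
  -- which other deficiencies are compared.
  partner : Coloured → Coloured
  partner (v , b) with isBr? v
  ... | yes _ = v , b
  ... | no _ = v , not b

  partner-br : ∀ {v b} → IsBr v → partner (v , b) ≡ (v , b)
  partner-br {v} s with isBr? v
  ... | yes _ = refl
  ... | no ¬s = contradiction s ¬s

  partner-¬br : ∀ {v b} → ¬ IsBr v → partner (v , b) ≡ (v , not b)
  partner-¬br {v} ¬s with isBr? v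
  ... | yes s = contradiction s ¬s
  ... | no _ = refl

  flip-≢ : ∀ {p} → flip p ≢ p
  flip-≢ {v , false} ()
  flip-≢ {v , true} ()

  flip-involutive : ∀ p → flip (flip p) ≡ p
  flip-involutive (v , b) = cong (v ,_) (not-involutive b)

  partner-involutive : ∀ p → partner (partner p) ≡ p
  partner-involutive (v , b) with isBr? v
  ... | yes s = partner-br s
  ... | no ¬s = trans (partner-¬br ¬s) (flip-involutive (v , b))

  partner-fixed : ∀ {v b} → partner (v , b) ≡ (v , b) → IsBr v
  partner-fixed {v} {b} e with isBr? v
  ... | yes s = s
  ... | no _ = contradiction e flip-≢

  module Hitting (B : Barrier) where
    open Barrier B renaming (m to μ)

    infix 4 _∈Z?
    _∈Z? : ∀ p → Dec (p ∈ˡ Z)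
    p ∈Z? = Any.any? (p ≟ᶜ_) Z

    -- Apart from `Z`, these are the vertices that the rungs fail to match once `Z` is deleted.
    Unpaired : Coloured → Set
    Unpaired p = partner p ≡ p ⊎ partner p ∈ˡ Z

    unpaired? : ∀ p → Dec (Unpaired p)
    unpaired? p = (partner p ≟ᶜ p) ⊎-dec (partner p ∈Z?)

    adjacent : ∀ {p q} → p ∉ˡ Z → q ∉ˡ Z → HEdge p q → p ~ q
    adjacent {p} {q} p∉ q∉ e = ~-adjacent p∉ q∉ (dec-true (hEdge? p q) e)

    partner-~ : ∀ {p} → p ∉ˡ Z → ¬ Unpaired p → p ~ partner p
    partner-~ {v , b} p∉ ¬u = go (isBr? v)
      where
      go : Dec (IsBr v) → (v , b) ~ partner (v , b)
      go (yes s) = contradiction (inj₁ (partner-br s)) ¬u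
      go (no ¬s) = subst ((v , b) ~_) (sym (partner-¬br ¬s))
        (adjacent p∉ (λ z → ¬u (inj₂ (subst (_∈ˡ Z) (sym (partner-¬br ¬s)) z))) (rung ¬s))

    Rep : Coloured → Coloured → Set
    Rep u d = d ∉ˡ Z × Unpaired d × u ~ d

    -- Otherwise the class of u would be perfectly matched by partner, and all but u would be matched by m.
    has-rep : ∀ {u} → μ u ≡ u → u ∉ˡ Z → ∃ (Rep u)
    has-rep {u} mu u∉ with anyᶜ? (λ d → ¬? (d ∈Z?) ×-dec (unpaired? d ×-dec (u ~? d)))
    ... | yes d = d
    ... | no none = contradiction (trans (sym (trans m-count (cong (_+ (b + b)) one))) (trans partner-count (cong (_+ (a + a)) nil))) (even≢odd b a)
      where
      class : List Coloured
      class = filter (λ w → ¬? (w ∈Z?) ×-dec (u ~? w)) univ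
      class⁻ : ∀ {w} → w ∈ˡ class → w ∉ˡ Z × u ~ w
      class⁻ w∈ = proj₂ (∈-filter⁻ (λ w → ¬? (w ∈Z?) ×-dec (u ~? w)) {xs = univ} w∈)
      class⁺ : ∀ {w} → w ∉ˡ Z → u ~ w → w ∈ˡ class
      class⁺ {w} w∉ r = ∈-filter⁺ (λ w → ¬? (w ∈Z?) ×-dec (u ~? w)) (univ-complete w) (w∉ , r)
      class-unique : Unique class
      class-unique = Uniq.filter⁺ _ univ-unique
      paired : ∀ {w} → w ∈ˡ class → ¬ Unpaired w
      paired w∈ un = none (_ , proj₁ (class⁻ w∈) , un , proj₂ (class⁻ w∈))
      partner-closed : ∀ {w} → w ∈ˡ class → partner w ∈ˡ class
      partner-closed w∈ = class⁺ (λ z → paired w∈ (inj₂ z))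
        (~-trans (proj₁ (class⁻ w∈)) (proj₂ (class⁻ w∈)) (partner-~ (proj₁ (class⁻ w∈)) (paired w∈)))
      m-closed : ∀ {w} → w ∈ˡ class → μ w ∈ˡ class
      m-closed {w} w∈ with μ w ≟ᶜ w
      ... | yes e = subst (_∈ˡ class) (sym e) w∈
      ... | no ne = class⁺ mw∉ (~-trans (proj₁ (class⁻ w∈)) (proj₂ (class⁻ w∈))
              (~-adjacent (proj₁ (class⁻ w∈)) mw∉ (proj₁ (proj₂ m-matching w ne))))
        where
        mw∉ : μ w ∉ˡ Z
        mw∉ = proj₂ (proj₂ m-matching (μ w) (λ e → ne (trans (sym e) (proj₁ m-matching w))))
      a b : ℕ
      a = length (raised finiteColoured partner class)
      b = length (raised finiteColoured μ class)
      partner-count : length class ≡ length (fixed finiteColoured partner class) + (a + a)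
      partner-count = involution-count finiteColoured partner partner-involutive class-unique partner-closed
      m-count : length class ≡ length (fixed finiteColoured μ class) + (b + b)
      m-count = involution-count finiteColoured μ (proj₁ m-matching) class-unique m-closed
      nil : length (fixed finiteColoured partner class) ≡ 0
      nil = ℕ.n≤0⇒n≡0 (unique-⊆⇒length≤ {ys = []} (Uniq.filter⁺ _ class-unique) λ w∈ →
        case ∈-filter⁻ (λ w → partner w ≟ᶜ w) {xs = class} w∈ of λ (w∈ , e) → contradiction (inj₁ e) (paired w∈))
      one : length (fixed finiteColoured μ class) ≡ 1
      one = unique-≈⇒length≡ {ys = u ∷ []} (Uniq.filter⁺ _ class-unique) ([] ∷ [])
        (λ w∈ → case ∈-filter⁻ (λ w → μ w ≟ᶜ w) {xs = class} w∈ of λ (w∈ , e) →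
          here (sym (~-unmatched mu e (proj₂ (class⁻ w∈)))))
        (λ { (here refl) → ∈-filter⁺ (λ w → μ w ≟ᶜ w) (class⁺ u∉ ~-refl) mu })

    exposed : List Coloured
    exposed = filter (λ u → (μ u ≟ᶜ u) ×-dec ¬? (u ∈Z?)) univ

    exposed⁻ : ∀ {u} → u ∈ˡ exposed → μ u ≡ u × u ∉ˡ Z
    exposed⁻ u∈ = proj₂ (∈-filter⁻ (λ u → (μ u ≟ᶜ u) ×-dec ¬? (u ∈Z?)) {xs = univ} u∈)

    rep : Coloured → Coloured
    rep u with μ u ≟ᶜ u | u ∈Z?
    ... | yes e | no u∉ = proj₁ (has-rep e u∉)
    ... | _ | _ = u

    rep-spec : ∀ {u} → u ∈ˡ exposed → Rep u (rep u)
    rep-spec {u} u∈ with μ u ≟ᶜ u | u ∈Z?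
    ... | yes e | no u∉ = proj₂ (has-rep e u∉)
    ... | no ne | _ = contradiction (proj₁ (exposed⁻ u∈)) ne
    ... | yes _ | yes z = contradiction z (proj₂ (exposed⁻ u∈))

    reps : List Coloured
    reps = map rep exposed

    reps⁻ : ∀ {d} → d ∈ˡ reps → ∃ λ u → u ∈ˡ exposed × Rep u d
    reps⁻ d∈ = case ∈-map⁻ rep d∈ of λ { (u , u∈ , refl) → u , u∈ , rep-spec u∈ }

    rep-injective : ∀ {u u′ d d′} → u ∈ˡ exposed → u′ ∈ˡ exposed → Rep u d → Rep u′ d′ → d ~ d′ → u ≡ u′
    rep-injective u∈ u′∈ (d∉ , _ , ud) (d′∉ , _ , ud′) dd′ =
      ~-unmatched (proj₁ (exposed⁻ u∈)) (proj₁ (exposed⁻ u′∈)) (~-trans d∉ ud (~-trans d′∉ dd′ (~-sym ud′)))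

    reps-distinct : ∀ {d d′} → d ∈ˡ reps → d′ ∈ˡ reps → d ~ d′ → d ≡ d′
    reps-distinct d∈ d′∈ dd′ with ∈-map⁻ rep d∈ | ∈-map⁻ rep d′∈
    ... | u , u∈ , refl | u′ , u′∈ , refl = cong rep (rep-injective u∈ u′∈ (rep-spec u∈) (rep-spec u′∈) dd′)

    reps-unique : Unique reps
    reps-unique = unique-map rep (Uniq.filter⁺ _ univ-unique)
      (λ x∈ y∈ e → rep-injective x∈ y∈ (rep-spec x∈) (rep-spec y∈) (subst (rep _ ~_) e ~-refl))

    -- Each class with a vertex exposed by `μ` keeps one unpaired representative; the vertices of
    -- all other unpaired copies are deleted. What remains unpaired outside `X` is then pairwise
    -- inequivalent.
    surplus : List Coloured
    surplus = filter (λ d → unpaired? d ×-dec ¬? (Any.any? (d ≟ᶜ_) reps)) univ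

    surplus⁻ : ∀ {d} → d ∈ˡ surplus → Unpaired d × d ∉ˡ reps
    surplus⁻ d∈ = proj₂ (∈-filter⁻ (λ d → unpaired? d ×-dec ¬? (Any.any? (d ≟ᶜ_) reps)) {xs = univ} d∈)

    hits? : ∀ v → Dec (v ∈ˡ map proj₁ surplus)
    hits? v = Any.any? (v F.≟_) (map proj₁ surplus)

    X : Subset n
    X = subsetOf hits?

    unpaired-rep : ∀ {v b} → v ∉ X → Unpaired (v , b) → (v , b) ∈ˡ reps
    unpaired-rep {v} {b} v∉ un with Any.any? ((v , b) ≟ᶜ_) reps
    ... | yes p = p
    ... | no ¬p = contradiction (∈-subsetOf⁺ hits? (∈-map⁺ proj₁
            (∈-filter⁺ (λ d → unpaired? d ×-dec ¬? (Any.any? (d ≟ᶜ_) reps)) (univ-complete (v , b)) (un , ¬p)))) v∉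

    -- There are at most 2 (`s` + `r`) unpaired copies plus one for each element of `Z`, and the
    -- representatives number at least the deficiency of `m₀` plus the length of `Z`. The
    -- contribution of `Z` cancels.
    X-small : ∣ X ∣ + deficiency m₀ ≤ (s + r) + (s + r)
    X-small = ℕ.+-cancelʳ-≤ (length Z) _ _ (ℕ.≤-trans (ℕ.≤-reflexive (ℕ.+-assoc ∣ X ∣ _ _))
        (ℕ.≤-trans (ℕ.+-mono-≤ X≤ gap) (ℕ.≤-trans surplus+reps unpaired≤)))
      where
      X≤ : ∣ X ∣ ≤ length surplus
      X≤ = subst₂ _≤_ (length-elements X) (L.length-map proj₁ surplus)
        (unique-⊆⇒length≤ (elements-unique X) (λ x∈ → ∈-subsetOf⁻ hits? (∈-elements⁻ x∈)))
      gap : deficiency m₀ + length Z ≤ length exposed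
      gap = ℕ.+-cancelʳ-≤ (length Z) _ _ (ℕ.≤-trans (ℕ.≤-reflexive (ℕ.+-assoc (deficiency m₀) _ _))
        (ℕ.≤-trans deficiency-gap (subst (deficiency μ ≤_) (L.length-++ exposed)
          (unique-⊆⇒length≤ (unmatched-unique μ) λ {x} x∈ → case x ∈Z? of λ where
            (yes z) → ∈-++⁺ʳ exposed z
            (no z∉) → ∈-++⁺ˡ (∈-filter⁺ _ (univ-complete x) (unmatched⁻ {μ} x∈ , z∉))))))
      all-unpaired : List Coloured
      all-unpaired = filter unpaired? univ
      surplus+reps : length surplus + length exposed ≤ length all-unpaired
      surplus+reps = subst (_≤ length all-unpaired) (trans (L.length-++ surplus) (cong (length surplus +_) (L.length-map rep exposed)))
        (unique-⊆⇒length≤ (unique-++ (Uniq.filter⁺ _ univ-unique) reps-unique (λ p → proj₂ (surplus⁻ p)))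
          λ p → [ (λ q → ∈-filter⁺ unpaired? (univ-complete _) (proj₁ (surplus⁻ q))) ,
                  (λ q → ∈-filter⁺ unpaired? (univ-complete _) (proj₁ (proj₂ (proj₂ (proj₂ (reps⁻ q)))))) ]′ (∈-++⁻ surplus p))
      brs : Bool → List Coloured
      brs b = map (λ k → br k , b) (allFin (s + r))
      length-brs : ∀ b → length (brs b) ≡ s + r
      length-brs b = trans (L.length-map (λ k → br k , b) (allFin (s + r))) (L.length-tabulate id)
      unpaired≤ : length all-unpaired ≤ (s + r) + (s + r) + length Z
      unpaired≤ = subst (length all-unpaired ≤_)
        (trans (L.length-++ (brs true ++ brs false)) (cong₂ _+_ (trans (L.length-++ (brs true))
            (cong₂ _+_ (length-brs true) (length-brs false)))
          (L.length-map partner Z)))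
        (unique-⊆⇒length≤ (Uniq.filter⁺ _ univ-unique) λ {x} x∈ → cover x (proj₂ (∈-filter⁻ unpaired? {xs = univ} x∈)))
        where
        cover : ∀ x → Unpaired x → x ∈ˡ (brs true ++ brs false) ++ map partner Z
        cover x (inj₂ z) = ∈-++⁺ʳ (brs true ++ brs false) (subst (_∈ˡ map partner Z) (partner-involutive x) (∈-map⁺ partner z))
        cover (v , b) (inj₁ e) with partner-fixed {v} {b} e
        cover (v , true) (inj₁ _) | k , refl = ∈-++⁺ˡ (∈-++⁺ˡ (∈-map⁺ _ (∈-allFin k)))
        cover (v , false) (inj₁ _) | k , refl = ∈-++⁺ˡ (∈-++⁺ʳ (brs true) (∈-map⁺ _ (∈-allFin k)))

    rep∉Z : ∀ {d} → d ∈ˡ reps → d ∉ˡ Z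
    rep∉Z d∈ = proj₁ (proj₂ (proj₂ (reps⁻ d∈)))

    -- Along the walk, the current vertex stays equivalent to a representative whose vertex has already been visited.
    no-breaking-from : ∀ {p j} (w : Star AStep p (flip (own (br j)))) → Simple proj₁ w →
      (∀ {v} → v ∈ˡ trace proj₁ w → v ∉ X) → Active p → p ∉ˡ Z → ∀ {d} → d ∈ˡ reps → d ~ p →
      (∀ {v} → v ∈ˡ trace proj₁ w → v ≡ proj₁ d → v ≡ proj₁ p) → ⊥
    -- A breaking path ends in the copy of a branch vertex that has the wrong colour, and this copy
    -- is not active.
    no-breaking-from {j = j} ε _ _ act _ _ _ _ with act
    ... | inj₁ ¬s = ¬s (j , refl)
    ... | inj₂ e = not-¬ refl (sym e)
    no-breaking-from {v , b} (_◅_ {j = x , _} (e , refl) w) u@(_ ∷ u′) out act p∉ {d} d∈ d~p old = go (isBr? x)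
      where
      x∉X : x ∉ X
      x∉X = out (there (trace-source proj₁ w))
      new : ¬ (x ≡ proj₁ d)
      new e = unique-head∉ u (subst (_∈ˡ trace proj₁ w) (old (there (trace-source proj₁ w)) e) (trace-source proj₁ w))
      -- Outside `X` an unpaired copy is a representative. Equivalent to `d`, it would be `d`
      -- itself, although `x` has not been visited before.
      clash : Active (x , b) → Unpaired (x , b) → ⊥
      clash act′ un = new (cong proj₁ (sym (reps-distinct d∈ rep∈ (~-trans p∉ d~p (adjacent p∉ (rep∉Z rep∈) (copy e act act′))))))
        where
        rep∈ = unpaired-rep x∉X un
      -- If `(x , b)` is inactive or in `Z`, the walk passes to `(x , not b)`. The rungs fail to
      -- match this copy, so it is a representative and can take the place of `d`.
      restart : Active (x , not b) → Unpaired (x , not b) → ⊥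
      restart act′ un = no-breaking-from w u′ (out ∘ there) act′ (rep∉Z rep∈) rep∈ ~-refl (λ _ e → e)
        where
        rep∈ = unpaired-rep x∉X un
      go : Dec (IsBr x) → ⊥
      go (yes s) with b 𝔹.≟ col x
      ... | yes eq = clash (inj₂ eq) (inj₁ (partner-br s))
      ... | no ne = restart (inj₂ (sym (¬-not (λ eq → ne (sym eq))))) (inj₁ (partner-br s))
      go (no ¬s) with unpaired? (x , b) | (x , b) ∈Z?
      ... | yes un | _ = clash (inj₁ ¬s) un
      ... | no pd | yes z = restart (inj₁ ¬s) (inj₂ (subst (_∈ˡ Z) (sym (trans (partner-¬br ¬s) (flip-involutive (x , b)))) z))
      -- Both copies of `x` lie outside `Z`, so the copy edge followed by the rung leads to a vertex
      -- still equivalent to `d`.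
      ... | no pd | no a∉ = no-breaking-from w u′ (out ∘ there) (inj₁ ¬s) q∉ d∈
              (~-trans a∉ (~-trans p∉ d~p (adjacent p∉ a∉ (copy e act (inj₁ ¬s)))) (adjacent a∉ q∉ (rung ¬s)))
              (λ v∈ eq → contradiction (subst (_∈ˡ trace proj₁ w) (old (there v∈) eq) v∈) (unique-head∉ u))
        where
        q∉ : (x , not b) ∉ˡ Z
        q∉ z = pd (inj₂ (subst (_∈ˡ Z) (sym (partner-¬br ¬s)) z))

    no-breaking : ∀ {i j} (w : Star AStep (own (br i)) (flip (own (br j)))) → Simple proj₁ w →
      (∀ {v} → v ∈ˡ trace proj₁ w → v ∉ X) → ⊥
    no-breaking {i} w u out = no-breaking-from w u out (inj₂ refl) (rep∉Z rep∈) rep∈ ~-refl (λ _ e → e)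
      where
      rep∈ = unpaired-rep (out (trace-source proj₁ w)) (inj₁ (partner-br (i , refl)))

  -- Breaking paths from a matching

  -- Each edge of an alternately coloured walk, seen in the auxiliary graph, joins the copies p and flip q.
  tokens : ∀ {x y} → Star AStep x y → List Coloured
  tokens ε = []
  tokens (_◅_ {i = p} {j = q} _ w) = p ∷ flip q ∷ tokens w

  tokens-◅◅ : ∀ {x y z} (w : Star AStep x y) (w′ : Star AStep y z) → tokens (w ◅◅ w′) ≡ tokens w ++ tokens w′
  tokens-◅◅ ε w′ = refl
  tokens-◅◅ (e ◅ w) w′ = cong (λ ts → _ ∷ _ ∷ ts) (tokens-◅◅ w w′)

  tokens-rev∈ : ∀ {x y} (w : Star AStep x y) {t} → t ∈ˡ tokens (revA w) → t ∈ˡ tokens w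
  tokens-rev∈ (_◅_ {i = p} e w) {t} t∈ with ∈-++⁻ (tokens (revA w)) (subst (t ∈ˡ_) (tokens-◅◅ (revA w) _) t∈)
  ... | inj₁ q = there (there (tokens-rev∈ w q))
  ... | inj₂ (here q) = there (here q)
  ... | inj₂ (there (here q)) = here (trans q (flip-involutive p))

  tokens-∈rev : ∀ {x y} (w : Star AStep x y) {t} → t ∈ˡ tokens w → t ∈ˡ tokens (revA w)
  tokens-∈rev (_◅_ {i = p} e w) {t} t∈ = subst (t ∈ˡ_) (sym (tokens-◅◅ (revA w) _)) (place t∈)
    where
    place : t ∈ˡ tokens (e ◅ w) → t ∈ˡ tokens (revA w) ++ _
    place (here q) = ∈-++⁺ʳ (tokens (revA w)) (there (here (trans q (sym (flip-involutive p)))))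
    place (there (here q)) = ∈-++⁺ʳ (tokens (revA w)) (here q)
    place (there (there q)) = ∈-++⁺ˡ (tokens-∈rev w q)

  tokens-rev-unique : ∀ {x y} (w : Star AStep x y) → Unique (tokens w) → Unique (tokens (revA w))
  tokens-rev-unique ε u = u
  tokens-rev-unique (_◅_ {i = p} {j = q} e w) u@(_ ∷ u′@(_ ∷ u″)) = subst Unique (sym (tokens-◅◅ (revA w) _))
    (unique-++ (tokens-rev-unique w u″)
      (unique-∷ (λ { (here eq) → unique-head∉ u (here (sym (trans eq (flip-involutive p)))) ; (there ()) }) ([] ∷ []))
      λ t∈ → λ { (here refl) → unique-head∉ u′ (tokens-rev∈ w t∈)
               ; (there (here refl)) → unique-head∉ u (there (subst (_∈ˡ tokens w) (flip-involutive p) (tokens-rev∈ w t∈))) })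

  arrival : ∀ {x y p} (w : Star AStep x y) → p ∈ˡ trace id w → flip p ∈ˡ flip x ∷ tokens w
  arrival ε (here refl) = here refl
  arrival (e ◅ w) (here refl) = here refl
  arrival (e ◅ w) (there p∈) = there (there (arrival w p∈))

  departure : ∀ {x y p} (w : Star AStep x y) → p ∈ˡ trace id w → p ≡ y ⊎ p ∈ˡ tokens w
  departure ε (here refl) = inj₁ refl
  departure (e ◅ w) (here refl) = inj₂ (here refl)
  departure (e ◅ w) (there p∈) = Sum.map₂ (λ t∈ → there (there t∈)) (departure w p∈)

  same-or-flip : ∀ {p q} → proj₁ p ≡ proj₁ q → p ≡ q ⊎ p ≡ flip q
  same-or-flip {v , a} {.v , b} refl with a 𝔹.≟ b
  ... | yes refl = inj₁ refl
  ... | no ne = inj₂ (cong (v ,_) (¬-not ne))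

  active-br : ∀ {k b} → Active (br k , b) → (br k , b) ≡ own (br k)
  active-br (inj₁ ¬s) = contradiction (_ , refl) ¬s
  active-br (inj₂ refl) = refl

  -- A return to the vertex of `x` would use the token `x` a second time: on arrival if the colour
  -- is flipped, on departure if it is the same. Nor can the walk end there in the same colour, as
  -- `x` is active and the final copy is not.
  tokens-simple : ∀ {x j} (w : Star AStep x (flip (own (br j)))) → Unique (tokens w) → (∀ {t} → t ∈ˡ tokens w → Active t) →
    Simple proj₁ w
  tokens-simple ε _ _ = [] ∷ []
  tokens-simple {x} {j} (e ◅ w) u@(_ ∷ _ ∷ u′) act = unique-∷ x∉ (tokens-simple w u′ (λ t∈ → act (there (there t∈))))
    where
    x∉ : proj₁ x ∉ˡ trace proj₁ w
    x∉ v∈ with ∈-map⁻ proj₁ (subst (proj₁ x ∈ˡ_) (trace-∘ id proj₁ w) v∈)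
    ... | p , p∈ , eq with same-or-flip {p} {x} (sym eq)
    ...   | inj₂ refl = unique-head∉ u (subst (_∈ˡ _) (flip-involutive x) (arrival w p∈))
    ...   | inj₁ refl with departure w p∈
    ...     | inj₂ t∈ = unique-head∉ u (there t∈)
    ...     | inj₁ refl = flip-≢ (active-br (act (here refl)))

  -- An inner vertex uses both of its copies as tokens, an end its own one. Hence disjointness of
  -- tokens forces disjointness of the paths in `G`.
  own-token : ∀ {x y} (w : Star AStep x y) {T : List Coloured} → (∀ {t} → t ∈ˡ tokens w → t ∈ˡ T) →
    own (proj₁ x) ∈ˡ T → own (proj₁ y) ∈ˡ T → ∀ {v} → v ∈ˡ trace proj₁ w → own v ∈ˡ T
  own-token ε sub ox oy (here refl) = ox
  own-token (e ◅ w) sub ox oy (here refl) = ox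
  own-token (e ◅ ε) sub ox oy (there (here refl)) = oy
  own-token (_◅_ {j = q} e w@(_ ◅ _)) sub ox oy (there v∈) = own-token w (λ t∈ → sub (there (there t∈))) oq oy v∈
    where
    oq : own (proj₁ q) ∈ˡ _
    oq with same-or-flip {own (proj₁ q)} {q} refl
    ... | inj₁ eq = subst (_∈ˡ _) (sym eq) (sub (there (there (here refl))))
    ... | inj₂ eq = subst (_∈ˡ _) (sym eq) (sub (there (here refl)))

  -- In the auxiliary graph the segment ends at `x` and at `flip y`. Both are tokens of the track,
  -- so disjoint token lists give different segments different ends.
  record Segment : Set where
    field
      {x y} : Coloured
      track  : Star AStep x y
      x∈    : x ∈ˡ tokens track
      y∈    : flip y ∈ˡ tokens track
      x≢y   : x ≢ flip y

  open Segment using (track; x∈; y∈; x≢y)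

  toks : Segment → List Coloured
  toks g = tokens (track g)

  -- Besides branch vertices, segments may end at vertices of `open-ends`; these are resolved one by
  -- one until the list is empty.
  record Proper (open-ends : List (Fin n)) (g : Segment) : Set where
    open Segment g using (x; y)
    field
      active : ∀ {t} → t ∈ˡ toks g → Active t
      inner¬br : ∀ {p} → p ∈ˡ trace id (track g) → p ≡ x ⊎ p ≡ y ⊎ ¬ IsBr (proj₁ p)
      x-end  : IsBr (proj₁ x) ⊎ proj₁ x ∈ˡ open-ends
      y-end  : IsBr (proj₁ y) ⊎ proj₁ y ∈ˡ open-ends

  open Proper

  reverseG : Segment → Segment
  reverseG g = record { track = revA (track g) ; x∈ = tokens-∈rev (track g) (y∈ g)
    ; y∈ = tokens-∈rev (track g) (subst (_∈ˡ toks g) (sym (flip-involutive _)) (x∈ g))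
    ; x≢y = λ e → x≢y g (sym (trans e (flip-involutive _))) }

  reverse-proper : ∀ {vs g} → Proper vs g → Proper vs (reverseG g)
  reverse-proper {vs} {g} ok = record
    { active = active ok ∘ tokens-rev∈ (track g)
    ; inner¬br = λ {p} p∈ → case ∈-map⁻ flip (subst (p ∈ˡ_) (trace-∘ id flip (track g))
        (revA⁻ id (track g) p∈)) of λ where
          (p′ , p′∈ , refl) → case inner¬br ok p′∈ of λ where
            (inj₁ refl) → inj₂ (inj₁ refl)
            (inj₂ (inj₁ refl)) → inj₁ refl
            (inj₂ (inj₂ ¬s)) → inj₂ (inj₂ ¬s)
    ; x-end = y-end ok ; y-end = x-end ok }

  allTokens : List Segment → List Coloured
  allTokens [] = []
  allTokens (g ∷ gs) = toks g ++ allTokens gs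

  allTokens⁺ : ∀ {g gs t} → g ∈ˡ gs → t ∈ˡ toks g → t ∈ˡ allTokens gs
  allTokens⁺ (here refl) t∈ = ∈-++⁺ˡ t∈
  allTokens⁺ {gs = g ∷ _} (there g∈) t∈ = ∈-++⁺ʳ (toks g) (allTokens⁺ g∈ t∈)

  Segments : List (Fin n) → List Segment → Set
  Segments vs gs = Unique (allTokens gs) × All (Proper vs) gs

  Untouched : Coloured → Segment → Set
  Untouched t g = Segment.x g ≢ t × flip (Segment.y g) ≢ t

  record Pulled (t : Coloured) (gs : List Segment) : Set where
    field
      {g}   : Segment
      {rest} : List Segment
      ends  : flip (Segment.y g) ≡ t
      size  : length gs ≡ suc (length rest)
      keep  : ∀ {vs} → Segments vs gs → Segments vs (g ∷ rest)
      sub   : ∀ {h} → h ∈ˡ rest → h ∈ˡ gs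
      sub-tokens : ∀ {t} → t ∈ˡ allTokens (g ∷ rest) → t ∈ˡ allTokens gs

  -- A segment that begins at `t` is reversed, so that joining two segments only has to deal with
  -- final ends.
  pull : ∀ t gs → (∀ {g} → g ∈ˡ gs → Untouched t g) ⊎ Pulled t gs
  pull t [] = inj₁ λ ()
  pull t (g ∷ gs) with flip (Segment.y g) ≟ᶜ t | Segment.x g ≟ᶜ t | pull t gs
  ... | yes e | _ | _ = inj₂ record { ends = e ; size = refl ; keep = id ; sub = there ; sub-tokens = id }
  ... | no _ | yes e | _ = inj₂ record
        { g = reverseG g ; ends = trans (flip-involutive _) e ; size = refl
        ; keep = λ { (u , ok ∷ oks) → case unique-++⁻ (toks g) u of λ (u₁ , u₂ , d) →
            unique-++ (tokens-rev-unique (track g) u₁) u₂ (λ t∈ → d (tokens-rev∈ (track g) t∈)) , reverse-proper ok ∷ oks }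
        ; sub = there
        ; sub-tokens = λ t∈ → [ (λ p → ∈-++⁺ˡ (tokens-rev∈ (track g) p)) , ∈-++⁺ʳ (toks g) ]′ (∈-++⁻ (toks (reverseG g)) t∈) }
  ... | no ny | no nx | inj₁ none = inj₁ λ { (here refl) → nx , ny ; (there g∈) → none g∈ }
  ... | no _ | no _ | inj₂ p = inj₂ record
        { g = P.g ; rest = g ∷ P.rest ; ends = P.ends ; size = cong suc P.size
        ; keep = λ { (u , ok ∷ oks) → case unique-++⁻ (toks g) u of λ (u₁ , u₂ , d) →
            case P.keep (u₂ , oks) of λ { (v , ok′ ∷ oks′) → case unique-++⁻ (toks P.g) v of λ (v₁ , v₂ , d′) →
              unique-++ v₁ (unique-++ u₁ v₂ (λ t∈ q → d t∈ (P.sub-tokens (∈-++⁺ʳ (toks P.g) q))))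
                (λ t∈ q → [ (λ q′ → d q′ (P.sub-tokens (∈-++⁺ˡ t∈))) , d′ t∈ ]′ (∈-++⁻ (toks g) q)) ,
              ok′ ∷ ok ∷ oks′ } }
        ; sub = λ { (here e) → here e ; (there h∈) → there (P.sub h∈) }
        ; sub-tokens = λ t∈ → [ (λ q → ∈-++⁺ʳ (toks g) (P.sub-tokens (∈-++⁺ˡ q))) ,
            (λ q → [ ∈-++⁺ˡ , (λ q′ → ∈-++⁺ʳ (toks g) (P.sub-tokens (∈-++⁺ʳ (toks P.g) q′))) ]′ (∈-++⁻ (toks g) q)) ]′
            (∈-++⁻ (toks P.g) t∈) }
    where module P = Pulled p

  untouched-others : ∀ {vs g rest t} → Segments vs (g ∷ rest) → t ∈ˡ toks g → ∀ {h} → h ∈ˡ rest → Untouched t h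
  untouched-others {g = g} (u , _) t∈ {h} h∈ =
    (λ { refl → d t∈ (allTokens⁺ h∈ (x∈ h)) }) , λ { refl → d t∈ (allTokens⁺ h∈ (y∈ h)) }
    where d = proj₂ (proj₂ (unique-++⁻ (toks g) u))

  segments-tail : ∀ {vs g gs} → Segments vs (g ∷ gs) → Segments vs gs
  segments-tail {g = g} (u , _ ∷ oks) = proj₁ (proj₂ (unique-++⁻ (toks g) u)) , oks

  close : ∀ {v vs gs} → Segments (v ∷ vs) gs → (∀ {g} → g ∈ˡ gs → ∀ b → Untouched (v , b) g) → Segments vs gs
  close {v} {vs} (u , oks) none = u , All.tabulate λ {g} g∈ → let ok = All.lookup oks g∈ in record
    { active = active ok ; inner¬br = inner¬br ok
    ; x-end = Sum.map₂ (λ { (here refl) → contradiction refl (proj₁ (none g∈ _)) ; (there p) → p }) (x-end ok)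
    ; y-end = Sum.map₂ (λ { (here refl) → contradiction refl (proj₂ (none g∈ _)) ; (there p) → p }) (y-end ok) }

  both : ∀ {Pr : Bool → Set} → Pr true → Pr false → ∀ b → Pr b
  both t f true = t
  both t f false = f

  -- The segments ending in the two copies of v are joined there; a segment with no counterpart is dropped.
  resolve : ∀ {v vs gs} → ¬ IsBr v → Segments (v ∷ vs) gs → ∃ λ gs′ → Segments vs gs′ × length gs ≤ suc (length gs′)
  resolve {v} {vs} {gs} ¬s st with pull (v , true) gs
  ... | inj₁ noneᵗ with pull (v , false) gs
  ...   | inj₁ noneᶠ = gs , close st (λ g∈ → both (noneᵗ g∈) (noneᶠ g∈)) , ℕ.n≤1+n _
  ...   | inj₂ record { g = B ; rest = rest ; ends = endB ; size = size ; keep = keep ; sub = sub } =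
          rest , close (segments-tail (keep st)) (λ g∈ → both (noneᵗ (sub g∈)) (untouched-others (keep st) (subst (_∈ˡ toks B) endB (y∈ B)) g∈)) ,
          ℕ.≤-reflexive size
  resolve {v} {vs} {gs} ¬s st | inj₂ record { g = A ; rest = rest ; ends = endA ; size = size ; keep = keep }
    with Segment.x A ≟ᶜ (v , false)
  -- Both ends of `A` are copies of `v`: it closes up at `v` and cannot become part of a path
  -- between branch vertices.
  ... | yes xA = rest , close (segments-tail (keep st)) (λ g∈ → both
          (untouched-others (keep st) (subst (_∈ˡ toks A) endA (y∈ A)) g∈)
          (untouched-others (keep st) (subst (_∈ˡ toks A) xA (x∈ A)) g∈)) , ℕ.≤-reflexive size
  ... | no xA≢ with pull (v , false) rest
  ...   | inj₁ noneᶠ = rest , close (segments-tail (keep st)) (λ g∈ → both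
          (untouched-others (keep st) (subst (_∈ˡ toks A) endA (y∈ A)) g∈) (noneᶠ g∈)) , ℕ.≤-reflexive size
  ...   | inj₂ record { g = B ; rest = rest′ ; ends = endB ; size = size′ ; keep = keep′ ; sub = sub′ ; sub-tokens = subT } =
          M ∷ rest′ , close (u′ , okM ∷ proj₂ (segments-tail stB)) untouched , ℕ.≤-reflexive (trans size (cong suc size′))
    where
    module A = Segment A
    module B = Segment B
    stA : Segments (v ∷ vs) (A ∷ rest)
    stA = keep st
    stB : Segments (v ∷ vs) (B ∷ rest′)
    stB = keep′ (segments-tail stA)
    dA : ∀ {t} → t ∈ˡ toks A → t ∉ˡ allTokens rest
    dA = proj₂ (proj₂ (unique-++⁻ (toks A) (proj₁ stA)))
    dAB : ∀ {t} → t ∈ˡ toks A → t ∉ˡ toks B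
    dAB t∈ t∈′ = dA t∈ (subT (∈-++⁺ˡ t∈′))
    okA = All.head (proj₂ stA)
    okB = All.head (proj₂ stB)
    -- The final tokens of `A` and `B` are the two copies of `v`, so `B` reversed with flipped
    -- colours starts exactly where `A` ends.
    yA : A.y ≡ flip (B.y)
    yA = trans (sym (flip-involutive A.y)) (trans (cong flip endA) (sym endB))
    back : Star AStep A.y (flip B.x)
    back = subst (λ p → Star AStep p (flip B.x)) (sym yA) (revA B.track)
    tokens-back : ∀ {p q q′} (e : q ≡ q′) (w : Star AStep q p) → tokens (subst (λ q → Star AStep q p) e w) ≡ tokens w
    tokens-back refl w = refl
    trace-back : ∀ {p q q′} (e : q ≡ q′) (w : Star AStep q p) → trace id (subst (λ q → Star AStep q p) e w) ≡ trace id w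
    trace-back refl w = refl
    joinT : tokens (A.track ◅◅ back) ≡ toks A ++ tokens (revA B.track)
    joinT = trans (tokens-◅◅ A.track back) (cong (toks A ++_) (tokens-back (sym yA) (revA B.track)))
    join⁻ : ∀ {t} → t ∈ˡ tokens (A.track ◅◅ back) → t ∈ˡ toks A ⊎ t ∈ˡ toks B
    join⁻ {t} t∈ = Sum.map₂ (tokens-rev∈ B.track) (∈-++⁻ (toks A) (subst (t ∈ˡ_) joinT t∈))
    M : Segment
    M = record { track = A.track ◅◅ back
      ; x∈ = subst (A.x ∈ˡ_) (sym joinT) (∈-++⁺ˡ A.x∈)
      ; y∈ = subst (_ ∈ˡ_) (sym joinT) (∈-++⁺ʳ (toks A) (tokens-∈rev B.track (subst (_∈ˡ toks B) (sym (flip-involutive B.x)) B.x∈)))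
      ; x≢y = λ e → dAB A.x∈ (subst (_∈ˡ toks B) (sym (trans e (flip-involutive B.x))) B.x∈) }
    u′ : Unique (allTokens (M ∷ rest′))
    u′ = unique-++ (subst Unique (sym joinT) (unique-++ (proj₁ (unique-++⁻ (toks A) (proj₁ stA)))
            (tokens-rev-unique B.track (proj₁ (unique-++⁻ (toks B) (proj₁ stB)))) (λ t∈ t∈′ → dAB t∈ (tokens-rev∈ B.track t∈′))))
          (proj₁ (proj₂ (unique-++⁻ (toks B) (proj₁ stB))))
          (λ t∈ t∈′ → [ (λ p → dA p (subT (∈-++⁺ʳ (toks B) t∈′))) ,
            (λ p → proj₂ (proj₂ (unique-++⁻ (toks B) (proj₁ stB))) p t∈′) ]′ (join⁻ t∈))
    okM : Proper (v ∷ vs) M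
    okM = record
      { active = λ t∈ → [ active okA , active okB ]′ (join⁻ t∈)
      ; inner¬br = λ {p} p∈ → case trace-◅◅⁻ id A.track p∈ of λ where
          (inj₁ q) → case inner¬br okA q of λ where
            (inj₁ r) → inj₁ r
            (inj₂ (inj₁ refl)) → inj₂ (inj₂ (λ s → ¬s (subst IsBr (cong proj₁ endA) s)))
            (inj₂ (inj₂ r)) → inj₂ (inj₂ r)
          (inj₂ q) → case inner¬br (reverse-proper okB) (subst (p ∈ˡ_) (trace-back (sym yA) (revA B.track)) q) of λ where
            (inj₁ refl) → inj₂ (inj₂ (λ s → ¬s (subst IsBr (cong proj₁ endB) s)))
            (inj₂ r) → inj₂ r
      ; x-end = x-end okA ; y-end = x-end okB }
    untouched : ∀ {g} → g ∈ˡ M ∷ rest′ → ∀ b → Untouched (v , b) g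
    untouched (here refl) = both
      ((λ e → A.x≢y (trans e (sym endA))) ,
       λ e → dAB (subst (_∈ˡ toks A) endA A.y∈) (subst (_∈ˡ toks B) (trans (sym (flip-involutive B.x)) e) B.x∈))
      (xA≢ , λ e → B.x≢y (trans (sym (flip-involutive B.x)) (trans e (sym endB))))
    untouched (there g∈) = both (untouched-others stA (subst (_∈ˡ toks A) endA A.y∈) (sub′ g∈))
      (untouched-others stB (subst (_∈ˡ toks B) endB B.y∈) g∈)

  resolve-all : ∀ vs {gs} → (∀ {v} → v ∈ˡ vs → ¬ IsBr v) → Segments vs gs →
    ∃ λ gs′ → Segments [] gs′ × length gs ≤ length vs + length gs′
  resolve-all [] _ st = _ , st , ℕ.≤-refl
  resolve-all (v ∷ vs) ¬s st with resolve (¬s (here refl)) st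
  ... | gs₁ , st₁ , le₁ with resolve-all vs (¬s ∘ there) st₁
  ...   | gs₂ , st₂ , le₂ = gs₂ , st₂ , ℕ.≤-trans le₁ (s≤s le₂)

  segment⇒bpath : ∀ {g} → Proper [] g → Unique (toks g) → Σ BPath λ p → ∀ {v} → v ∈ˡ vertices p → own v ∈ˡ toks g
  segment⇒bpath {record { x = x ; y = y ; track = w ; x∈ = x∈ ; y∈ = y∈ }} ok u
    with x-end ok | y-end ok
  ... | inj₁ (i , refl) | inj₁ (j , eq) = build (active-br (active ok x∈)) w x∈ y∈ (active ok) (inner¬br ok) u
        (trans (sym (flip-involutive y)) (cong flip (fl eq (active ok y∈))))
    where
    fl : ∀ {y} → br j ≡ proj₁ y → Active (flip y) → flip y ≡ own (br j)
    fl refl a = active-br a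
    build : ∀ {x y} → x ≡ own (br i) → (w : Star AStep x y) → x ∈ˡ tokens w → flip y ∈ˡ tokens w →
      (∀ {t} → t ∈ˡ tokens w → Active t) → (∀ {p} → p ∈ˡ trace id w → p ≡ x ⊎ p ≡ y ⊎ ¬ IsBr (proj₁ p)) →
      Unique (tokens w) → y ≡ flip (own (br j)) → Σ BPath λ p → ∀ {v} → v ∈ˡ vertices p → own v ∈ˡ tokens w
    build refl w x∈ y∈ act inn u refl = record
      { ia = i ; ib = j ; walk = w ; simple = tokens-simple w u act
      ; inside = λ k k∈ → case ∈-map⁻ proj₁ (subst (br k ∈ˡ_) (trace-∘ id proj₁ w) k∈) of λ (p , p∈ , e) → case inn p∈ of λ where
          (inj₁ refl) → inj₁ (br-inj k i e)
          (inj₂ (inj₁ refl)) → inj₂ (br-inj k j e)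
          (inj₂ (inj₂ ¬s)) → contradiction (k , e) ¬s } ,
      own-token w id x∈ (subst (_∈ˡ tokens w) (flip-involutive (own (br j))) y∈)

  segments⇒system : ∀ gs → Segments [] gs → Σ (System (length gs)) λ σ →
    ∀ {l v} → v ∈ˡ vertices (System.path σ l) → own v ∈ˡ allTokens gs
  segments⇒system [] _ = record { path = λ () ; disjoint = λ { {()} } } , λ { {()} }
  segments⇒system (g ∷ gs) (u , ok ∷ oks) with unique-++⁻ (toks g) u
  ... | u₁ , u₂ , d with segment⇒bpath ok u₁ | segments⇒system gs (u₂ , oks)
  ...   | p , p-toks | σ , σ-toks = record { path = path′ ; disjoint = λ {l} {l′} → disj l l′ } , λ {l} → toks′ l
    where
    path′ : Fin (suc (length gs)) → BPath
    path′ zero = p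
    path′ (suc l) = System.path σ l
    toks′ : ∀ l {v} → v ∈ˡ vertices (path′ l) → own v ∈ˡ toks g ++ allTokens gs
    toks′ zero v∈ = ∈-++⁺ˡ (p-toks v∈)
    toks′ (suc l) v∈ = ∈-++⁺ʳ (toks g) (σ-toks v∈)
    disj : ∀ l l′ {v} → v ∈ˡ vertices (path′ l) → v ∈ˡ vertices (path′ l′) → l ≡ l′
    disj zero zero _ _ = refl
    disj zero (suc l′) p q = contradiction (σ-toks q) (d (p-toks p))
    disj (suc l) zero p q = contradiction (σ-toks p) (d (p-toks q))
    disj (suc l) (suc l′) p q = cong suc (System.disjoint σ p q)

  rung-inv : ∀ {p q} → HEdge p q → proj₁ p ≡ proj₁ q → ¬ IsBr (proj₁ p) × q ≡ flip p
  rung-inv (copy {v} e _ _) refl = case trans (sym e) (Graph.irrefl G v) of λ ()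
  rung-inv (rung ¬s) _ = ¬s , refl

  copy-inv : ∀ {p q} → HEdge p q → proj₁ p ≢ proj₁ q → AStep p (flip q) × Active p × Active q
  copy-inv (copy e a a′) _ = (e , refl) , a , a′
  copy-inv (rung _) ne = contradiction refl ne

  module Extraction {μ : Coloured → Coloured} (matching : IsMatching [] μ) where

    μ-involutive : ∀ p → μ (μ p) ≡ p
    μ-involutive = proj₁ matching

    edge : ∀ {p} → μ p ≢ p → HEdge p (μ p)
    edge {p} ne = does⇒ (hEdge? p (μ p)) (proj₁ (proj₂ matching p ne))

    pairs copies rungs : List Coloured
    pairs = raised finiteColoured μ univ
    copies = filter (λ p → ¬? (proj₁ p F.≟ proj₁ (μ p))) pairs
    rungs = filter (λ p → proj₁ p F.≟ proj₁ (μ p)) pairs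

    halves-unique : Unique (pairs ++ map μ pairs)
    halves-unique = involution-halves-unique finiteColoured μ μ-involutive univ-unique (λ _ → univ-complete _)

    pairs-unique : Unique pairs
    pairs-unique = proj₁ (unique-++⁻ pairs halves-unique)

    pairs-moved : ∀ {p} → p ∈ˡ pairs → μ p ≢ p
    pairs-moved {p} p∈ e = ℕ.<⇒≢ (proj₂ (raised∈ finiteColoured μ μ-involutive univ-unique (λ _ → univ-complete _) p∈))
      (cong (toℕ ∘ Finite.idx finiteColoured) (sym e))

    rungs⁻ : ∀ {p} → p ∈ˡ rungs → p ∈ˡ pairs × ¬ IsBr (proj₁ p) × μ p ≡ flip p
    rungs⁻ p∈ with ∈-filter⁻ (λ p → proj₁ p F.≟ proj₁ (μ p)) {xs = pairs} p∈
    ... | p∈′ , e = p∈′ , rung-inv (edge (pairs-moved p∈′)) e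

    -- If the rung of a vertex is matched, both its copies are taken and no copy edge of the
    -- matching meets it. So only branch vertices and these vertices can be ends of the initial
    -- segments.
    unmatchedRungs : List (Fin n)
    unmatchedRungs = filter (λ v → ¬? (isBr? v) ×-dec ¬? (μ (v , true) ≟ᶜ (v , false))) (allFin n)

    unmatchedRungs⁻ : ∀ {v} → v ∈ˡ unmatchedRungs → ¬ IsBr v × μ (v , true) ≢ (v , false)
    unmatchedRungs⁻ v∈ = proj₂ (∈-filter⁻ (λ v → ¬? (isBr? v) ×-dec ¬? (μ (v , true) ≟ᶜ (v , false))) {xs = allFin n} v∈)

    open-end : ∀ q → proj₁ (μ q) ≢ proj₁ q → IsBr (proj₁ q) ⊎ proj₁ q ∈ˡ unmatchedRungs
    open-end (v , b) ne with isBr? v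
    ... | yes s = inj₁ s
    ... | no ¬s = inj₂ (∈-filter⁺ _ (∈-allFin v) (¬s , not-rung b ne))
      where
      not-rung : ∀ b → proj₁ (μ (v , b)) ≢ v → μ (v , true) ≢ (v , false)
      not-rung true ne e = ne (cong proj₁ e)
      not-rung false ne e = ne (cong proj₁ (trans (cong μ (sym e)) (μ-involutive (v , true))))

    initial-segments : ∀ ps → (∀ {p} → p ∈ˡ ps → μ p ≢ p × proj₁ p ≢ proj₁ (μ p)) → Unique (ps ++ map μ ps) →
      ∃ λ gs → length gs ≡ length ps × Segments unmatchedRungs gs × (∀ {t} → t ∈ˡ allTokens gs → t ∈ˡ ps ++ map μ ps)
    initial-segments [] _ _ = [] , refl , ([] , []) , λ ()
    initial-segments (p ∷ ps) ok u with unique-++⁻ (p ∷ ps) u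
    ... | uₚ@(_ ∷ u₁) , uₘ@(_ ∷ u₂) , d with initial-segments ps (ok ∘ there) (unique-++ u₁ u₂ (λ x∈ y∈ → d (there x∈) (there y∈)))
    ...   | gs , len , (ug , oks) , sub = g ∷ gs , cong suc len ,
              (unique-++ g-unique ug separate , g-proper ∷ oks) , sub′
      where
      split-edge = copy-inv (edge (proj₁ (ok (here refl)))) (proj₂ (ok (here refl)))
      g : Segment
      g = record { track = proj₁ split-edge ◅ ε ; x∈ = here refl ; y∈ = there (here refl)
        ; x≢y = λ e → proj₁ (ok (here refl)) (sym (trans e (flip-involutive (μ p)))) }
      g-tokens : ∀ {t} → t ∈ˡ toks g → t ≡ p ⊎ t ≡ μ p
      g-tokens (here e) = inj₁ e
      g-tokens (there (here e)) = inj₂ (trans e (flip-involutive (μ p)))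
      g-unique : Unique (toks g)
      g-unique = unique-∷ (λ { (here e) → Segment.x≢y g e ; (there ()) }) ([] ∷ [])
      separate : ∀ {t} → t ∈ˡ toks g → t ∉ˡ allTokens gs
      separate t∈ t∈′ with g-tokens t∈ | ∈-++⁻ ps (sub t∈′)
      ... | inj₁ refl | inj₁ q = unique-head∉ uₚ q
      ... | inj₁ refl | inj₂ q = d (here refl) (there q)
      ... | inj₂ refl | inj₁ q = d (there q) (here refl)
      ... | inj₂ refl | inj₂ q = unique-head∉ uₘ q
      g-proper : Proper unmatchedRungs g
      g-proper = record
        { active = λ t∈ → case g-tokens t∈ of λ where
            (inj₁ refl) → proj₁ (proj₂ split-edge)
            (inj₂ refl) → proj₂ (proj₂ split-edge)
        ; inner¬br = λ { (here e) → inj₁ e ; (there (here e)) → inj₂ (inj₁ e) }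
        ; x-end = open-end p (λ e → proj₂ (ok (here refl)) (sym e))
        ; y-end = open-end (μ p) (λ e → proj₂ (ok (here refl)) (trans (cong proj₁ (sym (μ-involutive p))) e)) }
      sub′ : ∀ {t} → t ∈ˡ toks g ++ allTokens gs → t ∈ˡ (p ∷ ps) ++ map μ (p ∷ ps)
      sub′ t∈ with ∈-++⁻ (toks g) t∈
      ... | inj₂ q = [ (λ q′ → ∈-++⁺ˡ (there q′)) , (λ q′ → ∈-++⁺ʳ (p ∷ ps) (there q′)) ]′ (∈-++⁻ ps (sub q))
      ... | inj₁ q with g-tokens q
      ...   | inj₁ refl = here refl
      ...   | inj₂ refl = ∈-++⁺ʳ (p ∷ ps) (here refl)

    copies⁻ : ∀ {p} → p ∈ˡ copies → μ p ≢ p × proj₁ p ≢ proj₁ (μ p)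
    copies⁻ p∈ with ∈-filter⁻ (λ p → ¬? (proj₁ p F.≟ proj₁ (μ p))) {xs = pairs} p∈
    ... | p∈′ , ne = pairs-moved p∈′ , ne

    copies-halves : Unique (copies ++ map μ copies)
    copies-halves = unique-++ (Uniq.filter⁺ _ pairs-unique)
      (unique-map μ (Uniq.filter⁺ _ pairs-unique) (λ {x} {y} _ _ e → trans (sym (μ-involutive x)) (trans (cong μ e) (μ-involutive y))))
      λ p q → case ∈-map⁻ μ q of λ { (y , y∈ , refl) → proj₂ (proj₂ (unique-++⁻ pairs halves-unique))
        (proj₁ (∈-filter⁻ (λ p → ¬? (proj₁ p F.≟ proj₁ (μ p))) {xs = pairs} p))
        (∈-map⁺ μ (proj₁ (∈-filter⁻ (λ p → ¬? (proj₁ p F.≟ proj₁ (μ p))) {xs = pairs} y∈))) }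

    pairs≤ : length pairs ≤ length copies + length rungs
    pairs≤ = subst (length pairs ≤_) (L.length-++ copies) (unique-⊆⇒length≤ pairs-unique λ {p} p∈ →
      case proj₁ p F.≟ proj₁ (μ p) of λ where
        (yes e) → ∈-++⁺ʳ copies (∈-filter⁺ (λ p → proj₁ p F.≟ proj₁ (μ p)) p∈ e)
        (no ne) → ∈-++⁺ˡ (∈-filter⁺ (λ p → ¬? (proj₁ p F.≟ proj₁ (μ p))) p∈ ne))

    vertices≤ : length unmatchedRungs + (length rungs + (s + r)) ≤ n
    vertices≤ = subst₂ _≤_
      (trans (L.length-++ unmatchedRungs) (cong (length unmatchedRungs +_) (trans (L.length-++ (map proj₁ rungs))
        (cong₂ _+_ (L.length-map proj₁ rungs) (trans (L.length-map br (allFin (s + r))) (L.length-tabulate id))))))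
      (L.length-tabulate id)
      (unique-⊆⇒length≤ {ys = allFin n} (unique-++ (Uniq.filter⁺ _ (Uniq.allFin⁺ n))
        (unique-++ (unique-map proj₁ (Uniq.filter⁺ _ pairs-unique) once) (Uniq.map⁺ (br-inj _ _) (Uniq.allFin⁺ (s + r)))
          λ p q → case ∈-map⁻ proj₁ p of λ { (x , x∈ , refl) → case ∈-map⁻ br q of λ (k , _ , e) →
            proj₁ (proj₂ (rungs⁻ x∈)) (k , sym e) })
        λ p q → case ∈-++⁻ (map proj₁ rungs) q of λ where
          (inj₁ q′) → case ∈-map⁻ proj₁ q′ of λ { (x , x∈ , refl) → proj₂ (unmatchedRungs⁻ p) (is-rung x (proj₂ (proj₂ (rungs⁻ x∈)))) }
          (inj₂ q′) → case ∈-map⁻ br q′ of λ { (k , _ , refl) → proj₁ (unmatchedRungs⁻ p) (k , refl) })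
        (λ _ → ∈-allFin _))
      where
      once : ∀ {x y} → x ∈ˡ rungs → y ∈ˡ rungs → proj₁ x ≡ proj₁ y → x ≡ y
      once {x} {y} x∈ y∈ e with same-or-flip {x} {y} e
      ... | inj₁ eq = eq
      ... | inj₂ eq = contradiction (subst (_∈ˡ map μ pairs) (trans (proj₂ (proj₂ (rungs⁻ y∈))) (sym eq)) (∈-map⁺ μ (proj₁ (rungs⁻ y∈))))
              (proj₂ (proj₂ (unique-++⁻ pairs halves-unique)) (proj₁ (rungs⁻ x∈)))
      is-rung : ∀ x → μ x ≡ flip x → μ (proj₁ x , true) ≡ (proj₁ x , false)
      is-rung (v , true) e = e
      is-rung (v , false) e = trans (cong μ (sym e)) (μ-involutive (v , false))

    size-total : n + n ≡ deficiency μ + (length pairs + length pairs)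
    size-total = trans (sym univ-size) (involution-count finiteColoured μ μ-involutive univ-unique (λ _ → univ-complete _))
      where
      univ-size : length univ ≡ n + n
      univ-size = trans (L.length-map (Finite.at finiteColoured) (allFin (n * 2)))
        (trans (L.length-tabulate id) (trans (ℕ.*-comm n 2) (cong (n +_) (ℕ.+-identityʳ n))))

    -- Every resolved vertex costs at most one segment. The bound says that there are at least as
    -- many paths as `μ` has edges in excess of the matching of all rungs.
    extraction : ∃ λ gs → Segments [] gs × (s + r) + (s + r) ≤ deficiency μ + (length gs + length gs)
    extraction =
      let gs₀ , len , st , _ = initial-segments copies copies⁻ copies-halves
          gs , st′ , le = resolve-all unmatchedRungs (proj₁ ∘ unmatchedRungs⁻) st
      in gs , st′ , count-bound (deficiency μ) (length pairs) (length copies) (length rungs)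
           (length unmatchedRungs) (length gs) (s + r) n size-total pairs≤ vertices≤ (subst (_≤ length unmatchedRungs + length gs) len le)

  -- The dichotomy and the conclusion

  NoBreaking : Subset n → Set
  NoBreaking X = ∀ {i j} (w : Star AStep (own (br i)) (flip (own (br j)))) → Simple proj₁ w →
    (∀ {v} → v ∈ˡ trace proj₁ w → v ∉ X) → ⊥

  shrink : ∀ {k l} → k ≤ l → System l → System k
  shrink le σ = record { path = System.path σ ∘ λ i → inject≤ i le
    ; disjoint = λ p q → F.inject≤-injective le le _ _ (System.disjoint σ p q) }

  system-or-hitting-set : ∀ k → System k ⊎ Σ (Subset n) λ X → ∣ X ∣ + 2 ≤ k + k × NoBreaking X
  system-or-hitting-set k = from barrier
    where
    from : Barrier → System k ⊎ Σ (Subset n) λ X → ∣ X ∣ + 2 ≤ k + k × NoBreaking X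
    from B = decide (Extraction.extraction (Barrier.m₀-matching B))
      where
      open Hitting B
      δ = deficiency (Barrier.m₀ B)
      decide : (∃ λ gs → Segments [] gs × (s + r) + (s + r) ≤ δ + (length gs + length gs)) →
        System k ⊎ Σ (Subset n) λ X → ∣ X ∣ + 2 ≤ k + k × NoBreaking X
      decide (gs , st , le) with k ℕ.≤? length gs
      ... | yes k≤ = inj₁ (shrink k≤ (proj₁ (segments⇒system gs st)))
      ... | no k≰ = inj₂ (X , ℕ.≤-trans (ℕ.+-monoˡ-≤ 2 X≤) two , no-breaking)
        where
        -- Hitting set and paths are measured against the same deficiency `δ`, which cancels.
        X≤ : ∣ X ∣ ≤ length gs + length gs
        X≤ = ℕ.+-cancelʳ-≤ δ _ _ (ℕ.≤-trans X-small (ℕ.≤-trans le (ℕ.≤-reflexive (ℕ.+-comm δ _))))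
        two : length gs + length gs + 2 ≤ k + k
        two = ℕ.≤-trans (ℕ.≤-reflexive (trans (ℕ.+-comm _ 2) (cong suc (sym (ℕ.+-suc _ _))))) (ℕ.+-mono-≤ (ℕ.≰⇒> k≰) (ℕ.≰⇒> k≰))

  conclusion : ∀ k → s ≡ k + k → r ≡ suc k → 1 ≤ k → ¬ HasOddKMinor G (suc k) →
    Σ (Subset n) λ X → ∣ X ∣ + 2 ≤ s × Σ (Subset n) λ U → Σ (Fin n → Fin n → Set) λ F →
      IsBlock G (λ x → x ∉ X) (mkSub U F) × Bipartite (mkSub U F) × r + 3 ≤ ∣ U ∣
  -- The ear construction is attempted for every small `X`. The hitting set refutes that all
  -- attempts end in a breaking path; the `X` returned is any one that yields a block.
  conclusion k s≡ r≡ 1≤k no-minor = search-subsets attempt (refute (system-or-hitting-set k))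
    where
    Found : Subset n → Set₁
    Found X = Σ (Subset n) λ U → Σ (Fin n → Fin n → Set) λ F →
      IsBlock G (λ x → x ∉ X) (mkSub U F) × Bipartite (mkSub U F) × r + 3 ≤ ∣ U ∣
    1≤r : 1 ≤ r
    1≤r = subst (1 ≤_) (sym r≡) (s≤s z≤n)
    i₀ : Fin m
    i₀ = s ↑ʳ fromℕ< 1≤r
    i₀∉K : ¬ Clique i₀
    i₀∉K lt = ℕ.<⇒≱ lt (subst (s ≤_) (sym (F.toℕ-↑ʳ s _)) (ℕ.m≤m+n s _))
    deletion : ∀ X → ∣ X ∣ + 2 ≤ s → Deletion
    deletion X small = record { X = X ; i₀ = i₀ ; i₀∉K = i₀∉K ; small = small }
    Missed : Subset n → Set
    Missed X = ∣ X ∣ + 2 ≤ s → ¬ NoBreaking X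
    translate : ∀ X (small : ∣ X ∣ + 2 ≤ s) → Found X ⊎ Avoiding.Breaking (deletion X small) → (∣ X ∣ + 2 ≤ s × Found X) ⊎ Missed X
    translate X small (inj₁ found) = inj₁ (small , found)
    translate X small (inj₂ record { walk = w ; simple = u ; avoids = out }) = inj₂ λ _ none → none w u out
    attempt : ∀ X → (∣ X ∣ + 2 ≤ s × Found X) ⊎ Missed X
    attempt X = [ (λ small → translate X small (Avoiding.block-or-breaking (deletion X small) r refl 1≤r)) ,
                  (λ large → inj₂ λ small → contradiction small large) ]′ (toSum ((∣ X ∣ + 2) ℕ.≤? s))
    refute : (System k ⊎ Σ (Subset n) λ X → ∣ X ∣ + 2 ≤ k + k × NoBreaking X) → ¬ (∀ X → Missed X)
    refute (inj₁ σ) _ = no-minor (system⇒oddMinor s≡ r≡ σ)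
    refute (inj₂ (X , small , hits)) missed = missed X (subst (∣ X ∣ + 2 ≤_) (sym s≡) small) hits

2t-2≡k+k : ∀ k → 2 * suc k ∸ 2 ≡ k + k
2t-2≡k+k k = trans (cong (_∸ 1) (ℕ.+-suc k (k + 0))) (cong (k +_) (ℕ.+-identityʳ k))

-- The bound is carried as `∣ X ∣ + 2` through all counts, and truncated subtraction enters only
-- here.
move-2 : ∀ {n a t} {A : Subset n → Set a} → (Σ (Subset n) λ X → ∣ X ∣ + 2 ≤ 2 * t ∸ 2 × A X) →
  Σ (Subset n) λ X → ∣ X ∣ ≤ 2 * t ∸ 4 × A X
move-2 {t = t} (X , small , a) = X , subst (∣ X ∣ ≤_) (ℕ.∸-+-assoc (2 * t) 2 2) (ℕ.m+n≤o⇒m≤o∸n ∣ X ∣ small) , a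

theorem3p5 : (t : ℕ) → 2 ≤ t → (G : Graph) →
    ¬ HasOddKMinor G t →
    HasBipartiteSubdivision G ((2 * t ∸ 2) + t) (KplusI (2 * t ∸ 2) t) →
    Σ (Subset (Graph.n G)) λ X → ∣ X ∣ ≤ 2 * t ∸ 4 ×
    Σ (Subset (Graph.n G)) λ U → Σ (Fin (Graph.n G) → Fin (Graph.n G) → Set) λ F →
    IsBlock G (λ x → x ∉ X) (mkSub U F) ×
    Bipartite (mkSub U F) ×
    t + 3 ≤ ∣ U ∣
theorem3p5 t@(suc k) (s≤s 1≤k) G no-minor (br , P , col , br-inj , P-path , P-disjoint) =
  move-2 {t = t} (Setup.conclusion subdivision k (2t-2≡k+k k) refl 1≤k no-minor)
  where
  subdivision : Subdivision
  subdivision = record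
    { G = G ; s = 2 * t ∸ 2 ; r = t ; br = br ; P = P ; col = col
    ; br-inj = br-inj ; P-path = P-path ; P-disjoint = P-disjoint }
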